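{- Let $p$ be an odd prime and $D_{2p}=\langle \tau,\sigma\mid \tau^p=\sigma^2=e,\ \sigma\tau\sigma=\tau^{ -1}\rangle$. The number of Cayley graphs on $D_{2p}$ up to isomorphism (i.e. isomorphism classes of $\mathrm{Cay}(D_{2p},S)$ with $S\subseteq D_{2p}\setminus\{e\}$, $S=S^{ -1}$) is $$\mathcal{N}'=\frac{1}{p}\left(2^{\frac{p+1}{2}}-2^{\frac{3p-1}{2}}\right)+\frac{2}{p-1}\sum_{i=0}^{p-2}2^{\frac{\gcd(2i,p-1)}{2}+\gcd(i,p-1)}.$$
   Context: For a finite group $G$ and $S\subseteq G$ with $e\notin S$ and $S^{ -1}=\{s^{ -1}\mid s\in S\}=S$, the Cayley graph $\mathrm{Cay}(G,S)$ is the undirected graph with vertex set $G$ in which $g,h$ are adjacent whenever $hg^{ -1}\in S$. Here $\gcd(0,p-1)=p-1$. -}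

module Defs where

open import Data.Nat using (ℕ; zero; suc; _∸_; _+_; NonZero)
open import Data.Nat.DivMod using (_mod_)
open import Data.Fin using (Fin; toℕ)
open import Data.Bool using (Bool; true; false; if_then_else_; _xor_)
open import Data.Product using (_×_; _,_; Σ; proj₁)
open import Data.Integer using (ℤ)
open import Data.Rational using (ℚ; 0ℚ; _/_)
open import Relation.Binary.PropositionalEquality using (_≡_)
open import Function.Bundles using (_↔_; _⇔_; Inverse)

-- Concrete model of the dihedral group D_{2n} = ⟨τ,σ | τ^n = σ^2 = e, στσ = τ⁻¹⟩:
-- the pair (a , b) stands for τ^a σ^b  (a ∈ ℤ/n, b ∈ {0,1} with true = 1).
module Dihedral (n : ℕ) .{{_ : NonZero n}} where

  D : Set
  D = Fin n × Bool

  e : D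
  e = (0 mod n , false)

  -- (τ^a σ^b)(τ^c σ^d) = τ^(a + (-1)^b c) σ^(b+d)
  _·_ : D → D → D
  (a , b) · (c , d) =
    ((toℕ a + (if b then n ∸ toℕ c else toℕ c)) mod n , b xor d)

  _⁻¹ : D → D
  (a , false) ⁻¹ = ((n ∸ toℕ a) mod n , false)
  (a , true) ⁻¹ = (a , true)

  Subset : Set
  Subset = D → Bool

  IsConnectionSet : Subset → Set
  IsConnectionSet S = (S e ≡ false) × (∀ g → S (g ⁻¹) ≡ S g)

  ConnectionSet : Set
  ConnectionSet = Σ Subset IsConnectionSet

  Adj : Subset → D → D → Set
  Adj S g h = S (h · (g ⁻¹)) ≡ true

  CayIso : Subset → Subset → Set
  CayIso S T = Σ (D ↔ D) λ f →
    ∀ g h → Adj S g h ⇔ Adj T (Inverse.to f g) (Inverse.to f h)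

-- n / d as a rational number (d = 0 only as a dummy case, unused here)
frac : ℤ → ℕ → ℚ
frac m zero = 0ℚ
frac m (suc d) = m / suc d

{-# OPTIONS --safe #-}

-- Cay(D₂ₚ, S) consists of two copies ("layers") of a circulant on ℤ/p with connection set R, joined
-- by x ~ y iff x + y ∈ Q.  The group D₂ₚ has the CI property: isomorphic graphs are related by an
-- affine map R′ = aR, Q′ = aQ + b.  To see this let ⟨ρ⟩ × ⟨ρ⟩, with ρ the right multiplication by τ,
-- act on the isomorphisms by f ↦ ρⁱ f ρʲ.  If none of them normalises ⟨ρ⟩, all orbits have p²
-- elements, so that p² divides the number of isomorphisms, which is the order of the automorphism
-- group; the same count there gives at least p² layer-preserving normalising automorphisms, two of
-- which must agree on one layer and differ by a translation on the other, so Q is constant.  Hence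
-- for non-constant Q there is a normalising isomorphism, which is affine.  For constant Q the layers
-- are preserved up to trivial cases, and the circulants are compared after adding a perfect matching.
--
-- The isomorphism classes are thus the orbits of the affine group of ℤ/p, which Burnside's lemma
-- counts: by a primitive root g the multiplier gⁱ acts on R as a shift by i on ℤ/((p-1)/2) and on
-- the non-zero part of Q as a shift by i on ℤ/(p-1), and a shift by i on ℤ/n has gcd(i,n) cycles.

module Submission where

open import Defs
open import Algebra.Bundles using (CommutativeRing)
open import Algebra.Structures using (IsGroup)
open import Data.Bool using (Bool; true; false; not)
open import Data.Fin using (Fin; toℕ)
open import Data.Integer using (ℤ)
open import Data.Integer.Solver using (module +-*-Solver)
open import Data.List using (List; []; _∷_; _++_; length; map; concatMap; filter; upTo; allFin)
open import Data.List.Membership.Propositional using (_∈_)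
open import Data.List.Relation.Unary.All using (All)
open import Data.List.Relation.Unary.AllPairs using (AllPairs)
open import Data.List.Relation.Unary.Any using (Any; here; there)
open import Data.Nat using (ℕ; zero; suc; _+_; _*_; _∸_; _^_; _≤_; _<_; z≤n; s≤s; NonZero)
open import Data.Nat.Coprimality using (Coprime)
open import Data.Nat.DivMod using (_/_; _%_; _mod_)
open import Data.Nat.Divisibility using (_∣_; divides)
open import Data.Nat.GCD using (gcd)
open import Data.Nat.Induction using (<-rec)
open import Data.Nat.ListAction using (sum)
open import Data.Nat.Primality using (Prime)
open import Data.Nat.Primality.Factorisation using (factorise)
open import Data.Nat.Tactic.RingSolver using (solve-∀)
open import Data.Product using (Σ; _×_; proj₁; proj₂; _,_; ∃)
open import Data.Product.Properties using (≡-dec)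
open import Data.Rational using () renaming (_+_ to _+ℚ_; _*_ to _*ℚ_)
open import Data.Rational.Unnormalised using (mkℚᵘ; *≡*; ↥_; ↧_; _≃_)
open import Data.Sum using (_⊎_; inj₁; inj₂)
open import Data.Unit using (⊤; tt)
open import Data.Vec using (Vec; []; _∷_; lookup; tabulate; replicate)
open import Function using (_∘_; id; case_of_)
open import Function.Bundles using (_⇔_; mk⇔; mk↔ₛ′; module Inverse; module Equivalence)
open import Function.Definitions using (Injective)
open import Level using (0ℓ)
open import Relation.Binary using (DecidableEquality)
open import Relation.Binary.PropositionalEquality using (_≡_; _≢_; refl; sym; trans; cong; cong₂; subst; module ≡-Reasoning)
open import Relation.Nullary using (¬_; Dec; yes; no; contradiction)
open import Relation.Nullary.Decidable using (_×-dec_; _→-dec_; ¬?; map′; does; does-⇔; dec⇒maybe; decidable-stable)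
open import Relation.Unary using (Decidable)

import Algebra.Solver.Ring
import Algebra.Solver.Ring.AlmostCommutativeRing as ACR
import Data.Bool.Properties as Bool
import Data.Fin as Fin
import Data.Fin.Properties as Fin
import Data.Integer as ℤ
import Data.Integer.Properties as ℤ
import Data.List
import Data.List.Membership.Propositional.Properties as ∈
import Data.List.Properties as List
import Data.List.Relation.Unary.All as All
import Data.List.Relation.Unary.AllPairs as AllPairs
import Data.List.Relation.Unary.AllPairs.Properties as AllPairs
import Data.List.Relation.Unary.Any as Any
import Data.List.Relation.Unary.Any.Properties as Any
import Data.List.Relation.Unary.Unique.Propositional.Properties as Unique
import Data.Maybe
import Data.Nat as ℕ
import Data.Nat.Coprimality as Coprime
import Data.Nat.Divisibility as ∣
import Data.Nat.DivMod as ℕ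
import Data.Nat.GCD as GCD
import Data.Nat.Primality as Prime
import Data.Nat.Properties as ℕ
import Data.Rational.Properties as ℚ
import Data.Rational as ℚ
import Data.Rational.Unnormalised as ℚᵘ
import Data.Rational.Unnormalised.Properties as ℚᵘ
import Data.Vec.Properties as Vec

-- The ring ℤ/n

-- A pair (i, j) fixes f when f ρʲ = ρ⁻ⁱ f. If j ≠ 0, then ρʲ generates ⟨ρ⟩ and f normalises it; if
-- j = 0, then i = 0 because ⟨ρ⟩ acts freely. So only normalising maps have non-trivial stabilizers,
-- and these have order p. Burnside's lemma makes A + (p - 1)N a multiple of p², where A counts the
-- isomorphisms and N the normalising ones. This count does the work of Sylow's theorem without any
-- group structure on the isomorphisms, which are maps between different graphs.
--
-- The term outside the sum in the formula comes from the multiplier 1. For any other multiplier gⁱ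
-- all p maps y ↦ gⁱ y + b have a fixed point and leave equally many sets invariant. Among the
-- translations, the p - 1 non-trivial ones leave 2 sets Q invariant instead of 2^p. This shortfall,
-- times the 2^((p-1)/2) choices of R and divided by the group order p(p - 1), is (2^((3p-1)/2) -
-- 2^((p+1)/2))/p.

module Zmod (n : ℕ) .{{_ : NonZero n}} where

  open import Data.Integer using (+_; -[1+_])

  infixl 6 _⊕_
  infixl 7 _⊗_
  infix  8 ⊖_

  Z : Set
  Z = Fin n

  abstract

    ⟦_⟧ : ℕ → Z
    ⟦ k ⟧ = k mod n

    _⊕_ _⊗_ : Z → Z → Z
    x ⊕ y = ⟦ toℕ x + toℕ y ⟧
    x ⊗ y = ⟦ toℕ x * toℕ y ⟧

    ⊖_ : Z → Z
    ⊖ x = ⟦ n ∸ toℕ x ⟧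

    ⟦⟧-def : ∀ k → ⟦ k ⟧ ≡ k mod n
    ⟦⟧-def k = refl

    ⊕-def : ∀ x y → x ⊕ y ≡ ⟦ toℕ x + toℕ y ⟧
    ⊕-def x y = refl

    ⊗-def : ∀ x y → x ⊗ y ≡ ⟦ toℕ x * toℕ y ⟧
    ⊗-def x y = refl

    ⊖-def : ∀ x → ⊖ x ≡ ⟦ n ∸ toℕ x ⟧
    ⊖-def x = refl

  0# 1# : Z
  0# = ⟦ 0 ⟧
  1# = ⟦ 1 ⟧

  toℕ-⟦⟧ : ∀ k → toℕ ⟦ k ⟧ ≡ k % n
  toℕ-⟦⟧ k = trans (cong toℕ (⟦⟧-def k)) (Fin.toℕ-fromℕ< _)

  ⟦⟧-cong-% : ∀ {j k} → j % n ≡ k % n → ⟦ j ⟧ ≡ ⟦ k ⟧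
  ⟦⟧-cong-% {j} {k} eq = Fin.toℕ-injective (trans (toℕ-⟦⟧ j) (trans eq (sym (toℕ-⟦⟧ k))))

  ⟦⟧-toℕ : ∀ x → ⟦ toℕ x ⟧ ≡ x
  ⟦⟧-toℕ x = Fin.toℕ-injective (trans (toℕ-⟦⟧ _) (ℕ.m<n⇒m%n≡m (Fin.toℕ<n x)))

  ⟦⟧-+ : ∀ j k → ⟦ j + k ⟧ ≡ ⟦ j ⟧ ⊕ ⟦ k ⟧
  ⟦⟧-+ j k = trans (⟦⟧-cong-% (trans (ℕ.%-distribˡ-+ j k n)
    (sym (cong (_% n) (cong₂ _+_ (toℕ-⟦⟧ j) (toℕ-⟦⟧ k)))))) (sym (⊕-def _ _))

  ⟦⟧-* : ∀ j k → ⟦ j * k ⟧ ≡ ⟦ j ⟧ ⊗ ⟦ k ⟧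
  ⟦⟧-* j k = trans (⟦⟧-cong-% (trans (ℕ.%-distribˡ-* j k n)
    (sym (cong (_% n) (cong₂ _*_ (toℕ-⟦⟧ j) (toℕ-⟦⟧ k)))))) (sym (⊗-def _ _))

  ⟦n⟧ : ⟦ n ⟧ ≡ 0#
  ⟦n⟧ = ⟦⟧-cong-% (trans (ℕ.n%n≡0 n) (sym (ℕ.m<n⇒m%n≡m (ℕ.>-nonZero⁻¹ n))))

  -- A residue absorbs its right operand without reducing it, so the ring laws below can be pulled
  -- back from ℕ.
  ⟦⟧+toℕ : ∀ j x → ⟦ j ⟧ ⊕ x ≡ ⟦ j + toℕ x ⟧
  ⟦⟧+toℕ j x = trans (cong (⟦ j ⟧ ⊕_) (sym (⟦⟧-toℕ x))) (sym (⟦⟧-+ j (toℕ x)))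

  ⟦⟧*toℕ : ∀ j x → ⟦ j ⟧ ⊗ x ≡ ⟦ j * toℕ x ⟧
  ⟦⟧*toℕ j x = trans (cong (⟦ j ⟧ ⊗_) (sym (⟦⟧-toℕ x))) (sym (⟦⟧-* j (toℕ x)))

  ⊕-comm : ∀ x y → x ⊕ y ≡ y ⊕ x
  ⊕-comm x y = trans (⊕-def x y) (trans (cong ⟦_⟧ (ℕ.+-comm (toℕ x) (toℕ y))) (sym (⊕-def y x)))

  ⊗-comm : ∀ x y → x ⊗ y ≡ y ⊗ x
  ⊗-comm x y = trans (⊗-def x y) (trans (cong ⟦_⟧ (ℕ.*-comm (toℕ x) (toℕ y))) (sym (⊗-def y x)))

  ⊕-assoc : ∀ x y z → (x ⊕ y) ⊕ z ≡ x ⊕ (y ⊕ z)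
  ⊕-assoc x y z = begin
    (x ⊕ y) ⊕ z                  ≡⟨ cong (_⊕ z) (⊕-def x y) ⟩
    ⟦ toℕ x + toℕ y ⟧ ⊕ z        ≡⟨ ⟦⟧+toℕ _ z ⟩
    ⟦ toℕ x + toℕ y + toℕ z ⟧    ≡⟨ cong ⟦_⟧ (trans (ℕ.+-assoc (toℕ x) _ _) (ℕ.+-comm (toℕ x) _)) ⟩
    ⟦ toℕ y + toℕ z + toℕ x ⟧    ≡⟨ ⟦⟧+toℕ _ x ⟨
    ⟦ toℕ y + toℕ z ⟧ ⊕ x        ≡⟨ cong (_⊕ x) (⊕-def y z) ⟨
    (y ⊕ z) ⊕ x                  ≡⟨ ⊕-comm _ x ⟩
    x ⊕ (y ⊕ z)                  ∎
    where open ≡-Reasoning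

  ⊗-assoc : ∀ x y z → (x ⊗ y) ⊗ z ≡ x ⊗ (y ⊗ z)
  ⊗-assoc x y z = begin
    (x ⊗ y) ⊗ z                  ≡⟨ cong (_⊗ z) (⊗-def x y) ⟩
    ⟦ toℕ x * toℕ y ⟧ ⊗ z        ≡⟨ ⟦⟧*toℕ _ z ⟩
    ⟦ toℕ x * toℕ y * toℕ z ⟧    ≡⟨ cong ⟦_⟧ (trans (ℕ.*-assoc (toℕ x) _ _) (ℕ.*-comm (toℕ x) _)) ⟩
    ⟦ toℕ y * toℕ z * toℕ x ⟧    ≡⟨ ⟦⟧*toℕ _ x ⟨
    ⟦ toℕ y * toℕ z ⟧ ⊗ x        ≡⟨ cong (_⊗ x) (⊗-def y z) ⟨
    (y ⊗ z) ⊗ x                  ≡⟨ ⊗-comm _ x ⟩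
    x ⊗ (y ⊗ z)                  ∎
    where open ≡-Reasoning

  ⊗-distribʳ-⊕ : ∀ x y z → (y ⊕ z) ⊗ x ≡ (y ⊗ x) ⊕ (z ⊗ x)
  ⊗-distribʳ-⊕ x y z = begin
    (y ⊕ z) ⊗ x                               ≡⟨ cong (_⊗ x) (⊕-def y z) ⟩
    ⟦ toℕ y + toℕ z ⟧ ⊗ x                     ≡⟨ ⟦⟧*toℕ _ x ⟩
    ⟦ (toℕ y + toℕ z) * toℕ x ⟧               ≡⟨ cong ⟦_⟧ (ℕ.*-distribʳ-+ (toℕ x) (toℕ y) (toℕ z)) ⟩
    ⟦ toℕ y * toℕ x + toℕ z * toℕ x ⟧         ≡⟨ ⟦⟧-+ _ _ ⟩
    ⟦ toℕ y * toℕ x ⟧ ⊕ ⟦ toℕ z * toℕ x ⟧     ≡⟨ cong₂ _⊕_ (⊗-def y x) (⊗-def z x) ⟨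
    (y ⊗ x) ⊕ (z ⊗ x)                         ∎
    where open ≡-Reasoning

  ⊕-identityˡ : ∀ x → 0# ⊕ x ≡ x
  ⊕-identityˡ x = trans (⟦⟧+toℕ 0 x) (⟦⟧-toℕ x)

  ⊗-identityˡ : ∀ x → 1# ⊗ x ≡ x
  ⊗-identityˡ x = trans (⟦⟧*toℕ 1 x) (trans (cong ⟦_⟧ (ℕ.*-identityˡ _)) (⟦⟧-toℕ x))

  ⊖-inverseˡ : ∀ x → ⊖ x ⊕ x ≡ 0#
  ⊖-inverseˡ x = trans (cong (_⊕ x) (⊖-def x)) (trans (⟦⟧+toℕ _ x)
    (trans (cong ⟦_⟧ (ℕ.m∸n+n≡m (ℕ.<⇒≤ (Fin.toℕ<n x)))) ⟦n⟧))

  commutativeRing : CommutativeRing 0ℓ 0ℓ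
  commutativeRing = record
    { Carrier = Z ; _≈_ = _≡_ ; _+_ = _⊕_ ; _*_ = _⊗_ ; -_ = ⊖_ ; 0# = 0# ; 1# = 1#
    ; isCommutativeRing = record
      { isRing = record
        { +-isAbelianGroup = record
          { isGroup = record
            { isMonoid = record
              { isSemigroup = record
                { isMagma = record { isEquivalence = isEquivalence ; ∙-cong = cong₂ _⊕_ }
                ; assoc = ⊕-assoc }
              ; identity = ⊕-identityˡ , comm∧idˡ⇒idʳ ⊕-comm ⊕-identityˡ }
            ; inverse = ⊖-inverseˡ , comm∧invˡ⇒invʳ ⊕-comm ⊖-inverseˡ
            ; ⁻¹-cong = cong ⊖_ }
          ; comm = ⊕-comm }
        ; *-cong = cong₂ _⊗_
        ; *-assoc = ⊗-assoc
        ; *-identity = ⊗-identityˡ , comm∧idˡ⇒idʳ ⊗-comm ⊗-identityˡ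
        ; distrib = comm∧distrʳ⇒distrˡ ⊗-comm ⊗-distribʳ-⊕ , ⊗-distribʳ-⊕ }
      ; *-comm = ⊗-comm } }
    where
    open import Relation.Binary.PropositionalEquality.Properties using (isEquivalence)
    open import Algebra.Consequences.Propositional
      using (comm∧idˡ⇒idʳ; comm∧invˡ⇒invʳ; comm∧distrʳ⇒distrˡ)

  open CommutativeRing commutativeRing public
    using () renaming (+-identityʳ to ⊕-identityʳ; -‿inverseʳ to ⊖-inverseʳ;
      *-identityʳ to ⊗-identityʳ; zeroˡ to ⊗-zeroˡ; zeroʳ to ⊗-zeroʳ)
  open import Algebra.Properties.Ring (CommutativeRing.ring commutativeRing) public
    using () renaming (-‿distribˡ-* to ⊖-distribˡ-⊗; -‿distribʳ-* to ⊖-distribʳ-⊗;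
      -‿involutive to ⊖-involutive; -0#≈0# to ⊖0#≡0#)
  open import Algebra.Properties.AbelianGroup (CommutativeRing.+-abelianGroup commutativeRing)
    using (⁻¹-∙-comm)

  ⟦_⟧ᶻ : ℤ → Z
  ⟦ + k ⟧ᶻ      = ⟦ k ⟧
  ⟦ -[1+ k ] ⟧ᶻ = ⊖ ⟦ suc k ⟧

  ⟦⟧ᶻ-⊖ : ∀ j k → ⟦ j ℤ.⊖ k ⟧ᶻ ≡ ⟦ j ⟧ ⊕ ⊖ ⟦ k ⟧
  ⟦⟧ᶻ-⊖ zero    zero    = sym (⊖-inverseʳ 0#)
  ⟦⟧ᶻ-⊖ zero    (suc k) = sym (⊕-identityˡ _)
  ⟦⟧ᶻ-⊖ (suc j) zero    = sym (trans (cong (⟦ suc j ⟧ ⊕_) ⊖0#≡0#) (⊕-identityʳ _))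
  ⟦⟧ᶻ-⊖ (suc j) (suc k) = begin
    ⟦ suc j ℤ.⊖ suc k ⟧ᶻ              ≡⟨ cong ⟦_⟧ᶻ (ℤ.[1+m]⊖[1+n]≡m⊖n j k) ⟩
    ⟦ j ℤ.⊖ k ⟧ᶻ                      ≡⟨ ⟦⟧ᶻ-⊖ j k ⟩
    a ⊕ ⊖ b                           ≡⟨ cong (_⊕ ⊖ b) (⊕-identityʳ a) ⟨
    -- 1 and its negative are inserted, to be absorbed by the two successors.
    a ⊕ 0# ⊕ ⊖ b                      ≡⟨ cong (λ t → a ⊕ t ⊕ ⊖ b) (⊖-inverseʳ 1#) ⟨
    a ⊕ (1# ⊕ ⊖ 1#) ⊕ ⊖ b             ≡⟨ cong (_⊕ ⊖ b) (trans (sym (⊕-assoc a _ _)) (cong (_⊕ ⊖ 1#) (⊕-comm a 1#))) ⟩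
    1# ⊕ a ⊕ ⊖ 1# ⊕ ⊖ b               ≡⟨ ⊕-assoc (1# ⊕ a) _ _ ⟩
    1# ⊕ a ⊕ (⊖ 1# ⊕ ⊖ b)             ≡⟨ cong₂ _⊕_ (sym (⟦⟧-+ 1 j)) (trans (⁻¹-∙-comm 1# b) (cong ⊖_ (sym (⟦⟧-+ 1 k)))) ⟩
    ⟦ suc j ⟧ ⊕ ⊖ ⟦ suc k ⟧           ∎
    where
    open ≡-Reasoning
    a = ⟦ j ⟧
    b = ⟦ k ⟧

  ⟦⟧ᶻ-+ : ∀ i j → ⟦ i ℤ.+ j ⟧ᶻ ≡ ⟦ i ⟧ᶻ ⊕ ⟦ j ⟧ᶻ
  ⟦⟧ᶻ-+ (+ i)      (+ j)      = ⟦⟧-+ i j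
  ⟦⟧ᶻ-+ (+ i)      -[1+ j ]   = ⟦⟧ᶻ-⊖ i (suc j)
  ⟦⟧ᶻ-+ -[1+ i ]   (+ j)      = trans (⟦⟧ᶻ-⊖ j (suc i)) (⊕-comm _ _)
  ⟦⟧ᶻ-+ -[1+ i ]   -[1+ j ]   = trans
    (cong ⊖_ (trans (cong ⟦_⟧ (cong suc (sym (ℕ.+-suc i j)))) (⟦⟧-+ (suc i) (suc j))))
    (sym (⁻¹-∙-comm _ _))

  ⟦⟧ᶻ-neg : ∀ i → ⟦ ℤ.- i ⟧ᶻ ≡ ⊖ ⟦ i ⟧ᶻ
  ⟦⟧ᶻ-neg (+ zero)  = sym ⊖0#≡0#
  ⟦⟧ᶻ-neg (+ suc i) = refl
  ⟦⟧ᶻ-neg -[1+ i ]  = sym (⊖-involutive _)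

  ⟦⟧ᶻ-*⁺ : ∀ i j → ⟦ + i ℤ.* j ⟧ᶻ ≡ ⟦ i ⟧ ⊗ ⟦ j ⟧ᶻ
  ⟦⟧ᶻ-*⁺ i (+ j)    = trans (cong ⟦_⟧ᶻ (sym (ℤ.pos-* i j))) (⟦⟧-* i j)
  ⟦⟧ᶻ-*⁺ i -[1+ j ] = begin
    ⟦ + i ℤ.* -[1+ j ] ⟧ᶻ          ≡⟨ cong ⟦_⟧ᶻ (ℤ.neg-distribʳ-* (+ i) (+ suc j)) ⟨
    ⟦ ℤ.- (+ i ℤ.* + suc j) ⟧ᶻ     ≡⟨ ⟦⟧ᶻ-neg (+ i ℤ.* + suc j) ⟩
    ⊖ ⟦ + i ℤ.* + suc j ⟧ᶻ         ≡⟨ cong ⊖_ (⟦⟧ᶻ-*⁺ i (+ suc j)) ⟩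
    ⊖ (⟦ i ⟧ ⊗ ⟦ suc j ⟧)          ≡⟨ ⊖-distribʳ-⊗ _ _ ⟩
    ⟦ i ⟧ ⊗ ⊖ ⟦ suc j ⟧            ∎
    where open ≡-Reasoning

  ⟦⟧ᶻ-* : ∀ i j → ⟦ i ℤ.* j ⟧ᶻ ≡ ⟦ i ⟧ᶻ ⊗ ⟦ j ⟧ᶻ
  ⟦⟧ᶻ-* (+ i)    j = ⟦⟧ᶻ-*⁺ i j
  ⟦⟧ᶻ-* -[1+ i ] j = begin
    ⟦ -[1+ i ] ℤ.* j ⟧ᶻ            ≡⟨ cong ⟦_⟧ᶻ (ℤ.neg-distribˡ-* (+ suc i) j) ⟨
    ⟦ ℤ.- (+ suc i ℤ.* j) ⟧ᶻ       ≡⟨ ⟦⟧ᶻ-neg (+ suc i ℤ.* j) ⟩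
    ⊖ ⟦ + suc i ℤ.* j ⟧ᶻ           ≡⟨ cong ⊖_ (⟦⟧ᶻ-*⁺ (suc i) j) ⟩
    ⊖ (⟦ suc i ⟧ ⊗ ⟦ j ⟧ᶻ)         ≡⟨ ⊖-distribˡ-⊗ _ _ ⟩
    ⊖ ⟦ suc i ⟧ ⊗ ⟦ j ⟧ᶻ           ∎
    where open ≡-Reasoning

  -- The coefficients are taken in ℤ: equality of elements of Fin n does not compute for a variable n.
  coefficientRing = CommutativeRing.rawRing ℤ.+-*-commutativeRing

  solverRing : ACR.AlmostCommutativeRing 0ℓ 0ℓ
  solverRing = ACR.fromCommutativeRing commutativeRing

  coefficientMorphism : coefficientRing ACR.-Raw-AlmostCommutative⟶ solverRing
  coefficientMorphism = record
    { ⟦_⟧ = ⟦_⟧ᶻ ; +-homo = ⟦⟧ᶻ-+ ; *-homo = ⟦⟧ᶻ-* ; -‿homo = ⟦⟧ᶻ-neg ; 0-homo = refl ; 1-homo = refl }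

  coefficient≟ : ∀ i j → Data.Maybe.Maybe (⟦ i ⟧ᶻ ≡ ⟦ j ⟧ᶻ)
  coefficient≟ i j = Data.Maybe.map (cong ⟦_⟧ᶻ) (dec⇒maybe (i ℤ.≟ j))

  module Solver = Algebra.Solver.Ring coefficientRing solverRing coefficientMorphism coefficient≟

-- Finite types and sums over them

𝟙 : {P : Set} → Dec P → ℕ
𝟙 (yes _) = 1
𝟙 (no _)  = 0

𝟙-yes : {P : Set} (P? : Dec P) → P → 𝟙 P? ≡ 1
𝟙-yes (yes _) _ = refl
𝟙-yes (no ¬p) p = contradiction p ¬p

𝟙-no : {P : Set} (P? : Dec P) → ¬ P → 𝟙 P? ≡ 0
𝟙-no (yes p) ¬p = contradiction p ¬p
𝟙-no (no _)  _  = refl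

𝟙-cong : {P Q : Set} (P? : Dec P) (Q? : Dec Q) → (P → Q) → (Q → P) → 𝟙 P? ≡ 𝟙 Q?
𝟙-cong (yes p) Q? f g = sym (𝟙-yes Q? (f p))
𝟙-cong (no ¬p) Q? f g = sym (𝟙-no Q? (¬p ∘ g))

𝟙-× : {P Q : Set} (P? : Dec P) (Q? : Dec Q) → 𝟙 (P? ×-dec Q?) ≡ 𝟙 P? * 𝟙 Q?
𝟙-× (yes p) (yes q) = refl
𝟙-× (yes p) (no ¬q) = refl
𝟙-× (no ¬p) Q?      = refl

𝟙≤1 : {P : Set} (P? : Dec P) → 𝟙 P? ≤ 1
𝟙≤1 (yes _) = ℕ.≤-refl
𝟙≤1 (no _)  = z≤n

module _ {A : Set} where

  ∑ : List A → (A → ℕ) → ℕ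
  ∑ xs f = sum (map f xs)

  ∑-cong : ∀ xs {f g : A → ℕ} → (∀ x → f x ≡ g x) → ∑ xs f ≡ ∑ xs g
  ∑-cong []       eq = refl
  ∑-cong (x ∷ xs) eq = cong₂ _+_ (eq x) (∑-cong xs eq)

  ∑-mono : ∀ xs {f g : A → ℕ} → (∀ x → f x ≤ g x) → ∑ xs f ≤ ∑ xs g
  ∑-mono []       le = z≤n
  ∑-mono (x ∷ xs) le = ℕ.+-mono-≤ (le x) (∑-mono xs le)

  ∑-*ˡ : ∀ c xs (f : A → ℕ) → ∑ xs (λ x → c * f x) ≡ c * ∑ xs f
  ∑-*ˡ c []       f = sym (ℕ.*-zeroʳ c)
  ∑-*ˡ c (x ∷ xs) f = trans (cong ((c * f x) +_) (∑-*ˡ c xs f)) (sym (ℕ.*-distribˡ-+ c (f x) _))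

  ∑-*ʳ : ∀ c xs (f : A → ℕ) → ∑ xs (λ x → f x * c) ≡ ∑ xs f * c
  ∑-*ʳ c xs f = trans (∑-cong xs (λ x → ℕ.*-comm (f x) c)) (trans (∑-*ˡ c xs f) (ℕ.*-comm c _))

  ∑-+ : ∀ xs (f g : A → ℕ) → ∑ xs (λ x → f x + g x) ≡ ∑ xs f + ∑ xs g
  ∑-+ []       f g = refl
  ∑-+ (x ∷ xs) f g = trans (cong (λ t → f x + g x + t) (∑-+ xs f g)) (interchange (f x) (g x) _ _)
    where
    open import Algebra.Properties.CommutativeSemigroup ℕ.+-commutativeSemigroup using (interchange)

  ∑-const : ∀ c xs → ∑ xs (λ _ → c) ≡ length xs * c
  ∑-const c []       = refl
  ∑-const c (x ∷ xs) = cong (c +_) (∑-const c xs)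

  ∑-zero : ∀ xs → ∑ xs (λ _ → 0) ≡ 0
  ∑-zero xs = trans (∑-const 0 xs) (ℕ.*-zeroʳ (length xs))

  ∑-++ : ∀ xs ys (f : A → ℕ) → ∑ (xs ++ ys) f ≡ ∑ xs f + ∑ ys f
  ∑-++ []       ys f = refl
  ∑-++ (x ∷ xs) ys f = trans (cong (f x +_) (∑-++ xs ys f)) (sym (ℕ.+-assoc (f x) _ _))

∑-swap : {A B : Set} (xs : List A) (ys : List B) (f : A → B → ℕ) →
  ∑ xs (λ x → ∑ ys (f x)) ≡ ∑ ys (λ y → ∑ xs (λ x → f x y))
∑-swap []       ys f = sym (∑-zero ys)
∑-swap (x ∷ xs) ys f = trans (cong (∑ ys (f x) +_) (∑-swap xs ys f)) (sym (∑-+ ys (f x) _))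

∑-map : {A B : Set} (h : A → B) (xs : List A) (f : B → ℕ) → ∑ (map h xs) f ≡ ∑ xs (f ∘ h)
∑-map h []       f = refl
∑-map h (x ∷ xs) f = cong (f (h x) +_) (∑-map h xs f)

∑-concatMap : {A B : Set} (h : A → List B) (xs : List A) (f : B → ℕ) →
  ∑ (concatMap h xs) f ≡ ∑ xs (λ x → ∑ (h x) f)
∑-concatMap h []       f = refl
∑-concatMap h (x ∷ xs) f = trans (∑-++ (h x) _ f) (cong (∑ (h x) f +_) (∑-concatMap h xs f))

length-filter≡∑ : {A : Set} {P : A → Set} (P? : Decidable P) (xs : List A) →
  length (filter P? xs) ≡ ∑ xs (λ x → 𝟙 (P? x))
length-filter≡∑ P? []       = refl
length-filter≡∑ P? (x ∷ xs) with P? x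
... | yes _ = cong suc (length-filter≡∑ P? xs)
... | no _  = length-filter≡∑ P? xs

-- Every element has multiplicity one in the list. Stated as a sum, this lets counts be compared
-- without permuting lists.
record Finite (A : Set) : Set where
  infix 4 _≟_
  field
    _≟_   : DecidableEquality A
    elems : List A
    once  : ∀ c → ∑ elems (λ a → 𝟙 (a ≟ c)) ≡ 1

open Finite {{...}} public

module _ {A : Set} {{_ : Finite A}} where

  abstract

    ∑ᶠ : (A → ℕ) → ℕ
    ∑ᶠ = ∑ elems

    ∑ᶠ-def : ∀ f → ∑ᶠ f ≡ ∑ elems f
    ∑ᶠ-def f = refl

    ∑ᶠ-cong : ∀ {f g} → (∀ x → f x ≡ g x) → ∑ᶠ f ≡ ∑ᶠ g
    ∑ᶠ-cong = ∑-cong elems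

    ∑ᶠ-mono : ∀ {f g} → (∀ x → f x ≤ g x) → ∑ᶠ f ≤ ∑ᶠ g
    ∑ᶠ-mono = ∑-mono elems

    ∑ᶠ-*ˡ : ∀ c f → ∑ᶠ (λ x → c * f x) ≡ c * ∑ᶠ f
    ∑ᶠ-*ˡ c = ∑-*ˡ c elems

    ∑ᶠ-*ʳ : ∀ c f → ∑ᶠ (λ x → f x * c) ≡ ∑ᶠ f * c
    ∑ᶠ-*ʳ c = ∑-*ʳ c elems

    ∑ᶠ-+ : ∀ f g → ∑ᶠ (λ x → f x + g x) ≡ ∑ᶠ f + ∑ᶠ g
    ∑ᶠ-+ = ∑-+ elems

    ∑ᶠ-once : ∀ c → ∑ᶠ (λ a → 𝟙 (a ≟ c)) ≡ 1
    ∑ᶠ-once = once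

  ∑ᶠ-zero : ∑ᶠ (λ _ → 0) ≡ 0
  ∑ᶠ-zero = ∑ᶠ-*ˡ 0 (λ _ → 0)

  # : {P : A → Set} → Decidable P → ℕ
  # P? = ∑ᶠ (λ a → 𝟙 (P? a))

  ∈-elems : (c : A) → c ∈ elems
  ∈-elems c = go elems (once c)
    where
    go : (xs : List A) → ∑ xs (λ a → 𝟙 (a ≟ c)) ≡ 1 → c ∈ xs
    go (x ∷ xs) eq with x ≟ c
    ... | yes x≡c = here (sym x≡c)
    ... | no _    = there (go xs eq)

  -- A repeated element would have multiplicity at least two.
  elems-unique : AllPairs _≢_ (elems {A})
  elems-unique = go elems (λ c → ℕ.≤-reflexive (once c))
    where
    occurs : (c : A) {xs : List A} → c ∈ xs → 1 ≤ ∑ xs (λ a → 𝟙 (a ≟ c))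
    occurs c {x ∷ xs} (here refl) = ℕ.≤-trans (ℕ.≤-reflexive (sym (𝟙-yes (c ≟ c) refl))) (ℕ.m≤m+n _ _)
    occurs c {x ∷ xs} (there i)   = ℕ.≤-trans (occurs c i) (ℕ.m≤n+m _ _)
    go : (xs : List A) → (∀ c → ∑ xs (λ a → 𝟙 (a ≟ c)) ≤ 1) → AllPairs _≢_ xs
    go []       le = AllPairs.[]
    go (x ∷ xs) le = All.tabulate (λ { {y} i refl → contradiction
        (ℕ.≤-trans (ℕ.+-mono-≤ (ℕ.≤-reflexive (sym (𝟙-yes (y ≟ y) refl))) (occurs y i)) (le y)) (λ { (s≤s ()) }) })
      AllPairs.∷ go xs (λ c → ℕ.≤-trans (ℕ.m≤n+m _ _) (le c))

  module _ {P : A → Set} (P? : Decidable P) where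

    ∀? : Dec (∀ a → P a)
    ∀? = map′ (λ ps a → All.lookup ps (∈-elems a)) (λ ps → All.universal ps elems) (All.all? P? elems)

    ∃? : Dec (∃ P)
    ∃? = map′ Any.satisfied (λ { (a , p) → Any.map (λ { refl → p }) (∈-elems a) }) (Any.any? P? elems)

  -- Read from right to left, this introduces a sum over a second variable, on which all the double
  -- counting rests.
  ∑ᶠ-δ : ∀ c (f : A → ℕ) → ∑ᶠ (λ a → 𝟙 (a ≟ c) * f a) ≡ f c
  ∑ᶠ-δ c f = begin
    ∑ᶠ (λ a → 𝟙 (a ≟ c) * f a)  ≡⟨ ∑ᶠ-cong pointwise ⟩
    ∑ᶠ (λ a → 𝟙 (a ≟ c) * f c)  ≡⟨ ∑ᶠ-*ʳ (f c) _ ⟩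
    ∑ᶠ (λ a → 𝟙 (a ≟ c)) * f c  ≡⟨ cong (_* f c) (∑ᶠ-once c) ⟩
    1 * f c                     ≡⟨ ℕ.*-identityˡ (f c) ⟩
    f c                         ∎
    where
    open ≡-Reasoning
    pointwise : ∀ a → 𝟙 (a ≟ c) * f a ≡ 𝟙 (a ≟ c) * f c
    pointwise a with a ≟ c
    ... | yes refl = refl
    ... | no _     = refl

  #≢0⇒∃ : {P : A → Set} (P? : Decidable P) → # P? ≢ 0 → ∃ P
  #≢0⇒∃ P? ne with ∃? P?
  ... | yes e = e
  ... | no ¬e = contradiction
    (trans (∑ᶠ-cong (λ a → 𝟙-no (P? a) (λ p → ¬e (a , p)))) (∑ᶠ-zero)) ne

  #-pos : {P : A → Set} (P? : Decidable P) → ∀ c → P c → 1 ≤ # P?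
  #-pos P? c p = subst (_≤ # P?) (∑ᶠ-once c) (∑ᶠ-mono le)
    where
    le : ∀ a → 𝟙 (a ≟ c) ≤ 𝟙 (P? a)
    le a with a ≟ c
    ... | yes refl = ℕ.≤-reflexive (sym (𝟙-yes (P? a) p))
    ... | no _     = z≤n

  #-unique : {P : A → Set} (P? : Decidable P) → ∀ c → P c → (∀ a → P a → a ≡ c) → # P? ≡ 1
  #-unique P? c p uniq = trans
    (∑ᶠ-cong (λ a → 𝟙-cong (P? a) (a ≟ c) (uniq a) (λ { refl → p }))) (∑ᶠ-once c)

  #-cong : {P Q : A → Set} (P? : Decidable P) (Q? : Decidable Q) →
    (∀ a → P a → Q a) → (∀ a → Q a → P a) → # P? ≡ # Q?
  #-cong P? Q? f g = ∑ᶠ-cong (λ a → 𝟙-cong (P? a) (Q? a) (f a) (g a))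

card : (A : Set) {{_ : Finite A}} → ℕ
card A = ∑ᶠ {A} (λ _ → 1)

∑ᶠ-const : {A : Set} {{_ : Finite A}} (c : ℕ) → ∑ᶠ {A} (λ _ → c) ≡ card A * c
∑ᶠ-const c = trans (∑ᶠ-cong (λ _ → sym (ℕ.*-identityˡ c))) (∑ᶠ-*ʳ c (λ _ → 1))

-- The indicators of `c` and of `P` have disjoint supports, so their sum is at most 1 everywhere.
#<card : {A : Set} {{_ : Finite A}} {P : A → Set} (P? : Decidable P) → ∀ c → ¬ P c → # P? < card A
#<card P? c ¬Pc = subst (_≤ _) (trans (∑ᶠ-+ _ _) (cong (_+ # P?) (∑ᶠ-once c))) (∑ᶠ-mono le)
  where
  le : ∀ a → 𝟙 (a ≟ c) + 𝟙 (P? a) ≤ 1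
  le a with a ≟ c
  ... | yes refl = ℕ.≤-reflexive (cong suc (𝟙-no (P? a) ¬Pc))
  ... | no _     = 𝟙≤1 (P? a)

module _ {A B : Set} {{_ : Finite A}} {{_ : Finite B}} where

  ∑ᶠ-swap : (f : A → B → ℕ) → ∑ᶠ (λ a → ∑ᶠ (f a)) ≡ ∑ᶠ (λ b → ∑ᶠ (λ a → f a b))
  ∑ᶠ-swap f = trans (∑ᶠ-def _) (trans (∑-cong elems (λ a → ∑ᶠ-def (f a))) (trans (∑-swap elems elems f)
    (sym (trans (∑ᶠ-def _) (∑-cong elems (λ b → ∑ᶠ-def (λ a → f a b)))))))

  -- Both sides count the pairs (a , f a) with P a, which are the pairs (g b , b) with Q b.
  #-bijection : {P : A → Set} {Q : B → Set} (P? : Decidable P) (Q? : Decidable Q)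
    (f : A → B) (g : B → A) → (∀ a → P a → Q (f a)) → (∀ b → Q b → P (g b)) →
    (∀ a → P a → g (f a) ≡ a) → (∀ b → Q b → f (g b) ≡ b) → # P? ≡ # Q?
  #-bijection P? Q? f g P⇒Q Q⇒P gf fg = begin
    ∑ᶠ (λ a → 𝟙 (P? a))                                ≡⟨ ∑ᶠ-cong (λ a → ∑ᶠ-δ (f a) (λ _ → 𝟙 (P? a))) ⟨
    ∑ᶠ (λ a → ∑ᶠ (λ b → 𝟙 (b ≟ f a) * 𝟙 (P? a)))       ≡⟨ ∑ᶠ-swap _ ⟩
    ∑ᶠ (λ b → ∑ᶠ (λ a → 𝟙 (b ≟ f a) * 𝟙 (P? a)))       ≡⟨ ∑ᶠ-cong (λ b → ∑ᶠ-cong (λ a → pointwise a b)) ⟩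
    ∑ᶠ (λ b → ∑ᶠ (λ a → 𝟙 (a ≟ g b) * 𝟙 (Q? b)))       ≡⟨ ∑ᶠ-cong (λ b → ∑ᶠ-δ (g b) (λ _ → 𝟙 (Q? b))) ⟩
    ∑ᶠ (λ b → 𝟙 (Q? b))                                ∎
    where
    open ≡-Reasoning
    pointwise : ∀ a b → 𝟙 (b ≟ f a) * 𝟙 (P? a) ≡ 𝟙 (a ≟ g b) * 𝟙 (Q? b)
    pointwise a b = trans (sym (𝟙-× (b ≟ f a) (P? a))) (trans
      (𝟙-cong ((b ≟ f a) ×-dec P? a) ((a ≟ g b) ×-dec Q? b)
        (λ { (refl , p) → sym (gf a p) , P⇒Q a p })
        (λ { (refl , q) → sym (fg b q) , Q⇒P b q }))
      (𝟙-× (a ≟ g b) (Q? b)))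

  ∑ᶠ-reindex : (f : A → B) (g : B → A) → (∀ a → g (f a) ≡ a) → (∀ b → f (g b) ≡ b) →
    (h : B → ℕ) → ∑ᶠ (h ∘ f) ≡ ∑ᶠ h
  ∑ᶠ-reindex f g gf fg h = begin
    ∑ᶠ (λ a → h (f a))                               ≡⟨ ∑ᶠ-cong (λ a → ∑ᶠ-δ (f a) h) ⟨
    ∑ᶠ (λ a → ∑ᶠ (λ b → 𝟙 (b ≟ f a) * h b))          ≡⟨ ∑ᶠ-swap _ ⟩
    ∑ᶠ (λ b → ∑ᶠ (λ a → 𝟙 (b ≟ f a) * h b))          ≡⟨ ∑ᶠ-cong (λ b → ∑ᶠ-cong (λ a → cong (_* h b)
                                                        (𝟙-cong (b ≟ f a) (a ≟ g b)
                                                          (λ { refl → sym (gf a) }) (λ { refl → sym (fg b) })))) ⟩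
    ∑ᶠ (λ b → ∑ᶠ (λ a → 𝟙 (a ≟ g b) * h b))          ≡⟨ ∑ᶠ-cong (λ b → ∑ᶠ-δ (g b) (λ _ → h b)) ⟩
    ∑ᶠ h                                             ∎
    where open ≡-Reasoning

  -- Without a collision every fibre has at most one element, and only fibres over points of `Q` are
  -- inhabited; summing the fibre sizes contradicts the inequality.
  pigeonhole : {P : A → Set} {Q : B → Set} (P? : Decidable P) (Q? : Decidable Q) (f : A → B) →
    (∀ a → P a → Q (f a)) → # Q? < # P? → ∃ λ a → ∃ λ a′ → P a × P a′ × a ≢ a′ × f a ≡ f a′
  pigeonhole {P} {Q} P? Q? f P⇒Q lt
    with ∃? (λ a → ∃? (λ a′ → P? a ×-dec (P? a′ ×-dec (¬? (a ≟ a′) ×-dec (f a ≟ f a′)))))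
  ... | yes e = e
  ... | no ¬e = contradiction bound (ℕ.<⇒≱ lt)
    where
    fibre? : ∀ b → Decidable (λ a → P a × b ≡ f a)
    fibre? b a = P? a ×-dec (b ≟ f a)
    unique : ∀ {a c b} → P a → b ≡ f a → P c → b ≡ f c → a ≡ c
    unique {a} {c} Pa b≡fa Pc b≡fc with a ≟ c
    ... | yes a≡c = a≡c
    ... | no a≢c  = contradiction (a , c , Pa , Pc , a≢c , trans (sym b≡fa) b≡fc) ¬e
    fibre≤𝟙 : ∀ b → # (fibre? b) ≤ 𝟙 (Q? b)
    fibre≤𝟙 b with ∃? (fibre? b)
    ... | no ¬c = subst (_≤ 𝟙 (Q? b))
      (sym (trans (∑ᶠ-cong (λ a → 𝟙-no (fibre? b a) (λ q → ¬c (a , q)))) ∑ᶠ-zero)) z≤n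
    ... | yes (c , Pc , b≡fc) = ℕ.≤-reflexive (trans
      (#-unique (fibre? b) c (Pc , b≡fc) (λ { a (Pa , b≡fa) → unique Pa b≡fa Pc b≡fc }))
      (sym (𝟙-yes (Q? b) (subst Q (sym b≡fc) (P⇒Q c Pc)))))
    bound : # P? ≤ # Q?
    bound = begin
      ∑ᶠ (λ a → 𝟙 (P? a))                             ≡⟨ ∑ᶠ-cong (λ a → ∑ᶠ-δ (f a) (λ _ → 𝟙 (P? a))) ⟨
      ∑ᶠ (λ a → ∑ᶠ (λ b → 𝟙 (b ≟ f a) * 𝟙 (P? a)))    ≡⟨ ∑ᶠ-swap _ ⟩
      ∑ᶠ (λ b → ∑ᶠ (λ a → 𝟙 (b ≟ f a) * 𝟙 (P? a)))    ≡⟨ ∑ᶠ-cong (λ b → ∑ᶠ-cong (λ a →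
                                                          trans (ℕ.*-comm (𝟙 (b ≟ f a)) _) (sym (𝟙-× (P? a) (b ≟ f a))))) ⟩
      ∑ᶠ (λ b → # (fibre? b))                         ≤⟨ ∑ᶠ-mono fibre≤𝟙 ⟩
      # Q?                                            ∎
      where open ℕ.≤-Reasoning

instance

  Finite-Bool : Finite Bool
  Finite-Bool = record { _≟_ = Bool._≟_ ; elems = true ∷ false ∷ []
    ; once = λ { true → refl ; false → refl } }

  Finite-Fin : ∀ {n} → Finite (Fin n)
  Finite-Fin {n} = record { _≟_ = Fin._≟_ ; elems = allFin n ; once = once-Fin n }
    where
    once-Fin : ∀ n (c : Fin n) → ∑ (allFin n) (λ a → 𝟙 (a Fin.≟ c)) ≡ 1
    once-Fin (suc n) c = trans
      (cong (λ xs → 𝟙 (Fin.zero Fin.≟ c) + ∑ xs (λ a → 𝟙 (a Fin.≟ c))) (sym (List.map-tabulate id Fin.suc)))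
      (trans (cong (𝟙 (Fin.zero Fin.≟ c) +_) (∑-map Fin.suc (allFin n) _)) (go c))
      where
      go : (c : Fin (suc n)) → 𝟙 (Fin.zero Fin.≟ c) + ∑ (allFin n) (λ a → 𝟙 (Fin.suc a Fin.≟ c)) ≡ 1
      go Fin.zero    = cong suc (trans (∑-cong (allFin n) (λ a → 𝟙-no (Fin.suc a Fin.≟ Fin.zero) (λ ()))) (∑-zero (allFin n)))
      go (Fin.suc c) = trans
        (∑-cong (allFin n) (λ a → 𝟙-cong (Fin.suc a Fin.≟ Fin.suc c) (a Fin.≟ c) Fin.suc-injective (cong Fin.suc)))
        (once-Fin n c)

  Finite-× : {A B : Set} {{_ : Finite A}} {{_ : Finite B}} → Finite (A × B)
  Finite-× {A} {B} = record { _≟_ = _≟×_ ; elems = elems× ; once = once× }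
    where
    _≟×_ : DecidableEquality (A × B)
    _≟×_ = ≡-dec _≟_ _≟_
    elems× : List (A × B)
    elems× = concatMap (λ a → map (a ,_) elems) elems
    once× : ∀ cd → ∑ elems× (λ ab → 𝟙 (ab ≟× cd)) ≡ 1
    once× (c , d) = begin
      ∑ elems× (λ ab → 𝟙 (ab ≟× (c , d)))
        ≡⟨ ∑-concatMap _ (elems {A}) _ ⟩
      ∑ elems (λ a → ∑ (map (a ,_) elems) (λ ab → 𝟙 (ab ≟× (c , d))))
        ≡⟨ ∑-cong (elems {A}) (λ a → ∑-map (a ,_) (elems {B}) _) ⟩
      ∑ elems (λ a → ∑ elems (λ b → 𝟙 ((a , b) ≟× (c , d))))
        ≡⟨ ∑-cong (elems {A}) (λ a → ∑-cong (elems {B}) (λ b → trans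
             (𝟙-cong ((a , b) ≟× (c , d)) ((a ≟ c) ×-dec (b ≟ d))
               (λ { refl → refl , refl }) (λ { (refl , refl) → refl }))
             (𝟙-× (a ≟ c) (b ≟ d)))) ⟩
      ∑ elems (λ a → ∑ elems (λ b → 𝟙 (a ≟ c) * 𝟙 (b ≟ d)))
        ≡⟨ ∑-cong (elems {A}) (λ a → trans (∑-*ˡ (𝟙 (a ≟ c)) (elems {B}) _) (cong (𝟙 (a ≟ c) *_) (once d))) ⟩
      ∑ elems (λ a → 𝟙 (a ≟ c) * 1)
        ≡⟨ ∑-*ʳ 1 (elems {A}) _ ⟩
      ∑ elems (λ a → 𝟙 (a ≟ c)) * 1
        ≡⟨ cong (_* 1) (once c) ⟩
      1 ∎
      where open ≡-Reasoning

module _ {A B : Set} {{_ : Finite A}} {{_ : Finite B}} where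

  ∑ᶠ-× : (f : A × B → ℕ) → ∑ᶠ f ≡ ∑ᶠ (λ a → ∑ᶠ (λ b → f (a , b)))
  ∑ᶠ-× f = begin
    ∑ᶠ f                                     ≡⟨ ∑ᶠ-def f ⟩
    ∑ (elems {A × B}) f                      ≡⟨ ∑-concatMap _ (elems {A}) f ⟩
    ∑ elems (λ a → ∑ (map (a ,_) elems) f)   ≡⟨ ∑-cong (elems {A}) (λ a → ∑-map (a ,_) (elems {B}) f) ⟩
    ∑ elems (λ a → ∑ elems (λ b → f (a , b))) ≡⟨ ∑-cong (elems {A}) (λ a → ∑ᶠ-def (λ b → f (a , b))) ⟨
    ∑ elems (λ a → ∑ᶠ (λ b → f (a , b)))     ≡⟨ ∑ᶠ-def (λ a → ∑ᶠ (λ b → f (a , b))) ⟨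
    ∑ᶠ (λ a → ∑ᶠ (λ b → f (a , b)))          ∎
    where open ≡-Reasoning

  ∑ᶠ-*-∑ᶠ : (f : A → ℕ) (g : B → ℕ) →
    ∑ᶠ (λ (ab : A × B) → f (proj₁ ab) * g (proj₂ ab)) ≡ ∑ᶠ f * ∑ᶠ g
  ∑ᶠ-*-∑ᶠ f g = trans (∑ᶠ-× _) (trans (∑ᶠ-cong (λ a → ∑ᶠ-*ˡ (f a) g)) (∑ᶠ-*ʳ (∑ᶠ g) f))

  card-× : card (A × B) ≡ card A * card B
  card-× = trans (∑ᶠ-× (λ _ → 1)) (∑ᶠ-const (card B))

card-Fin : ∀ n → card (Fin n) ≡ n
card-Fin n = trans (∑ᶠ-def {Fin n} (λ _ → 1)) (trans (∑-const 1 (allFin n))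
  (trans (ℕ.*-identityʳ _) (List.length-tabulate id)))

instance

  Finite-Vec : {A : Set} {{_ : Finite A}} {n : ℕ} → Finite (Vec A n)
  Finite-Vec {A} {n = zero} = record { _≟_ = λ { [] [] → yes refl } ; elems = [] ∷ [] ; once = λ { [] → refl } }
  Finite-Vec {A} {n = suc n} = record
    { _≟_ = Vec.≡-dec _≟_
    ; elems = map cons elems
    ; once = λ { (c ∷ cs) → trans (∑-map cons (elems {A × Vec A n}) _) (trans
        (∑-cong (elems {A × Vec A n}) (λ { (a , as) → 𝟙-cong (Vec.≡-dec _≟_ (a ∷ as) (c ∷ cs)) ((a , as) ≟ (c , cs))
          (λ { refl → refl }) (λ { refl → refl }) }))
        (once (c , cs))) } }
    where
    cons : A × Vec A n → Vec A (suc n)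
    cons (a , as) = a ∷ as

card-Vec : {A : Set} {{_ : Finite A}} (n : ℕ) → card (Vec A n) ≡ card A ^ n
card-Vec {A} zero    = ∑ᶠ-def {Vec A 0} _
card-Vec {A} (suc n) = begin
  card (Vec A (suc n))                ≡⟨ ∑ᶠ-def {Vec A (suc n)} _ ⟩
  ∑ (elems {Vec A (suc n)}) (λ _ → 1) ≡⟨ ∑-map _ (elems {A × Vec A n}) _ ⟩
  ∑ (elems {A × Vec A n}) (λ _ → 1)   ≡⟨ ∑ᶠ-def {A × Vec A n} _ ⟨
  card (A × Vec A n)                  ≡⟨ card-× {A} {Vec A n} ⟩
  card A * card (Vec A n)             ≡⟨ cong (card A *_) (card-Vec {A} n) ⟩
  card A * card A ^ n                 ∎
  where open ≡-Reasoning

vec-ext : {A : Set} {n : ℕ} {v w : Vec A n} → (∀ i → lookup v i ≡ lookup w i) → v ≡ w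
vec-ext {v = v} {w} eq = trans (sym (Vec.tabulate∘lookup v)) (trans (Vec.tabulate-cong eq) (Vec.tabulate∘lookup w))

-- Burnside's lemma

module _ {A : Set} where

  firstOr : {P : A → Set} → Decidable P → A → List A → A
  firstOr P? d []       = d
  firstOr P? d (x ∷ xs) with P? x
  ... | yes _ = x
  ... | no _  = firstOr P? d xs

  firstOr-satisfies : {P : A → Set} (P? : Decidable P) (d : A) {xs : List A} → Any P xs → P (firstOr P? d xs)
  firstOr-satisfies P? d {x ∷ xs} any with P? x | any
  ... | yes p | _       = p
  ... | no ¬p | here p  = contradiction p ¬p
  ... | no _  | there q = firstOr-satisfies P? d q

  -- A hit exists, so the defaults are never reached and may differ.
  firstOr-cong : {P Q : A → Set} (P? : Decidable P) (Q? : Decidable Q) →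
    (∀ {x} → P x → Q x) → (∀ {x} → Q x → P x) → (d d′ : A) {xs : List A} → Any P xs →
    firstOr P? d xs ≡ firstOr Q? d′ xs
  firstOr-cong P? Q? f g d d′ {x ∷ xs} any with P? x | Q? x | any
  ... | yes p | yes q | _       = refl
  ... | yes p | no ¬q | _       = contradiction (f p) ¬q
  ... | no ¬p | yes q | _       = contradiction (g q) ¬p
  ... | no ¬p | no _  | here p  = contradiction p ¬p
  ... | no _  | no _  | there r = firstOr-cong P? Q? f g d d′ r

module Burnside {G X : Set} {{_ : Finite G}} {{_ : Finite X}}
  {_∙_ : G → G → G} {ε : G} {_⁻¹ : G → G} (isGroup : IsGroup _≡_ _∙_ ε _⁻¹)
  (act : G → X → X) (act-ε : ∀ x → act ε x ≡ x) (act-∙ : ∀ g h x → act (g ∙ h) x ≡ act g (act h x))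
  where

  open IsGroup isGroup using (assoc; identityˡ; inverseˡ; inverseʳ)

  act-inverseˡ : ∀ g x → act (g ⁻¹) (act g x) ≡ x
  act-inverseˡ g x = trans (sym (act-∙ (g ⁻¹) g x)) (trans (cong (λ h → act h x) (inverseˡ g)) (act-ε x))

  act-inverseʳ : ∀ g x → act g (act (g ⁻¹) x) ≡ x
  act-inverseʳ g x = trans (sym (act-∙ g (g ⁻¹) x)) (trans (cong (λ h → act h x) (inverseʳ g)) (act-ε x))

  Orbit : X → X → Set
  Orbit x y = ∃ λ g → act g x ≡ y

  orbit? : ∀ x → Decidable (Orbit x)
  orbit? x y = ∃? (λ g → act g x ≟ y)

  -- The first element of the orbit in the enumeration. It depends on the orbit alone, which is what
  -- makes it constant on orbits.
  rep : X → X
  rep x = firstOr (orbit? x) x elems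

  orbit-inhabited : ∀ x → Any (Orbit x) elems
  orbit-inhabited x = Any.map (λ { refl → ε , act-ε x }) (∈-elems x)

  rep-orbit : ∀ x → Orbit x (rep x)
  rep-orbit x = firstOr-satisfies (orbit? x) x (orbit-inhabited x)

  rep-act : ∀ g x → rep (act g x) ≡ rep x
  rep-act g x = firstOr-cong (orbit? (act g x)) (orbit? x)
    (λ { (h , eq) → h ∙ g , trans (act-∙ h g x) eq })
    (λ { (h , eq) → h ∙ (g ⁻¹) , trans (act-∙ h (g ⁻¹) (act g x)) (trans (cong (act h) (act-inverseˡ g x)) eq) })
    (act g x) x (orbit-inhabited (act g x))

  -- Left multiplication by some `h` that takes `x` to its representative maps the stabilizer onto
  -- the coset of elements doing the same.
  #-stabilizer : ∀ x → # (λ g → act g x ≟ x) ≡ # (λ g → act g x ≟ rep x)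
  #-stabilizer x with h , eq ← rep-orbit x = #-bijection _ _ (h ∙_) ((h ⁻¹) ∙_)
    (λ g gx≡x → trans (act-∙ h g x) (trans (cong (act h) gx≡x) eq))
    (λ g gx≡r → trans (act-∙ (h ⁻¹) g x) (trans (cong (act (h ⁻¹)) (trans gx≡r (sym eq))) (act-inverseˡ h x)))
    (λ g _ → trans (sym (assoc (h ⁻¹) h g)) (trans (cong (_∙ g) (inverseˡ h)) (identityˡ g)))
    (λ g _ → trans (sym (assoc h (h ⁻¹) g)) (trans (cong (_∙ g) (inverseʳ h)) (identityˡ g)))

  module _ {P : X → Set} (P? : Decidable P) (P-act : ∀ g {x} → P x → P (act g x)) where

    #-fixed : G → ℕ
    #-fixed g = # (λ x → P? x ×-dec (act g x ≟ x))

    -- One element for each orbit inside `P`. An invariant `P` singles out the isomorphisms among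
    -- all coded maps; the trivial `P` serves for the affine orbits.
    #-reps : ℕ
    #-reps = # (λ x → P? x ×-dec (x ≟ rep x))

    -- The stabilizer of x is equinumerous with the set of g taking x to the representative of its
    -- orbit; substituting x for g x, every g then contributes the number of representatives.
    burnside : ∑ᶠ #-fixed ≡ card G * #-reps
    burnside = begin
      ∑ᶠ (λ g → ∑ᶠ (λ x → 𝟙 (P? x ×-dec (act g x ≟ x))))         ≡⟨ ∑ᶠ-swap _ ⟩
      ∑ᶠ (λ x → ∑ᶠ (λ g → 𝟙 (P? x ×-dec (act g x ≟ x))))         ≡⟨ ∑ᶠ-cong (λ x → ∑ᶠ-cong (λ g → 𝟙-× (P? x) _)) ⟩
      ∑ᶠ (λ x → ∑ᶠ (λ g → 𝟙 (P? x) * 𝟙 (act g x ≟ x)))           ≡⟨ ∑ᶠ-cong (λ x → trans (∑ᶠ-*ˡ (𝟙 (P? x)) _)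
                                                                      (trans (cong (𝟙 (P? x) *_) (#-stabilizer x))
                                                                        (sym (∑ᶠ-*ˡ (𝟙 (P? x)) _)))) ⟩
      ∑ᶠ (λ x → ∑ᶠ (λ g → 𝟙 (P? x) * 𝟙 (act g x ≟ rep x)))       ≡⟨ ∑ᶠ-swap _ ⟩
      ∑ᶠ (λ g → ∑ᶠ (λ x → 𝟙 (P? x) * 𝟙 (act g x ≟ rep x)))       ≡⟨ ∑ᶠ-cong (λ g → ∑ᶠ-cong (λ x → pointwise g x)) ⟩
      ∑ᶠ (λ g → ∑ᶠ (λ x → 𝟙 (P? (act g x) ×-dec (act g x ≟ rep (act g x)))))
        ≡⟨ ∑ᶠ-cong (λ g → ∑ᶠ-reindex (act g) (act (g ⁻¹)) (act-inverseˡ g) (act-inverseʳ g)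
             (λ x → 𝟙 (P? x ×-dec (x ≟ rep x)))) ⟩
      ∑ᶠ {G} (λ g → #-reps)                                      ≡⟨ ∑ᶠ-const #-reps ⟩
      card G * #-reps                                            ∎
      where
      open ≡-Reasoning
      pointwise : ∀ g x → 𝟙 (P? x) * 𝟙 (act g x ≟ rep x) ≡ 𝟙 (P? (act g x) ×-dec (act g x ≟ rep (act g x)))
      pointwise g x = trans (sym (𝟙-× (P? x) (act g x ≟ rep x)))
        (𝟙-cong (P? x ×-dec (act g x ≟ rep x)) (P? (act g x) ×-dec (act g x ≟ rep (act g x)))
          (λ { (p , eq) → P-act g p , trans eq (sym (rep-act g x)) })
          (λ { (p , eq) → subst P (act-inverseˡ g x) (P-act (g ⁻¹) p) , trans eq (rep-act g x) }))

  reps : List X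
  reps = filter (λ x → x ≟ rep x) elems

  length-reps : length reps ≡ # (λ x → x ≟ rep x)
  length-reps = trans (length-filter≡∑ (λ x → x ≟ rep x) elems) (sym (∑ᶠ-def {X} _))

  reps-complete : ∀ x → Any (Orbit x) reps
  reps-complete x with g , eq ← rep-orbit x = Any.map (λ { refl → g , eq })
    (∈.∈-filter⁺ (λ x → x ≟ rep x) (∈-elems (rep x)) (trans (sym (rep-act g x)) (cong rep eq) ))

  reps-separated : AllPairs (λ x y → ¬ Orbit x y) reps
  reps-separated = separate (Unique.filter⁺ (λ x → x ≟ rep x) elems-unique)
    (All.tabulate (λ {x} i → proj₂ (∈.∈-filter⁻ (λ x → x ≟ rep x) {xs = elems} i)))
    where
    distinct : ∀ {x y} → x ≡ rep x → y ≡ rep y → x ≢ y → ¬ Orbit x y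
    distinct x≡r y≡r x≢y (g , refl) = x≢y (trans x≡r (trans (sym (rep-act g _)) (sym y≡r)))
    separate : ∀ {xs} → AllPairs _≢_ xs → All (λ x → x ≡ rep x) xs → AllPairs (λ x y → ¬ Orbit x y) xs
    separate AllPairs.[]          _            = AllPairs.[]
    separate (x∉ AllPairs.∷ uniq) (r All.∷ rs) =
      All.zipWith (λ { (x≢y , s) → distinct r s x≢y }) (x∉ , rs) AllPairs.∷ separate uniq rs

-- Shift-invariant sets

module _ (n : ℕ) .{{_ : NonZero n}} where

  open Zmod n

  ShiftInvariant : ℕ → Vec Bool n → Set
  ShiftInvariant i u = ∀ j → lookup u (j ⊕ ⟦ i ⟧) ≡ lookup u j

  shiftInvariant? : ∀ i → Decidable (ShiftInvariant i)
  shiftInvariant? i u = ∀? (λ j → lookup u (j ⊕ ⟦ i ⟧) ≟ lookup u j)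

  module _ (i : ℕ) where

    private
      d : ℕ
      d = gcd i n

      instance
        d≢0 : NonZero d
        d≢0 = ℕ.≢-nonZero (GCD.gcd[m,n]≢0 i n (inj₂ (ℕ.≢-nonZero⁻¹ n)))

      module Zd = Zmod d

    -- The periods `i` and `n` combine by Bézout's identity to the period `d`. Over ℕ the identity
    -- has two forms: `d` plus a multiple of one period is a multiple of the other.
    shiftInvariant-gcd : ∀ u → ShiftInvariant i u → ∀ k → lookup u ⟦ k ⟧ ≡ lookup u ⟦ k % d ⟧
    shiftInvariant-gcd u inv k = trans (cong U (ℕ.m≡m%n+[m/n]*n k d)) (multiple d by-d (k % d) (k / d))
      where
      U : ℕ → Bool
      U k = lookup u ⟦ k ⟧
      multiple : ∀ s → (∀ k → U (k + s) ≡ U k) → ∀ k x → U (k + x * s) ≡ U k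
      multiple s per k zero    = cong U (ℕ.+-identityʳ k)
      multiple s per k (suc x) = trans
        (cong U (trans (cong (k +_) (ℕ.+-comm s (x * s))) (sym (ℕ.+-assoc k (x * s) s))))
        (trans (per (k + x * s)) (multiple s per k x))
      by-i : ∀ k → U (k + i) ≡ U k
      by-i k = trans (cong (lookup u) (⟦⟧-+ k i)) (inv ⟦ k ⟧)
      by-n : ∀ k → U (k + n) ≡ U k
      by-n k = cong (lookup u) (⟦⟧-cong-% (ℕ.[m+n]%n≡m%n k n))
      by-d : ∀ k → U (k + d) ≡ U k
      by-d k with GCD.Bézout.identity (GCD.gcd-GCD i n)
      ... | GCD.Bézout.+- x y eq = trans (sym (multiple n by-n (k + d) y))
        (trans (cong U (trans (ℕ.+-assoc k d (y * n)) (cong (k +_) eq))) (multiple i by-i k x))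
      ... | GCD.Bézout.-+ x y eq = trans (sym (multiple i by-i (k + d) x))
        (trans (cong U (trans (ℕ.+-assoc k d (x * i)) (cong (k +_) eq))) (multiple n by-n k y))

    -- An invariant vector is determined by its first `d` entries, and these are arbitrary because
    -- `d` divides both `i` and `n`.
    #-shiftInvariant : # (shiftInvariant? i) ≡ 2 ^ gcd i n
    #-shiftInvariant = trans
      (#-bijection {Q = λ _ → ⊤} (shiftInvariant? i) (λ _ → yes tt) restrict extend
        (λ _ _ → tt) (λ w _ → extend-invariant w)
        (λ u inv → vec-ext (extend-restrict u inv)) (λ w _ → vec-ext (restrict-extend w)))
      (trans (card-Vec {Bool} d) (cong (_^ d) (∑ᶠ-def {Bool} (λ _ → 1))))
      where
      restrict : Vec Bool n → Vec Bool d
      restrict u = tabulate (λ k → lookup u ⟦ toℕ k ⟧)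
      extend : Vec Bool d → Vec Bool n
      extend w = tabulate (λ j → lookup w Zd.⟦ toℕ j ⟧)
      ⟦⟧%d : ∀ k → Zd.⟦ toℕ ⟦ k ⟧ ⟧ ≡ Zd.⟦ k ⟧
      ⟦⟧%d k = Zd.⟦⟧-cong-% (trans (cong (_% d) (toℕ-⟦⟧ k)) (ℕ.m∣n⇒o%n%m≡o%m d n k (GCD.gcd[m,n]∣n i n)))
      extend-invariant : ∀ w → ShiftInvariant i (extend w)
      extend-invariant w j = begin
        lookup (extend w) (j ⊕ ⟦ i ⟧)            ≡⟨ Vec.lookup∘tabulate _ (j ⊕ ⟦ i ⟧) ⟩
        lookup w Zd.⟦ toℕ (j ⊕ ⟦ i ⟧) ⟧          ≡⟨ cong (λ t → lookup w Zd.⟦ toℕ (t ⊕ ⟦ i ⟧) ⟧) (⟦⟧-toℕ j) ⟨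
        lookup w Zd.⟦ toℕ (⟦ toℕ j ⟧ ⊕ ⟦ i ⟧) ⟧  ≡⟨ cong (λ t → lookup w Zd.⟦ toℕ t ⟧) (⟦⟧-+ (toℕ j) i) ⟨
        lookup w Zd.⟦ toℕ ⟦ toℕ j + i ⟧ ⟧        ≡⟨ cong (lookup w) (⟦⟧%d (toℕ j + i)) ⟩
        lookup w Zd.⟦ toℕ j + i ⟧                ≡⟨ cong (lookup w) (Zd.⟦⟧-cong-% (ℕ.%-remove-+ʳ (toℕ j) (GCD.gcd[m,n]∣m i n))) ⟩
        lookup w Zd.⟦ toℕ j ⟧                    ≡⟨ Vec.lookup∘tabulate _ j ⟨
        lookup (extend w) j                      ∎
        where open ≡-Reasoning
      extend-restrict : ∀ u → ShiftInvariant i u → ∀ j → lookup (extend (restrict u)) j ≡ lookup u j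
      extend-restrict u inv j = begin
        lookup (extend (restrict u)) j           ≡⟨ Vec.lookup∘tabulate _ j ⟩
        lookup (restrict u) Zd.⟦ toℕ j ⟧         ≡⟨ Vec.lookup∘tabulate _ Zd.⟦ toℕ j ⟧ ⟩
        lookup u ⟦ toℕ Zd.⟦ toℕ j ⟧ ⟧            ≡⟨ cong (λ t → lookup u ⟦ t ⟧) (Zd.toℕ-⟦⟧ (toℕ j)) ⟩
        lookup u ⟦ toℕ j % d ⟧                   ≡⟨ shiftInvariant-gcd u inv (toℕ j) ⟨
        lookup u ⟦ toℕ j ⟧                       ≡⟨ cong (lookup u) (⟦⟧-toℕ j) ⟩
        lookup u j                               ∎
        where open ≡-Reasoning
      restrict-extend : ∀ w k → lookup (restrict (extend w)) k ≡ lookup w k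
      restrict-extend w k = begin
        lookup (restrict (extend w)) k           ≡⟨ Vec.lookup∘tabulate _ k ⟩
        lookup (extend w) ⟦ toℕ k ⟧              ≡⟨ Vec.lookup∘tabulate _ ⟦ toℕ k ⟧ ⟩
        lookup w Zd.⟦ toℕ ⟦ toℕ k ⟧ ⟧            ≡⟨ cong (lookup w) (⟦⟧%d (toℕ k)) ⟩
        lookup w Zd.⟦ toℕ k ⟧                    ≡⟨ cong (lookup w) (Zd.⟦⟧-toℕ k) ⟩
        lookup w k                               ∎
        where open ≡-Reasoning

-- Primitive roots

primeDivisor : ∀ e → .{{NonZero e}} → e ≢ 1 → ∃ λ q → Prime q × q ∣ e
primeDivisor e e≢1 with factorise e
... | record { factors = [] ; isFactorisation = eq } = contradiction eq e≢1
... | record { factors = q ∷ qs ; isFactorisation = eq ; factorsPrime = q-prime All.∷ _ } =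
  q , q-prime , subst (q ∣_) (sym eq) (∣.m∣m*n _)

splitPower : ∀ q → Prime q → ∀ n → .{{NonZero n}} → ∃ λ j → ∃ λ n′ → n ≡ q ^ j * n′ × ¬ q ∣ n′
splitPower q q-prime = λ n → <-rec P step n
  where
  P : ℕ → Set
  P n = .{{NonZero n}} → ∃ λ j → ∃ λ n′ → n ≡ q ^ j * n′ × ¬ q ∣ n′
  step : ∀ n → (∀ {k} → k < n → P k) → P n
  step n rec with q ∣.∣? n
  ... | no q∤n = 0 , n , sym (ℕ.+-identityʳ n) , q∤n
  ... | yes (divides k eq) = extend (rec k<n {{k≢0}})
    where
    k≢0 : NonZero k
    k≢0 = ℕ.≢-nonZero (λ { refl → ℕ.≢-nonZero⁻¹ n eq })
    k<n : k < n
    k<n = subst (k <_) (sym eq) (ℕ.m<m*n k q {{k≢0}} (ℕ.nonTrivial⇒n>1 q {{Prime.prime⇒nonTrivial q-prime}}))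
    extend : (∃ λ j → ∃ λ n′ → k ≡ q ^ j * n′ × ¬ q ∣ n′) → ∃ λ j → ∃ λ n′ → n ≡ q ^ j * n′ × ¬ q ∣ n′
    extend (j , n′ , k≡ , q∤n′) =
      suc j , n′ , trans eq (trans (ℕ.*-comm k q) (trans (cong (q *_) k≡) (sym (ℕ.*-assoc q _ _)))) , q∤n′

prime^-coprime : ∀ q → Prime q → ∀ k n → ¬ q ∣ n → Coprime (q ^ k) n
prime^-coprime q q-prime zero    n q∤n (d∣1 , _)   = ∣.∣1⇒≡1 d∣1
prime^-coprime q q-prime (suc k) n q∤n {d} (d∣qqᵏ , d∣n) =
  prime^-coprime q q-prime k n q∤n (Coprime.coprime-divisor d⊥q d∣qqᵏ , d∣n)
  where
  d⊥q : Coprime d q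
  d⊥q (i∣d , i∣q) with Prime.prime⇒irreducible q-prime i∣q
  ... | inj₁ i≡1  = i≡1
  ... | inj₂ refl = contradiction (∣.∣-trans i∣d d∣n) q∤n

coprime-*-∣ : ∀ {m n k} → Coprime m n → m ∣ k → n ∣ k → m * n ∣ k
coprime-*-∣ {m} {n} m⊥n (divides q refl) n∣qm = subst (m * n ∣_) (ℕ.*-comm m q)
  (∣.*-monoʳ-∣ m (Coprime.coprime-divisor (Coprime.sym m⊥n) (subst (n ∣_) (ℕ.*-comm q m) n∣qm)))

-- A power `q ^ i` with `i ≤ j` that divides `m` also divides `n`, hence the gcd, and the cofactor
-- `e` supplies one more factor `q`.
gcdQuotient-powers : ∀ m n e q j n′ → m ≡ e * gcd m n → q ∣ e → n ≡ q ^ j * n′ → ∀ i → i ≤ suc j → q ^ i ∣ m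
gcdQuotient-powers m n e q j n′ m≡e*d q∣e n≡ zero    _         = ∣.1∣ m
gcdQuotient-powers m n e q j n′ m≡e*d q∣e n≡ (suc i) (s≤s i≤j) = subst (q ^ suc i ∣_) (sym m≡e*d)
  (∣.*-pres-∣ q∣e (GCD.gcd-greatest (gcdQuotient-powers m n e q j n′ m≡e*d q∣e n≡ i (ℕ.m≤n⇒m≤1+n i≤j))
    (subst (q ^ i ∣_) (sym n≡) (∣.∣m⇒∣m*n n′
      (subst (λ t → q ^ i ∣ q ^ t) (ℕ.m+[n∸m]≡n i≤j) (subst (q ^ i ∣_) (sym (ℕ.^-distribˡ-+-* q i (j ∸ i))) (∣.m∣m*n _)))))))

-- A prime `q` whose exponent in `m` exceeds `j`, its exact exponent in `n`: the obstruction to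
-- `m ∣ n` from which `order-increase` gains a larger order.
ExcessPrime : ℕ → ℕ → Set
ExcessPrime m n = ∃ λ q → ∃ λ j → ∃ λ n′ → ∃ λ c →
  Prime q × n ≡ q ^ j * n′ × ¬ q ∣ n′ × m ≡ c * q ^ suc j

excessPrime : ∀ m n → .{{_ : NonZero m}} → .{{_ : NonZero n}} → ¬ m ∣ n → ExcessPrime m n
excessPrime m n m∤n = atQuotient (GCD.gcd[m,n]∣m m n)
  where
  atPrime : ∀ e → m ≡ e * gcd m n → (∃ λ q → Prime q × q ∣ e) → ExcessPrime m n
  atPrime e m≡e*d (q , q-prime , q∣e) = split (splitPower q q-prime n)
    where
    split : (∃ λ j → ∃ λ n′ → n ≡ q ^ j * n′ × ¬ q ∣ n′) → ExcessPrime m n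
    split (j , n′ , n≡ , q∤n′) = cofactor (gcdQuotient-powers m n e q j n′ m≡e*d q∣e n≡ (suc j) ℕ.≤-refl)
      where
      cofactor : q ^ suc j ∣ m → ExcessPrime m n
      cofactor (divides c m≡) = q , j , n′ , c , q-prime , n≡ , q∤n′ , m≡
  atQuotient : gcd m n ∣ m → ExcessPrime m n
  atQuotient (divides e m≡e*d) = atPrime e m≡e*d (primeDivisor e
    {{ℕ.≢-nonZero (λ e≡0 → ℕ.≢-nonZero⁻¹ m (trans m≡e*d (cong (_* gcd m n) e≡0)))}}
    (λ e≡1 → m∤n (subst (_∣ n) (sym (trans m≡e*d (trans (cong (_* gcd m n) e≡1) (ℕ.*-identityˡ _)))) (GCD.gcd[m,n]∣n m n))))

least : {P : ℕ → Set} → Decidable P → ∀ b → P b → ∃ λ k → P k × (∀ j → j < k → ¬ P j)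
least {P} P? b Pb = case search b of λ { (inj₂ found) → found ; (inj₁ none) → b , Pb , none }
  where
  search : ∀ b → (∀ j → j < b → ¬ P j) ⊎ ∃ λ k → P k × (∀ j → j < k → ¬ P j)
  search zero = inj₁ (λ j ())
  search (suc b) with search b
  ... | inj₂ found = inj₂ found
  ... | inj₁ none with P? b
  ...   | yes Pb = inj₂ (b , Pb , none)
  ...   | no ¬Pb = inj₁ λ j j<1+b → case ℕ.m≤n⇒m<n∨m≡n (ℕ.≤-pred j<1+b) of λ
            { (inj₁ j<b) → none j j<b ; (inj₂ refl) → ¬Pb }

module PrimeField (p : ℕ) .{{_ : NonZero p}} (p-prime : Prime p) where

  open Zmod p

  infixr 8 _↑_

  _↑_ : Z → ℕ → Z
  x ↑ zero  = 1#
  x ↑ suc k = x ⊗ x ↑ k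

  ↑-+ : ∀ x j k → x ↑ (j + k) ≡ x ↑ j ⊗ x ↑ k
  ↑-+ x zero    k = sym (⊗-identityˡ _)
  ↑-+ x (suc j) k = trans (cong (x ⊗_) (↑-+ x j k)) (sym (⊗-assoc x _ _))

  ↑-* : ∀ x j k → (x ↑ j) ↑ k ≡ x ↑ (j * k)
  ↑-* x j zero    = cong (x ↑_) (sym (ℕ.*-zeroʳ j))
  ↑-* x j (suc k) = trans (cong (x ↑ j ⊗_) (↑-* x j k))
    (trans (sym (↑-+ x j (j * k))) (cong (x ↑_) (sym (ℕ.*-suc j k))))

  ⊗-interchange : ∀ x y z w → (x ⊗ y) ⊗ (z ⊗ w) ≡ (x ⊗ z) ⊗ (y ⊗ w)
  ⊗-interchange = solve 4 (λ x y z w → (x :* y) :* (z :* w) := (x :* z) :* (y :* w)) refl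
    where open Solver

  ⊗-↑ : ∀ x y k → (x ⊗ y) ↑ k ≡ x ↑ k ⊗ y ↑ k
  ⊗-↑ x y zero    = sym (⊗-identityˡ 1#)
  ⊗-↑ x y (suc k) = trans (cong (x ⊗ y ⊗_) (⊗-↑ x y k)) (⊗-interchange x y (x ↑ k) (y ↑ k))

  1<p : 1 < p
  1<p = ℕ.nonTrivial⇒n>1 p {{Prime.prime⇒nonTrivial p-prime}}

  toℕ-0# : toℕ 0# ≡ 0
  toℕ-0# = trans (toℕ-⟦⟧ 0) (ℕ.m<n⇒m%n≡m (ℕ.<-trans (s≤s z≤n) 1<p))

  toℕ-1# : toℕ 1# ≡ 1
  toℕ-1# = trans (toℕ-⟦⟧ 1) (ℕ.m<n⇒m%n≡m 1<p)

  1#≢0# : 1# ≢ 0#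
  1#≢0# eq = case trans (sym toℕ-1#) (trans (cong toℕ eq) toℕ-0#) of λ ()

  ∣toℕ⇒≡0# : ∀ x → p ∣ toℕ x → x ≡ 0#
  ∣toℕ⇒≡0# x p∣x with toℕ x in eq
  ... | zero  = Fin.toℕ-injective (trans eq (sym toℕ-0#))
  ... | suc k = contradiction (∣.∣⇒≤ p∣x) (ℕ.<⇒≱ (subst (_< p) eq (Fin.toℕ<n x)))

  x⊗y≡0⇒x≡0∨y≡0 : ∀ x y → x ⊗ y ≡ 0# → x ≡ 0# ⊎ y ≡ 0#
  x⊗y≡0⇒x≡0∨y≡0 x y eq with Prime.euclidsLemma (toℕ x) (toℕ y) p-prime (∣.m%n≡0⇒n∣m _ p
    (trans (sym (toℕ-⟦⟧ _)) (trans (cong toℕ (trans (sym (⊗-def x y)) eq)) toℕ-0#)))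
  ... | inj₁ p∣x = inj₁ (∣toℕ⇒≡0# x p∣x)
  ... | inj₂ p∣y = inj₂ (∣toℕ⇒≡0# y p∣y)

  ⊖≡0⇒≡ : ∀ x y → x ⊕ ⊖ y ≡ 0# → x ≡ y
  ⊖≡0⇒≡ x y eq = begin
    x              ≡⟨ solve 2 (λ x y → x := (x :+ :- y) :+ y) refl x y ⟩
    x ⊕ ⊖ y ⊕ y    ≡⟨ cong (_⊕ y) eq ⟩
    0# ⊕ y         ≡⟨ ⊕-identityˡ y ⟩
    y              ∎
    where
    open ≡-Reasoning
    open Solver

  ⊗-distribˡ-⊖ : ∀ a x y → a ⊗ (x ⊕ ⊖ y) ≡ a ⊗ x ⊕ ⊖ (a ⊗ y)
  ⊗-distribˡ-⊖ = solve 3 (λ a x y → a :* (x :+ :- y) := a :* x :+ :- (a :* y)) refl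
    where open Solver

  ⊗-cancelˡ : ∀ a x y → a ≢ 0# → a ⊗ x ≡ a ⊗ y → x ≡ y
  ⊗-cancelˡ a x y a≢0 eq = case x⊗y≡0⇒x≡0∨y≡0 a (x ⊕ ⊖ y) a[x-y]≡0 of λ
    { (inj₁ a≡0) → contradiction a≡0 a≢0 ; (inj₂ x-y≡0) → ⊖≡0⇒≡ x y x-y≡0 }
    where
    a[x-y]≡0 : a ⊗ (x ⊕ ⊖ y) ≡ 0#
    a[x-y]≡0 = trans (⊗-distribˡ-⊖ a x y) (trans (cong (_⊕ ⊖ (a ⊗ y)) eq) (⊖-inverseʳ (a ⊗ y)))

  ↑-≢0 : ∀ x k → x ≢ 0# → x ↑ k ≢ 0#
  ↑-≢0 x zero    x≢0 = 1#≢0#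
  ↑-≢0 x (suc k) x≢0 eq with x⊗y≡0⇒x≡0∨y≡0 x (x ↑ k) eq
  ... | inj₁ x≡0  = x≢0 x≡0
  ... | inj₂ xᵏ≡0 = ↑-≢0 x k x≢0 xᵏ≡0

  1↑ : ∀ k → 1# ↑ k ≡ 1#
  1↑ zero    = refl
  1↑ (suc k) = trans (⊗-identityˡ _) (1↑ k)

  HasOrder : Z → ℕ → Set
  HasOrder x n = x ↑ n ≡ 1# × (∀ k → x ↑ k ≡ 1# → n ∣ k)

  ∣⇒↑≡1 : ∀ x n k → x ↑ n ≡ 1# → n ∣ k → x ↑ k ≡ 1#
  ∣⇒↑≡1 x n _ xⁿ≡1 (divides q refl) = trans (cong (x ↑_) (ℕ.*-comm q n))
    (trans (sym (↑-* x n q)) (trans (cong (_↑ q) xⁿ≡1) (1↑ q)))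

  -- Among `p + 1` powers two coincide, and the smaller one cancels. Multiplicative inverses are
  -- later obtained from this too.
  ↑-returns : ∀ x → x ≢ 0# → ∃ λ k → x ↑ suc k ≡ 1#
  ↑-returns x x≢0 = collision (Fin.pigeonhole (ℕ.n<1+n p) (λ (i : Fin (suc p)) → x ↑ toℕ i))
    where
    collision : (∃ λ (i : Fin (suc p)) → ∃ λ j → toℕ i < toℕ j × x ↑ toℕ i ≡ x ↑ toℕ j) → ∃ λ k → x ↑ suc k ≡ 1#
    collision (i , j , i<j , eq) = k , ⊗-cancelˡ (x ↑ toℕ i) (x ↑ suc k) 1# (↑-≢0 x (toℕ i) x≢0) (begin
      x ↑ toℕ i ⊗ x ↑ suc k   ≡⟨ ↑-+ x (toℕ i) (suc k) ⟨
      x ↑ (toℕ i + suc k)     ≡⟨ cong (x ↑_) (trans (ℕ.+-suc (toℕ i) k) (ℕ.m+[n∸m]≡n i<j)) ⟩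
      x ↑ toℕ j               ≡⟨ eq ⟨
      x ↑ toℕ i               ≡⟨ ⊗-identityʳ _ ⟨
      x ↑ toℕ i ⊗ 1#          ∎)
      where
      open ≡-Reasoning
      k : ℕ
      k = toℕ j ∸ suc (toℕ i)

  ↑-% : ∀ x n l → .{{_ : NonZero n}} → x ↑ n ≡ 1# → x ↑ (l % n) ≡ x ↑ l
  ↑-% x n l xⁿ≡1 = begin
    x ↑ (l % n)                    ≡⟨ ⊗-identityʳ _ ⟨
    x ↑ (l % n) ⊗ 1#               ≡⟨ cong (x ↑ (l % n) ⊗_) (∣⇒↑≡1 x n _ xⁿ≡1 (∣.n∣m*n (l / n))) ⟨
    x ↑ (l % n) ⊗ x ↑ (l / n * n)  ≡⟨ ↑-+ x (l % n) _ ⟨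
    x ↑ (l % n + l / n * n)        ≡⟨ cong (x ↑_) (ℕ.m≡m%n+[m/n]*n l n) ⟨
    x ↑ l                          ∎
    where open ≡-Reasoning

  minimal⇒order : ∀ x k → x ↑ suc k ≡ 1# → (∀ j → j < k → x ↑ suc j ≢ 1#) → HasOrder x (suc k)
  minimal⇒order x k eq minimal = eq , λ l xˡ≡1 → ∣.m%n≡0⇒n∣m l (suc k)
    (vanishes (l % suc k) (trans (↑-% x (suc k) l eq) xˡ≡1) (ℕ.m%n<n l (suc k)))
    where
    vanishes : ∀ r → x ↑ r ≡ 1# → r < suc k → r ≡ 0
    vanishes zero    _    _       = refl
    vanishes (suc r) xʳ≡1 (s≤s r<k) = contradiction xʳ≡1 (minimal r r<k)

  order-exists : ∀ x → x ≢ 0# → ∃ λ n → NonZero n × HasOrder x n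
  order-exists x x≢0 =
    let b , xᵇ≡1          = ↑-returns x x≢0
        k , xᵏ≡1 , minimal = least (λ k → x ↑ suc k ≟ 1#) b xᵇ≡1
    in suc k , _ , minimal⇒order x k xᵏ≡1 minimal

  order-↑ : ∀ x c b → .{{NonZero c}} → HasOrder x (c * b) → HasOrder (x ↑ c) b
  order-↑ x c b (x^≡1 , minimal) = trans (↑-* x c b) x^≡1 ,
    λ k eq → ∣.*-cancelˡ-∣ c (minimal (c * k) (trans (sym (↑-* x c k)) eq))

  -- If (xy)ᵏ = 1, raising to the power `n` removes `y`, so `m` divides kn and by coprimality k; the
  -- argument for `n` is symmetric.
  order-⊗ : ∀ x y m n → Coprime m n → HasOrder x m → HasOrder y n → HasOrder (x ⊗ y) (m * n)
  order-⊗ x y m n m⊥n (xᵐ≡1 , x-min) (yⁿ≡1 , y-min) =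
    trans (⊗-↑ x y (m * n)) (trans (cong₂ _⊗_ (∣⇒↑≡1 x m _ xᵐ≡1 (∣.m∣m*n n)) (∣⇒↑≡1 y n _ yⁿ≡1 (∣.n∣m*n m))) (⊗-identityˡ 1#)) ,
    λ k eq → coprime-*-∣ m⊥n (m∣ k eq) (n∣ k eq)
    where
    open ≡-Reasoning
    m∣ : ∀ k → (x ⊗ y) ↑ k ≡ 1# → m ∣ k
    m∣ k eq = Coprime.coprime-divisor m⊥n (subst (m ∣_) (ℕ.*-comm k n) (x-min (k * n) (begin
      x ↑ (k * n)                  ≡⟨ ⊗-identityʳ _ ⟨
      x ↑ (k * n) ⊗ 1#             ≡⟨ cong (x ↑ (k * n) ⊗_) (∣⇒↑≡1 y n _ yⁿ≡1 (∣.n∣m*n k)) ⟨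
      x ↑ (k * n) ⊗ y ↑ (k * n)    ≡⟨ ⊗-↑ x y (k * n) ⟨
      (x ⊗ y) ↑ (k * n)            ≡⟨ ∣⇒↑≡1 (x ⊗ y) k _ eq (∣.m∣m*n n) ⟩
      1#                           ∎)))
    n∣ : ∀ k → (x ⊗ y) ↑ k ≡ 1# → n ∣ k
    n∣ k eq = Coprime.coprime-divisor (Coprime.sym m⊥n) (subst (n ∣_) (ℕ.*-comm k m) (y-min (k * m) (begin
      y ↑ (k * m)                  ≡⟨ ⊗-identityˡ _ ⟨
      1# ⊗ y ↑ (k * m)             ≡⟨ cong (_⊗ y ↑ (k * m)) (∣⇒↑≡1 x m _ xᵐ≡1 (∣.n∣m*n k)) ⟨
      x ↑ (k * m) ⊗ y ↑ (k * m)    ≡⟨ ⊗-↑ x y (k * m) ⟨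
      (x ⊗ y) ↑ (k * m)            ≡⟨ ∣⇒↑≡1 (x ⊗ y) k _ eq (∣.m∣m*n m) ⟩
      1#                           ∎)))

  -- Some prime q occurs in the order m of x with a higher power than in n = qʲ n′; replacing the
  -- q-part of g by that of x multiplies the order by q.
  order-increase : ∀ g n x → .{{NonZero n}} → HasOrder g n → x ≢ 0# → x ↑ n ≢ 1# →
    ∃ λ g′ → ∃ λ n′ → n < n′ × HasOrder g′ n′
  order-increase g n x g-ord x≢0 xⁿ≢1 = increase (order-exists x x≢0)
    where
    Goal : Set
    Goal = ∃ λ g′ → ∃ λ n′ → n < n′ × HasOrder g′ n′
    exchange : ∀ m → NonZero m → HasOrder x m → ExcessPrime m n → Goal
    exchange m m≢0 x-ord (q , j , n′ , c , q-prime , n≡ , q∤n′ , m≡) =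
      (x ↑ c) ⊗ (g ↑ (q ^ j)) , q ^ suc j * n′ ,
      subst (n <_) (trans (cong (q *_) n≡) (sym (ℕ.*-assoc q (q ^ j) n′)))
        (subst (n <_) (ℕ.*-comm n q) (ℕ.m<m*n n q (ℕ.nonTrivial⇒n>1 q {{Prime.prime⇒nonTrivial q-prime}}))) ,
      order-⊗ (x ↑ c) (g ↑ (q ^ j)) (q ^ suc j) n′ (prime^-coprime q q-prime (suc j) n′ q∤n′)
        (order-↑ x c (q ^ suc j)
          {{ℕ.≢-nonZero (λ c≡0 → ℕ.≢-nonZero⁻¹ m {{m≢0}} (trans m≡ (cong (_* q ^ suc j) c≡0)))}}
          (subst (HasOrder x) m≡ x-ord))
        (order-↑ g (q ^ j) n′ {{ℕ.m^n≢0 q j {{Prime.prime⇒nonZero q-prime}}}} (subst (HasOrder g) n≡ g-ord))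
    increase : (∃ λ m → NonZero m × HasOrder x m) → Goal
    increase (m , m≢0 , x-ord) = exchange m m≢0 x-ord
      (excessPrime m n {{m≢0}} (λ m∣n → xⁿ≢1 (∣⇒↑≡1 x m n (proj₁ x-ord) m∣n)))

  -- Horner form of a monic polynomial of degree `n`, the lower coefficients being listed from the
  -- constant term upwards.
  monic : ∀ {n} → Vec Z n → Z → Z
  monic []       x = 1#
  monic (c ∷ cs) x = x ⊗ monic cs x ⊕ c

  horner-base : ∀ x a c o → x ⊗ o ⊕ c ≡ (x ⊕ ⊖ a) ⊗ o ⊕ (a ⊗ o ⊕ c)
  horner-base = solve 4 (λ x a c o → x :* o :+ c := (x :+ :- a) :* o :+ (a :* o :+ c)) refl
    where open Solver

  horner-step : ∀ x a c h f → x ⊗ ((x ⊕ ⊖ a) ⊗ h ⊕ f) ⊕ c ≡ (x ⊕ ⊖ a) ⊗ (x ⊗ h ⊕ f) ⊕ (a ⊗ f ⊕ c)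
  horner-step = solve 5 (λ x a c h f →
    x :* ((x :+ :- a) :* h :+ f) :+ c := (x :+ :- a) :* (x :* h :+ f) :+ (a :* f :+ c)) refl
    where open Solver

  -- Synthetic division: the coefficients of the quotient are the Horner values at `a` of the
  -- successive tails.
  monic-divide : ∀ {n} (cs : Vec Z (suc n)) a → ∃ λ ds →
    ∀ x → monic cs x ≡ (x ⊕ ⊖ a) ⊗ monic {n} ds x ⊕ monic cs a
  monic-divide (c ∷ [])         a = [] , λ x → horner-base x a c 1#
  monic-divide (c ∷ cs@(_ ∷ _)) a = monic cs a ∷ proj₁ rec , λ x → trans
    (cong (λ t → x ⊗ t ⊕ c) (proj₂ rec x)) (horner-step x a c (monic (proj₁ rec) x) (monic cs a))
    where
    rec = monic-divide cs a

  monic-roots : ∀ {n} (cs : Vec Z n) (r : Fin (suc n) → Z) → Injective _≡_ _≡_ r → ¬ (∀ i → monic cs (r i) ≡ 0#)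
  monic-roots {zero}  [] r r-inj roots = 1#≢0# (roots Fin.zero)
  monic-roots {suc n} cs r r-inj roots = reduce (monic-divide cs a)
    where
    a : Z
    a = r Fin.zero
    reduce : ¬ (∃ λ ds → ∀ x → monic cs x ≡ (x ⊕ ⊖ a) ⊗ monic {n} ds x ⊕ monic cs a)
    reduce (ds , eq) = monic-roots ds (r ∘ Fin.suc) (Fin.suc-injective ∘ r-inj) λ i →
      case x⊗y≡0⇒x≡0∨y≡0 (r (Fin.suc i) ⊕ ⊖ a) (monic ds (r (Fin.suc i))) (product≡0 (Fin.suc i)) of λ
      { (inj₁ eq₀) → case r-inj (⊖≡0⇒≡ (r (Fin.suc i)) a eq₀) of λ () ; (inj₂ root) → root }
      where
      product≡0 : ∀ i → (r i ⊕ ⊖ a) ⊗ monic ds (r i) ≡ 0#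
      product≡0 i = trans (sym (⊕-identityʳ _)) (trans (cong ((r i ⊕ ⊖ a) ⊗ monic ds (r i) ⊕_) (sym (roots Fin.zero)))
        (trans (sym (eq (r i))) (roots i)))

  unity-roots : ∀ n → .{{NonZero n}} → (r : Fin (suc n) → Z) → Injective _≡_ _≡_ r → ¬ (∀ i → r i ↑ n ≡ 1#)
  -- Constant term -1 and zeros above it: the polynomial x ↑ (n + 1) - 1.
  unity-roots (suc n) r r-inj roots = monic-roots (⊖ 1# ∷ replicate n 0#) r r-inj λ i →
    trans (cong (λ t → r i ⊗ t ⊕ ⊖ 1#) (monic-replicate n (r i)))
      (trans (cong (_⊕ ⊖ 1#) (roots i)) (⊖-inverseʳ 1#))
    where
    monic-replicate : ∀ n x → monic (replicate n 0#) x ≡ x ↑ n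
    monic-replicate zero    x = refl
    monic-replicate (suc n) x = trans (⊕-identityʳ _) (cong (x ⊗_) (monic-replicate n x))

  -- Its injectivity bounds the order of `g` by `p - 1`; for a primitive root it lists all of ℤ/p.
  powersWithZero : Z → ∀ {n} → Fin (suc n) → Z
  powersWithZero g Fin.zero    = 0#
  powersWithZero g (Fin.suc i) = g ↑ toℕ i

  order⇒≢0 : ∀ g n → .{{NonZero n}} → HasOrder g n → g ≢ 0#
  order⇒≢0 g (suc n) (gⁿ≡1 , _) refl = 1#≢0# (trans (sym gⁿ≡1) (⊗-zeroˡ _))

  ↑-injective-≤ : ∀ g n → .{{NonZero n}} → HasOrder g n → ∀ j k → j ≤ k → k < n → g ↑ j ≡ g ↑ k → j ≡ k
  ↑-injective-≤ g n g-ord j k j≤k k<n eq = ℕ.≤-antisym j≤k (ℕ.m∸n≡0⇒m≤n (difference (k ∸ j) refl))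
    where
    gᵏ⁻ʲ≡1 : g ↑ (k ∸ j) ≡ 1#
    gᵏ⁻ʲ≡1 = ⊗-cancelˡ (g ↑ j) _ _ (↑-≢0 g j (order⇒≢0 g n g-ord))
      (trans (sym (↑-+ g j (k ∸ j))) (trans (cong (g ↑_) (ℕ.m+[n∸m]≡n j≤k)) (trans (sym eq) (sym (⊗-identityʳ _)))))
    difference : ∀ t → k ∸ j ≡ t → k ∸ j ≡ 0
    difference zero    k∸j≡ = k∸j≡
    difference (suc t) k∸j≡ = contradiction
      (∣.∣⇒≤ {{ℕ.≢-nonZero (λ z → case trans (sym k∸j≡) z of λ ())}} (proj₂ g-ord (k ∸ j) gᵏ⁻ʲ≡1))
      (ℕ.<⇒≱ (ℕ.≤-<-trans (ℕ.m∸n≤m k j) k<n))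

  ↑-injective : ∀ g n → .{{NonZero n}} → HasOrder g n → ∀ j k → j < n → k < n → g ↑ j ≡ g ↑ k → j ≡ k
  ↑-injective g n g-ord j k j<n k<n eq with ℕ.≤-total j k
  ... | inj₁ j≤k = ↑-injective-≤ g n g-ord j k j≤k k<n eq
  ... | inj₂ k≤j = sym (↑-injective-≤ g n g-ord k j k≤j j<n (sym eq))

  powersWithZero-injective : ∀ g n → .{{NonZero n}} → HasOrder g n → Injective _≡_ _≡_ (powersWithZero g {n})
  powersWithZero-injective g n g-ord {Fin.zero}  {Fin.zero}  eq = refl
  powersWithZero-injective g n g-ord {Fin.zero}  {Fin.suc j} eq = contradiction (sym eq) (↑-≢0 g (toℕ j) (order⇒≢0 g n g-ord))
  powersWithZero-injective g n g-ord {Fin.suc i} {Fin.zero}  eq = contradiction eq (↑-≢0 g (toℕ i) (order⇒≢0 g n g-ord))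
  powersWithZero-injective g n g-ord {Fin.suc i} {Fin.suc j} eq =
    cong Fin.suc (Fin.toℕ-injective (↑-injective g n g-ord _ _ (Fin.toℕ<n i) (Fin.toℕ<n j) eq))

  -- Otherwise the residues of 1, ..., n + 1 would be `n + 1` distinct roots of xⁿ - 1.
  unity-roots-bound : ∀ n → .{{NonZero n}} → (∀ x → x ≢ 0# → x ↑ n ≡ 1#) → p ≤ suc n
  unity-roots-bound n all-roots = ℕ.≮⇒≥ λ 1+n<p →
    let toℕ-suc : (i : Fin (suc n)) → toℕ ⟦ suc (toℕ i) ⟧ ≡ suc (toℕ i)
        toℕ-suc i = trans (toℕ-⟦⟧ _) (ℕ.m<n⇒m%n≡m (ℕ.≤-<-trans (Fin.toℕ<n i) 1+n<p))
    in unity-roots n (λ i → ⟦ suc (toℕ i) ⟧)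
      (λ {i} {j} eq → Fin.toℕ-injective (ℕ.suc-injective (trans (sym (toℕ-suc i)) (trans (cong toℕ eq) (toℕ-suc j)))))
      (λ i → all-roots ⟦ suc (toℕ i) ⟧ (λ eq → case trans (sym (toℕ-suc i)) (trans (cong toℕ eq) toℕ-0#) of λ ()))

  -- The order `n` is raised until every non-zero x satisfies xⁿ = 1. Then the bound on roots of
  -- unity gives p ≤ n + 1, and the distinct powers of `g` together with 0 give n + 1 ≤ p.
  primitiveRoot : ∃ λ g → HasOrder g (p ∸ 1)
  primitiveRoot = climb p 1# 1 (⊗-identityˡ 1# , λ k _ → ∣.1∣ k) (ℕ.m≤m+n p 1)
    where
    order<p : ∀ g n → .{{NonZero n}} → HasOrder g n → suc n ≤ p
    order<p g n g-ord = Fin.injective⇒≤ (powersWithZero-injective g n g-ord)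
    climb : ∀ fuel g n → .{{NonZero n}} → HasOrder g n → p ≤ fuel + n → ∃ λ g → HasOrder g (p ∸ 1)
    -- Without fuel the invariant reads p ≤ n, which the n + 1 distinct residues rule out.
    climb zero       g n g-ord p≤ = contradiction (order<p g n g-ord) (ℕ.<⇒≱ (s≤s p≤))
    climb (suc fuel) g n g-ord p≤ = next (∃? (λ x → ¬? (x ≟ 0#) ×-dec ¬? (x ↑ n ≟ 1#)))
      where
      larger : (∃ λ g′ → ∃ λ n′ → n < n′ × HasOrder g′ n′) → ∃ λ g → HasOrder g (p ∸ 1)
      larger (g′ , n′ , n<n′ , g′-ord) = climb fuel g′ n′ {{ℕ.>-nonZero (ℕ.≤-<-trans z≤n n<n′)}} g′-ord
        (ℕ.≤-trans p≤ (ℕ.≤-trans (ℕ.≤-reflexive (sym (ℕ.+-suc fuel n))) (ℕ.+-monoʳ-≤ fuel n<n′)))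
      is-root : ¬ (∃ λ x → x ≢ 0# × x ↑ n ≢ 1#) → ∀ x → x ≢ 0# → x ↑ n ≡ 1#
      is-root none x x≢0 = decidable-stable (x ↑ n ≟ 1#) (λ xⁿ≢1 → none (x , x≢0 , xⁿ≢1))
      next : Dec (∃ λ x → x ≢ 0# × x ↑ n ≢ 1#) → ∃ λ g → HasOrder g (p ∸ 1)
      next (yes (x , x≢0 , xⁿ≢1)) = larger (order-increase g n x g-ord x≢0 xⁿ≢1)
      next (no none)              = g , subst (HasOrder g)
        (cong (_∸ 1) (ℕ.≤-antisym (order<p g n g-ord) (unity-roots-bound n (is-root none)))) g-ord

-- Bicirculants over ℤ/p

-- A missed value could be punched out, leaving an injection into a smaller set.
injective⇒surjective : ∀ {n} (f : Fin n → Fin n) → Injective _≡_ _≡_ f → ∀ y → ∃ λ x → f x ≡ y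
injective⇒surjective {suc n} f f-inj y = decidable-stable (Fin.any? (λ x → f x Fin.≟ y)) λ none →
  ℕ.1+n≰n (Fin.injective⇒≤ {f = λ x → Fin.punchOut (λ y≡fx → none (x , sym y≡fx))}
    (λ {i} {j} eq → f-inj (Fin.punchOut-injective {i = y} _ _ eq)))

module Bicirculant (p : ℕ) .{{_ : NonZero p}} (p-prime : Prime p) where

  open Zmod p
  open PrimeField p p-prime
  open Solver using (solve; _:=_; _:+_; _:*_; :-_)

  V : Set
  V = Z × Bool

  -- On τ^x σ^i the adjacency of Cay(D₂ₚ, S) with S = { τ^z : R z } ∪ { τ^z σ : Q z }.
  adj : (R Q : Z → Bool) → V → V → Bool
  adj R Q (x , false) (y , false) = R (y ⊕ ⊖ x)
  adj R Q (x , false) (y , true)  = Q (y ⊕ x)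
  adj R Q (x , true)  (y , false) = Q (y ⊕ x)
  adj R Q (x , true)  (y , true)  = R (y ⊕ ⊖ x)

  -- Right multiplication by τ^k.
  ρ : Z → V → V
  ρ k (x , false) = x ⊕ k , false
  ρ k (x , true)  = x ⊕ ⊖ k , true

  -- Right multiplication by σ, hence an automorphism of every graph `adj R Q`. It exchanges the
  -- layers, and conjugation by it inverts `ρ k`.
  swap : V → V
  swap (x , i) = x , not i

  adj-ρ : ∀ R Q k u v → adj R Q (ρ k u) (ρ k v) ≡ adj R Q u v
  adj-ρ R Q k (x , false) (y , false) = cong R
    (solve 3 (λ x y k → (y :+ k) :+ :- (x :+ k) := y :+ :- x) refl x y k)
  adj-ρ R Q k (x , false) (y , true) = cong Q
    (solve 3 (λ x y k → (y :+ :- k) :+ (x :+ k) := y :+ x) refl x y k)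
  adj-ρ R Q k (x , true) (y , false) = cong Q
    (solve 3 (λ x y k → (y :+ k) :+ (x :+ :- k) := y :+ x) refl x y k)
  adj-ρ R Q k (x , true) (y , true) = cong R
    (solve 3 (λ x y k → (y :+ :- k) :+ :- (x :+ :- k) := y :+ :- x) refl x y k)

  adj-swap : ∀ R Q u v → adj R Q (swap u) (swap v) ≡ adj R Q u v
  adj-swap R Q (x , false) (y , false) = refl
  adj-swap R Q (x , false) (y , true)  = refl
  adj-swap R Q (x , true)  (y , false) = refl
  adj-swap R Q (x , true)  (y , true)  = refl

  swap-involutive : ∀ v → swap (swap v) ≡ v
  swap-involutive (x , i) = cong (x ,_) (Bool.not-involutive i)

  swap-injective : ∀ {u v} → swap u ≡ swap v → u ≡ v
  swap-injective eq = trans (sym (swap-involutive _)) (trans (cong swap eq) (swap-involutive _))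

  swap-ρ : ∀ k v → swap (ρ k v) ≡ ρ (⊖ k) (swap v)
  swap-ρ k (x , false) = cong (λ t → x ⊕ t , true) (sym (⊖-involutive k))
  swap-ρ k (x , true)  = refl

  ρ-⊕ : ∀ k l v → ρ (k ⊕ l) v ≡ ρ k (ρ l v)
  ρ-⊕ k l (x , false) = cong (_, false) (solve 3 (λ x k l → x :+ (k :+ l) := (x :+ l) :+ k) refl x k l)
  ρ-⊕ k l (x , true)  = cong (_, true) (solve 3 (λ x k l → x :+ :- (k :+ l) := (x :+ :- l) :+ :- k) refl x k l)

  ρ-0 : ∀ v → ρ 0# v ≡ v
  ρ-0 (x , false) = cong (_, false) (⊕-identityʳ x)
  ρ-0 (x , true)  = cong (_, true) (trans (cong (x ⊕_) ⊖0#≡0#) (⊕-identityʳ x))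

  ρ-free : ∀ k v → ρ k v ≡ v → k ≡ 0#
  ρ-free k (x , false) eq = trans (solve 2 (λ k x → k := (x :+ k) :+ :- x) refl k x)
    (trans (cong (_⊕ ⊖ x) (cong proj₁ eq)) (⊖-inverseʳ x))
  ρ-free k (x , true) eq = trans (solve 2 (λ k x → k := x :+ :- (x :+ :- k)) refl k x)
    (trans (cong (λ t → x ⊕ ⊖ t) (cong proj₁ eq)) (⊖-inverseʳ x))

  ρ-inverseˡ : ∀ k v → ρ (⊖ k) (ρ k v) ≡ v
  ρ-inverseˡ k v = trans (sym (ρ-⊕ (⊖ k) k v)) (trans (cong (λ t → ρ t v) (⊖-inverseˡ k)) (ρ-0 v))

  ρ-injective : ∀ k {u v} → ρ k u ≡ ρ k v → u ≡ v
  ρ-injective k {u} {v} eq = trans (sym (ρ-inverseˡ k u)) (trans (cong (ρ (⊖ k)) eq) (ρ-inverseˡ k v))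

  inverse : ∀ a → a ≢ 0# → ∃ λ b → b ⊗ a ≡ 1#
  inverse a a≢0 = let k , aᵏ⁺¹≡1 = ↑-returns a a≢0 in a ↑ k , trans (⊗-comm (a ↑ k) a) aᵏ⁺¹≡1

  -- As `c` is invertible, every `w` is a multiple of `c` and is reached from 0 by repeating the
  -- period.
  periodic⇒constant : ∀ (Q : Z → Bool) c → c ≢ 0# → (∀ w → Q (w ⊕ c) ≡ Q w) → ∀ w → Q w ≡ Q 0#
  periodic⇒constant Q c c≢0 per w = from-inverse (inverse c c≢0)
    where
    multiple : ∀ n → Q (⟦ n ⟧ ⊗ c) ≡ Q 0#
    multiple zero    = cong Q (⊗-zeroˡ c)
    multiple (suc n) = trans (cong Q (trans (cong (_⊗ c) (⟦⟧-+ 1 n))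
      (solve 3 (λ o n c → (o :+ n) :* c := n :* c :+ o :* c) refl 1# ⟦ n ⟧ c)))
      (trans (cong (λ t → Q (⟦ n ⟧ ⊗ c ⊕ t)) (⊗-identityˡ c)) (trans (per _) (multiple n)))
    from-inverse : (∃ λ b → b ⊗ c ≡ 1#) → Q w ≡ Q 0#
    from-inverse (b , bc≡1) = trans (cong Q (sym (trans (cong (_⊗ c) (⟦⟧-toℕ (w ⊗ b)))
      (trans (⊗-assoc w b c) (trans (cong (w ⊗_) bc≡1) (⊗-identityʳ w)))))) (multiple (toℕ (w ⊗ b)))

  module _ (f : V → V) where

    Normal : Set
    Normal = ∃ λ a → ∀ v → f (ρ 1# v) ≡ ρ a (f v)

    -- Iteration over a natural number lifting `k`. With `k` inverse to a non-zero `j`, a relation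
    -- at any shift `j` becomes one at the shift 1, which is `Normal`.
    intertwine : ∀ j b → (∀ v → f (ρ j v) ≡ ρ b (f v)) → ∀ k v → f (ρ (k ⊗ j) v) ≡ ρ (k ⊗ b) (f v)
    intertwine j b eq k v = subst (λ k → f (ρ (k ⊗ j) v) ≡ ρ (k ⊗ b) (f v)) (⟦⟧-toℕ k) (go (toℕ k))
      where
      expand : ∀ n c u → ρ (⟦ suc n ⟧ ⊗ c) u ≡ ρ c (ρ (⟦ n ⟧ ⊗ c) u)
      expand n c u = trans (cong (λ t → ρ t u) (trans (cong (_⊗ c) (⟦⟧-+ 1 n))
        (trans (⊗-distribʳ-⊕ c 1# ⟦ n ⟧) (cong (_⊕ ⟦ n ⟧ ⊗ c) (⊗-identityˡ c))))) (ρ-⊕ c (⟦ n ⟧ ⊗ c) u)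
      go : ∀ n → f (ρ (⟦ n ⟧ ⊗ j) v) ≡ ρ (⟦ n ⟧ ⊗ b) (f v)
      go zero    = trans (cong f (trans (cong (λ t → ρ t v) (⊗-zeroˡ j)) (ρ-0 v)))
        (sym (trans (cong (λ t → ρ t (f v)) (⊗-zeroˡ b)) (ρ-0 (f v))))
      go (suc n) = trans (cong f (expand n j v)) (trans (eq _) (trans (cong (ρ b) (go n)) (sym (expand n b (f v)))))

    Affine : Z → Z → Z → Set
    Affine a b₀ b₁ = (∀ x → f (x , false) ≡ (a ⊗ x ⊕ b₀ , false)) × (∀ x → f (x , true) ≡ (a ⊗ x ⊕ b₁ , true))

    InjectiveMap : Set
    InjectiveMap = ∀ u v → f u ≡ f v → u ≡ v

    affine-≢0 : InjectiveMap → ∀ {a b₀} → (∀ x → f (x , false) ≡ (a ⊗ x ⊕ b₀ , false)) → a ≢ 0#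
    affine-≢0 f-inj {a} {b₀} eq₀ refl = 1#≢0# (cong proj₁ (f-inj (1# , false) (0# , false)
      (trans (eq₀ 1#) (trans (cong (λ t → t ⊕ b₀ , false) (trans (⊗-zeroˡ 1#) (sym (⊗-zeroˡ 0#)))) (sym (eq₀ 0#))))))

    normal⇒affine : InjectiveMap → Normal → proj₂ (f (0# , false)) ≡ false → ∃ λ a → ∃ λ b₀ → ∃ λ b₁ → Affine a b₀ b₁
    normal⇒affine f-inj (a , eq) layer₀ = a , b₀ , b₁ , value₀ , λ x → value₁ x (proj₂ (f (0# , true))) refl
      where
      b₀ = proj₁ (f (0# , false))
      b₁ = proj₁ (f (0# , true))
      step : ∀ k v → f (ρ k v) ≡ ρ (k ⊗ a) (f v)
      step k v = trans (cong (λ t → f (ρ t v)) (sym (⊗-identityʳ k))) (intertwine 1# a eq k v)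
      value₀ : ∀ x → f (x , false) ≡ (a ⊗ x ⊕ b₀ , false)
      value₀ x = trans (cong f (cong (_, false) (sym (⊕-identityˡ x)))) (trans (step x (0# , false))
        (trans (cong (λ s → ρ (x ⊗ a) (b₀ , s)) layer₀)
          (cong (_, false) (solve 3 (λ a x b → b :+ x :* a := a :* x :+ b) refl a x b₀))))
      a≢0 : a ≢ 0#
      a≢0 = affine-≢0 f-inj value₀
      value₁ : ∀ x s → proj₂ (f (0# , true)) ≡ s → f (x , true) ≡ (a ⊗ x ⊕ b₁ , true)
      -- On the second layer `ρ` subtracts, both before and after `f`; the two signs cancel and the
      -- multiplier is again `a`.
      value₁ x true  layer₁ = trans (cong f (cong (_, true) (solve 1 (λ x → x := con 0 :+ :- (:- x)) refl x)))
        (trans (step (⊖ x) (0# , true)) (trans (cong (λ s → ρ (⊖ x ⊗ a) (b₁ , s)) layer₁)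
          (cong (_, true) (solve 3 (λ a x b → b :+ :- (:- x :* a) := a :* x :+ b) refl a x b₁))))
        where
        con : ∀ {n} → ℕ → Solver.Polynomial n
        con k = Solver.con (ℤ.+ k)
      -- The image of the first layer already fills the first layer, `a` being invertible, so (0,
      -- true) cannot be sent there.
      value₁ x false layer₁ = contradiction (inverse a a≢0) λ { (c , ca≡1) →
        case f-inj (c ⊗ (b₁ ⊕ ⊖ b₀) , false) (0# , true) (trans (value₀ _) (trans
          (cong (_, false) (trans (solve 4 (λ a c b₁ b₀ → a :* (c :* (b₁ :+ :- b₀)) :+ b₀ := (c :* a) :* (b₁ :+ :- b₀) :+ b₀) refl a c b₁ b₀)
            (trans (cong (λ t → t ⊗ (b₁ ⊕ ⊖ b₀) ⊕ b₀) ca≡1) (trans (cong (_⊕ b₀) (⊗-identityˡ _))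
              (solve 2 (λ b₁ b₀ → (b₁ :+ :- b₀) :+ b₀ := b₁) refl b₁ b₀)))))
          (cong (b₁ ,_) (sym layer₁)))) of λ () }

-- Isomorphisms under the two-sided action of ⟨ρ⟩

module IsomorphismCount (p : ℕ) .{{_ : NonZero p}} (p-prime : Prime p) where

  open Zmod p
  open PrimeField p p-prime
  open Bicirculant p p-prime
  open Solver using (solve; _:=_; _:+_; _:*_; :-_)

  -- Maps on the vertices, tabulated layer by layer: unlike functions, these have decidable equality
  -- and can be counted.
  Code : Set
  Code = Vec V p × Vec V p

  app : Code → V → V
  app c (x , false) = lookup (proj₁ c) x
  app c (x , true)  = lookup (proj₂ c) x

  code : (V → V) → Code
  code f = tabulate (λ x → f (x , false)) , tabulate (λ x → f (x , true))

  app-code : ∀ f v → app (code f) v ≡ f v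
  app-code f (x , false) = Vec.lookup∘tabulate _ x
  app-code f (x , true)  = Vec.lookup∘tabulate _ x

  code-ext : ∀ {c d} → (∀ v → app c v ≡ app d v) → c ≡ d
  code-ext eq = cong₂ _,_ (vec-ext (λ x → eq (x , false))) (vec-ext (λ x → eq (x , true)))

  code-≡ : ∀ f c → (∀ v → f v ≡ app c v) → code f ≡ c
  code-≡ f c eq = code-ext (λ v → trans (app-code f v) (eq v))

  _∙_ : Z × Z → Z × Z → Z × Z
  (i , j) ∙ (k , l) = i ⊕ k , j ⊕ l

  _⁻¹ : Z × Z → Z × Z
  (i , j) ⁻¹ = ⊖ i , ⊖ j

  isGroup : IsGroup _≡_ _∙_ (0# , 0#) _⁻¹
  isGroup = record
    { isMonoid = record
      { isSemigroup = record
        { isMagma = record { isEquivalence = isEquivalence ; ∙-cong = cong₂ _∙_ }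
        ; assoc = λ _ _ _ → cong₂ _,_ (⊕-assoc _ _ _) (⊕-assoc _ _ _) }
      ; identity = (λ _ → cong₂ _,_ (⊕-identityˡ _) (⊕-identityˡ _)) , (λ _ → cong₂ _,_ (⊕-identityʳ _) (⊕-identityʳ _)) }
    ; inverse = (λ _ → cong₂ _,_ (⊖-inverseˡ _) (⊖-inverseˡ _)) , (λ _ → cong₂ _,_ (⊖-inverseʳ _) (⊖-inverseʳ _))
    ; ⁻¹-cong = cong _⁻¹ }
    where open import Relation.Binary.PropositionalEquality.Properties using (isEquivalence)

  act : Z × Z → Code → Code
  act (i , j) c = code (λ v → ρ i (app c (ρ j v)))

  app-act : ∀ i j c v → app (act (i , j) c) v ≡ ρ i (app c (ρ j v))
  app-act i j c v = app-code (λ v → ρ i (app c (ρ j v))) v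

  act-ε : ∀ c → act (0# , 0#) c ≡ c
  act-ε c = code-≡ (λ v → ρ 0# (app c (ρ 0# v))) c (λ v → trans (ρ-0 _) (cong (app c) (ρ-0 v)))

  act-∙ : ∀ g h c → act (g ∙ h) c ≡ act g (act h c)
  act-∙ (i , j) (k , l) c = code-≡ (λ v → ρ (i ⊕ k) (app c (ρ (j ⊕ l) v))) (act (i , j) (act (k , l) c))
    (λ v → sym (trans (app-act i j (act (k , l) c) v) (trans (cong (ρ i) (app-act k l c (ρ j v)))
    (trans (sym (ρ-⊕ i k _)) (cong (λ t → ρ (i ⊕ k) (app c t)) (trans (sym (ρ-⊕ l j v)) (cong (λ t → ρ t v) (⊕-comm l j))))))))

  act-fixed : ∀ {i j c} → act (i , j) c ≡ c → ∀ v → app c (ρ j v) ≡ ρ (⊖ i) (app c v)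
  act-fixed {i} {j} {c} eq v = trans (sym (ρ-inverseˡ i _))
    (cong (ρ (⊖ i)) (trans (sym (app-act i j c v)) (cong (λ d → app d v) eq)))

  -- The vertex set is finite, so injectivity stands for bijectivity.
  Iso : (R Q R′ Q′ : Z → Bool) → (V → V) → Set
  Iso R Q R′ Q′ f = InjectiveMap f × (∀ u v → adj R′ Q′ (f u) (f v) ≡ adj R Q u v)

  iso-cong : ∀ {R Q R′ Q′ f g} → (∀ v → f v ≡ g v) → Iso R Q R′ Q′ f → Iso R Q R′ Q′ g
  iso-cong {R′ = R′} {Q′} eq (f-inj , f-adj) =
    (λ u v e → f-inj u v (trans (eq u) (trans e (sym (eq v))))) ,
    (λ u v → trans (cong₂ (adj R′ Q′) (sym (eq u)) (sym (eq v))) (f-adj u v))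

  normal-cong : ∀ {f g} → (∀ v → f v ≡ g v) → Normal f → Normal g
  normal-cong eq (a , nrm) = a , λ v → trans (sym (eq _)) (trans (nrm v) (cong (ρ a) (eq v)))

  normal? : (c : Code) → Dec (Normal (app c))
  normal? c = ∃? (λ a → ∀? (λ v → app c (ρ 1# v) ≟ ρ a (app c v)))

  -- Since f ρʲ equals ρ to the power ja followed by f on the right, each `j` is completed to a
  -- fixing pair by exactly one `i`, namely -ja.
  stabilizer-normal : ∀ c → InjectiveMap (app c) → Normal (app c) → # (λ g → act g c ≟ c) ≡ p
  stabilizer-normal c c-inj (a , nrm) = trans
    (#-bijection {Q = λ (_ : Z) → ⊤} (λ g → act g c ≟ c) (λ _ → yes tt) proj₂ (λ j → ⊖ (j ⊗ a) , j)
      (λ _ _ → tt) (λ j _ → fixes j)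
      (λ { (i , j) eq → cong (_, j) (determined i j eq) }) (λ _ _ → refl))
    (card-Fin p)
    where
    step : ∀ k v → app c (ρ k v) ≡ ρ (k ⊗ a) (app c v)
    step k v = trans (cong (λ t → app c (ρ t v)) (sym (⊗-identityʳ k))) (intertwine (app c) 1# a nrm k v)
    fixes : ∀ j → act (⊖ (j ⊗ a) , j) c ≡ c
    fixes j = code-≡ (λ v → ρ (⊖ (j ⊗ a)) (app c (ρ j v))) c (λ v → trans (cong (ρ (⊖ (j ⊗ a))) (step j v)) (ρ-inverseˡ (j ⊗ a) (app c v)))
    determined : ∀ i j → act (i , j) c ≡ c → ⊖ (j ⊗ a) ≡ i
    determined i j eq = trans (sym (⊕-identityʳ _)) (trans (cong (⊖ (j ⊗ a) ⊕_) (sym i+ja≡0))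
      (solve 2 (λ i t → :- t :+ (i :+ t) := i) refl i (j ⊗ a)))
      where
      i+ja≡0 : i ⊕ j ⊗ a ≡ 0#
      i+ja≡0 = ρ-free _ (app c (0# , false)) (trans (ρ-⊕ i (j ⊗ a) _) (trans (cong (ρ i) (sym (step j (0# , false))))
        (trans (sym (app-act i j c (0# , false))) (cong (λ d → app d (0# , false)) eq))))

  stabilizer-trivial : ∀ c → InjectiveMap (app c) → ¬ Normal (app c) → # (λ g → act g c ≟ c) ≡ 1
  stabilizer-trivial c c-inj ¬nrm = #-unique (λ g → act g c ≟ c) (0# , 0#) (act-ε c)
    (λ { (i , j) eq → unique i j eq (j ≟ 0#) })
    where
    unique : ∀ i j → act (i , j) c ≡ c → Dec (j ≡ 0#) → (i , j) ≡ (0# , 0#)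
    unique i j eq (no j≢0) = contradiction (normal (inverse j j≢0)) ¬nrm
      where
      normal : (∃ λ k → k ⊗ j ≡ 1#) → Normal (app c)
      normal (k , kj≡1) = k ⊗ ⊖ i , λ v → trans (cong (λ t → app c (ρ t v)) (sym kj≡1))
        (intertwine (app c) j (⊖ i) (act-fixed eq) k v)
    unique i j eq (yes refl) = cong (_, 0#) (trans (sym (⊖-involutive i)) (trans (cong ⊖_
      (ρ-free (⊖ i) (app c (0# , false)) (trans (sym (act-fixed eq (0# , false))) (cong (app c) (ρ-0 (0# , false)))))) ⊖0#≡0#))

  module _ (R Q R′ Q′ : Z → Bool) where

    iso? : (c : Code) → Dec (Iso R Q R′ Q′ (app c))
    iso? c = ∀? (λ u → ∀? (λ v → (app c u ≟ app c v) →-dec (u ≟ v)))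
      ×-dec ∀? (λ u → ∀? (λ v → adj R′ Q′ (app c u) (app c v) ≟ adj R Q u v))

    iso∧normal? : (c : Code) → Dec (Iso R Q R′ Q′ (app c) × Normal (app c))
    iso∧normal? c = iso? c ×-dec normal? c

    private module B = Burnside isGroup act act-ε act-∙

    iso-act : ∀ g {c} → Iso R Q R′ Q′ (app c) → Iso R Q R′ Q′ (app (act g c))
    iso-act (i , j) {c} (c-inj , c-adj) = iso-cong {R} {Q} {R′} {Q′} (λ v → sym (app-act i j c v))
      ((λ u v eq → ρ-injective j (c-inj _ _ (ρ-injective i eq))) ,
       (λ u v → trans (adj-ρ R′ Q′ i (app c (ρ j u)) (app c (ρ j v))) (trans (c-adj (ρ j u) (ρ j v)) (adj-ρ R Q j u v))))

    -- Pairs of an isomorphism and a group element fixing it are counted twice: the stabilizer of an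
    -- isomorphism has 1 + (p - 1) elements if it is normalising and 1 otherwise, and the group has
    -- order p².
    iso-count : # iso? + (p ∸ 1) * # iso∧normal? ≡ p ^ 2 * B.#-reps iso? iso-act
    iso-count = begin
      # iso? + (p ∸ 1) * # iso∧normal?
        ≡⟨ cong (# iso? +_) (∑ᶠ-*ˡ (p ∸ 1) _) ⟨
      # iso? + ∑ᶠ (λ c → (p ∸ 1) * 𝟙 (iso∧normal? c))
        ≡⟨ ∑ᶠ-+ _ _ ⟨
      ∑ᶠ (λ c → 𝟙 (iso? c) + (p ∸ 1) * 𝟙 (iso∧normal? c))
        ≡⟨ ∑ᶠ-cong (λ c → pointwise c (iso? c) (normal? c)) ⟨
      ∑ᶠ (λ c → 𝟙 (iso? c) * # (λ g → act g c ≟ c))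
        ≡⟨ ∑ᶠ-cong (λ c → ∑ᶠ-*ˡ (𝟙 (iso? c)) _) ⟨
      ∑ᶠ (λ c → ∑ᶠ (λ g → 𝟙 (iso? c) * 𝟙 (act g c ≟ c)))
        ≡⟨ ∑ᶠ-cong (λ c → ∑ᶠ-cong (λ g → 𝟙-× (iso? c) (act g c ≟ c))) ⟨
      ∑ᶠ (λ c → ∑ᶠ (λ g → 𝟙 (iso? c ×-dec (act g c ≟ c))))
        ≡⟨ ∑ᶠ-swap _ ⟩
      ∑ᶠ (B.#-fixed iso? iso-act)
        ≡⟨ B.burnside iso? iso-act ⟩
      card (Z × Z) * B.#-reps iso? iso-act
        ≡⟨ cong (_* B.#-reps iso? iso-act) (trans (card-× {Z} {Z}) (trans (cong₂ _*_ (card-Fin p) (card-Fin p))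
             (cong (p *_) (sym (ℕ.*-identityʳ p))))) ⟩
      p ^ 2 * B.#-reps iso? iso-act ∎
      where
      open ≡-Reasoning
      pointwise : ∀ c (d : Dec (Iso R Q R′ Q′ (app c))) (e : Dec (Normal (app c))) →
        𝟙 d * # (λ g → act g c ≟ c) ≡ 𝟙 d + (p ∸ 1) * 𝟙 (d ×-dec e)
      pointwise c (no _)         e         = sym (ℕ.*-zeroʳ (p ∸ 1))
      pointwise c (yes (inj , _)) (no ¬nrm) = trans (cong (_+ 0) (stabilizer-trivial c inj ¬nrm)) (cong suc (sym (ℕ.*-zeroʳ (p ∸ 1))))
      pointwise c (yes (inj , _)) (yes nrm) = trans (cong (_+ 0) (stabilizer-normal c inj nrm))
        (trans (ℕ.+-identityʳ p) (trans (sym (ℕ.m+[n∸m]≡n (ℕ.<⇒≤ 1<p))) (cong suc (sym (ℕ.*-identityʳ (p ∸ 1))))))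

-- Affine equivalence, and isomorphisms for non-constant Q

module CayleyIsomorphism (p : ℕ) .{{_ : NonZero p}} (p-prime : Prime p) (p≢2 : p ≢ 2) where

  open Zmod p
  open PrimeField p p-prime
  open Bicirculant p p-prime
  open IsomorphismCount p p-prime
  open Solver using (solve; _:=_; _:+_; _:*_; :-_)

  -- The pair (a, b) is the automorphism τ ↦ τᵃ, σ ↦ τᵇσ of D₂ₚ, so this relates connection sets by
  -- a group automorphism, as the CI property demands.
  Equivalent : (R Q R′ Q′ : Z → Bool) → Set
  Equivalent R Q R′ Q′ = ∃ λ a → ∃ λ b →
    a ≢ 0# × (∀ z → R′ (a ⊗ z) ≡ R z) × (∀ z → Q′ (a ⊗ z ⊕ b) ≡ Q z)

  swap-normal : ∀ {f} → Normal f → Normal (swap ∘ f)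
  swap-normal {f} (a , nrm) = ⊖ a , λ v → trans (cong swap (nrm v)) (swap-ρ a (f v))

  module _ {R Q R′ Q′ : Z → Bool} where

    affine-R : ∀ {f a b₀ b₁} → Iso R Q R′ Q′ f → Affine f a b₀ b₁ → ∀ z → R′ (a ⊗ z) ≡ R z
    affine-R {f} {a} {b₀} (_ , f-adj) (eq₀ , _) z = begin
      R′ (a ⊗ z)                                        ≡⟨ cong R′ (trans (solve 3 (λ a z b → a :* z := (a :* z :+ b) :+ :- b) refl a z b₀)
                                                             (cong (λ t → a ⊗ z ⊕ b₀ ⊕ ⊖ t) (sym (trans (cong (_⊕ b₀) (⊗-zeroʳ a)) (⊕-identityˡ b₀))))) ⟩
      adj R′ Q′ (a ⊗ 0# ⊕ b₀ , false) (a ⊗ z ⊕ b₀ , false) ≡⟨ cong₂ (adj R′ Q′) (eq₀ 0#) (eq₀ z) ⟨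
      adj R′ Q′ (f (0# , false)) (f (z , false))        ≡⟨ f-adj (0# , false) (z , false) ⟩
      R (z ⊕ ⊖ 0#)                                      ≡⟨ cong R (trans (cong (z ⊕_) ⊖0#≡0#) (⊕-identityʳ z)) ⟩
      R z                                               ∎
      where open ≡-Reasoning

    -- Across the layers adjacency depends on a sum, in which the two translations add up; in the
    -- differences within a layer they cancel.
    affine-Q : ∀ {f a b₀ b₁} → Iso R Q R′ Q′ f → Affine f a b₀ b₁ → ∀ z → Q′ (a ⊗ z ⊕ (b₀ ⊕ b₁)) ≡ Q z
    affine-Q {f} {a} {b₀} {b₁} (_ , f-adj) (eq₀ , eq₁) z = begin
      Q′ (a ⊗ z ⊕ (b₀ ⊕ b₁))                            ≡⟨ cong Q′ (trans (solve 3 (λ t b₀ b₁ → t :+ (b₀ :+ b₁) := (t :+ b₁) :+ b₀) refl (a ⊗ z) b₀ b₁)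
                                                             (cong (a ⊗ z ⊕ b₁ ⊕_) (sym (trans (cong (_⊕ b₀) (⊗-zeroʳ a)) (⊕-identityˡ b₀))))) ⟩
      adj R′ Q′ (a ⊗ 0# ⊕ b₀ , false) (a ⊗ z ⊕ b₁ , true) ≡⟨ cong₂ (adj R′ Q′) (eq₀ 0#) (eq₁ z) ⟨
      adj R′ Q′ (f (0# , false)) (f (z , true))         ≡⟨ f-adj (0# , false) (z , true) ⟩
      Q (z ⊕ 0#)                                        ≡⟨ cong Q (⊕-identityʳ z) ⟩
      Q z                                               ∎
      where open ≡-Reasoning

    swap-iso : ∀ {f} → Iso R Q R′ Q′ f → Iso R Q R′ Q′ (swap ∘ f)
    swap-iso {f} (f-inj , f-adj) = (λ u v eq → f-inj u v (swap-injective eq)) ,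
      (λ u v → trans (adj-swap R′ Q′ (f u) (f v)) (f-adj u v))

    normal⇒equivalent : ∀ f → Iso R Q R′ Q′ f → Normal f → Equivalent R Q R′ Q′
    normal⇒equivalent f f-iso f-nrm = by-layer (proj₂ (f (0# , false))) refl
      where
      affine⇒equivalent : ∀ {g} → Iso R Q R′ Q′ g → (∃ λ a → ∃ λ b₀ → ∃ λ b₁ → Affine g a b₀ b₁) → Equivalent R Q R′ Q′
      affine⇒equivalent {g} g-iso (a , b₀ , b₁ , aff) =
        a , b₀ ⊕ b₁ , affine-≢0 g (proj₁ g-iso) (proj₁ aff) , affine-R g-iso aff , affine-Q g-iso aff
      by-layer : ∀ s → proj₂ (f (0# , false)) ≡ s → Equivalent R Q R′ Q′
      by-layer false layer = affine⇒equivalent f-iso (normal⇒affine f (proj₁ f-iso) f-nrm layer)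
      -- Composition with the automorphism `swap` of the target restores the layers.
      by-layer true  layer = affine⇒equivalent (swap-iso f-iso)
        (normal⇒affine (swap ∘ f) (proj₁ (swap-iso f-iso)) (swap-normal f-nrm) (cong not layer))

  p∤ : ∀ n → .{{NonZero n}} → n < p → ¬ p ∣ n
  p∤ n n<p p∣n = ℕ.<⇒≱ n<p (∣.∣⇒≤ p∣n)

  2<p : 2 < p
  2<p = ℕ.≤∧≢⇒< 1<p (p≢2 ∘ sym)

  -- `p` is prime to `p - 1` and, being odd, to 2, so both factors can be cancelled from a multiple
  -- of p².
  p²∣half : ∀ A N N⁺ N⁻ k → A + (p ∸ 1) * N ≡ p ^ 2 * k → N ≡ N⁺ + N⁻ → N⁺ ≡ N⁻ → p ^ 2 ∣ A → p ^ 2 ∣ N⁺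
  p²∣half A N N⁺ N⁻ k count N≡ refl p²∣A = Coprime.coprime-divisor (prime^-coprime p p-prime 2 2 (p∤ 2 2<p))
    (subst (p ^ 2 ∣_) (trans N≡ (cong (N⁺ +_) (sym (ℕ.+-identityʳ N⁺)))) p²∣N)
    where
    p∤p-1 : ¬ p ∣ p ∸ 1
    p∤p-1 = p∤ (p ∸ 1) {{ℕ.>-nonZero (ℕ.m<n⇒0<n∸m 1<p)}} (ℕ.∸-monoʳ-< {o = 0} (s≤s z≤n) (ℕ.<⇒≤ 1<p))
    p²∣N : p ^ 2 ∣ N
    p²∣N = Coprime.coprime-divisor (prime^-coprime p p-prime 2 (p ∸ 1) p∤p-1)
      (∣.∣m+n∣m⇒∣n (subst (p ^ 2 ∣_) (sym count) (∣.m∣m*n k)) p²∣A)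

  module Automorphisms (R Q : Z → Bool) where

    Layer : Bool → Code → Set
    Layer s c = (Iso R Q R Q (app c) × Normal (app c)) × proj₂ (app c (0# , false)) ≡ s

    layer? : ∀ s → Decidable (Layer s)
    layer? s c = iso∧normal? R Q R Q c ×-dec (proj₂ (app c (0# , false)) ≟ s)

    #-normal : # (iso∧normal? R Q R Q) ≡ # (layer? false) + # (layer? true)
    #-normal = trans (∑ᶠ-cong (λ c → split (iso∧normal? R Q R Q c) (proj₂ (app c (0# , false))))) (∑ᶠ-+ _ _)
      where
      split : {A : Set} (d : Dec A) (s : Bool) → 𝟙 d ≡ 𝟙 (d ×-dec (s ≟ false)) + 𝟙 (d ×-dec (s ≟ true))
      split (no _)  s     = refl
      split (yes _) false = refl
      split (yes _) true  = refl

    -- Composition with `swap` exchanges the two kinds.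
    #-layers : # (layer? false) ≡ # (layer? true)
    #-layers = #-bijection (layer? false) (layer? true) exchange exchange
      (λ c → exchange-layer c true) (λ c → exchange-layer c false)
      (λ c _ → involutive c) (λ c _ → involutive c)
      where
      exchange : Code → Code
      exchange c = code (swap ∘ app c)
      app-exchange : ∀ c v → app (exchange c) v ≡ swap (app c v)
      app-exchange c = app-code (swap ∘ app c)
      involutive : ∀ c → exchange (exchange c) ≡ c
      involutive c = code-≡ (swap ∘ app (exchange c)) c (λ v → trans (cong swap (app-exchange c v)) (swap-involutive _))
      exchange-layer : ∀ c s → Layer (not s) c → Layer s (exchange c)
      exchange-layer c s ((iso , nrm) , layer) =
        (iso-cong {R} {Q} {R} {Q} (λ v → sym (app-exchange c v)) (swap-iso iso) ,
         normal-cong (λ v → sym (app-exchange c v)) (swap-normal nrm)) ,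
        trans (cong proj₂ (app-exchange c (0# , false))) (trans (cong not layer) (Bool.not-involutive s))

    identity-layer : Layer false (code id)
    identity-layer =
      (iso-cong {R} {Q} {R} {Q} (λ v → sym (app-code id v)) ((λ _ _ eq → eq) , λ _ _ → refl) ,
       normal-cong (λ v → sym (app-code id v)) (1# , λ _ → refl)) ,
      cong proj₂ (app-code id (0# , false))

    -- Two normalising automorphisms that agree on the first layer differ by a translation of the
    -- second layer, so that Q has a non-zero period.
    few-normal : (∃ λ x → Q x ≢ Q 0#) → # (layer? false) < p ^ 2
    few-normal (x , Qx≢Q0) = ℕ.≰⇒> λ p²≤ → contradiction
      (pigeonhole (layer? false) distinct? key key-distinct (ℕ.<-≤-trans #distinct<p² p²≤)) no-collision
      where
      distinct? : Decidable (λ (ab : Z × Z) → proj₁ ab ≢ proj₂ ab)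
      distinct? (a , b) = ¬? (a ≟ b)
      #distinct<p² : # distinct? < p ^ 2
      #distinct<p² = subst (# distinct? <_) (trans (card-× {Z} {Z}) (trans (cong₂ _*_ (card-Fin p) (card-Fin p))
        (cong (p *_) (sym (ℕ.*-identityʳ p))))) (#<card distinct? (0# , 0#) (λ 0≢0 → 0≢0 refl))
      -- The images of 0 and 1 determine an affine map on the first layer. They are distinct, which
      -- keeps the number of possible keys below p².
      key : Code → Z × Z
      key c = proj₁ (app c (0# , false)) , proj₁ (app c (1# , false))
      affine : ∀ c → Layer false c → ∃ λ a → ∃ λ b₀ → ∃ λ b₁ → Affine (app c) a b₀ b₁
      affine c ((iso , nrm) , layer) = normal⇒affine (app c) (proj₁ iso) nrm layer
      key₀ : ∀ c {a b₀ b₁} → Affine (app c) a b₀ b₁ → proj₁ (key c) ≡ b₀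
      key₀ c {a} {b₀} (eq₀ , _) = trans (cong proj₁ (eq₀ 0#)) (trans (cong (_⊕ b₀) (⊗-zeroʳ a)) (⊕-identityˡ b₀))
      key₁ : ∀ c {a b₀ b₁} → Affine (app c) a b₀ b₁ → proj₂ (key c) ≡ a ⊕ b₀
      key₁ c {a} {b₀} (eq₀ , _) = trans (cong proj₁ (eq₀ 1#)) (cong (_⊕ b₀) (⊗-identityʳ a))
      key-distinct : ∀ c → Layer false c → proj₁ (key c) ≢ proj₂ (key c)
      key-distinct c ((iso , nrm) , layer) eq = 1#≢0# (sym (cong proj₁ (proj₁ iso (0# , false) (1# , false)
        (same-layer (affine c ((iso , nrm) , layer))))))
        where
        same-layer : (∃ λ a → ∃ λ b₀ → ∃ λ b₁ → Affine (app c) a b₀ b₁) → app c (0# , false) ≡ app c (1# , false)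
        same-layer (a , b₀ , b₁ , eq₀ , _) = cong₂ _,_ eq (trans layer (sym (cong proj₂ (eq₀ 1#))))
      no-collision : ¬ (∃ λ c → ∃ λ d → Layer false c × Layer false d × c ≢ d × key c ≡ key d)
      no-collision (c , d , Lc , Ld , c≢d , key≡) = collide (affine c Lc) (affine d Ld)
        where
        collide : (∃ λ a → ∃ λ b₀ → ∃ λ b₁ → Affine (app c) a b₀ b₁) →
          ¬ (∃ λ a → ∃ λ b₀ → ∃ λ b₁ → Affine (app d) a b₀ b₁)
        collide (a , b₀ , b₁ , c-aff) (a′ , b₀′ , b₁′ , d-aff) =
          Qx≢Q0 (periodic⇒constant Q (b₁′ ⊕ ⊖ b₁) period≢0 periodic x)
          where
          b₀≡ : b₀ ≡ b₀′
          b₀≡ = trans (sym (key₀ c c-aff)) (trans (cong proj₁ key≡) (key₀ d d-aff))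
          a+b₀≡ : a ⊕ b₀ ≡ a′ ⊕ b₀′
          a+b₀≡ = trans (sym (key₁ c c-aff)) (trans (cong proj₂ key≡) (key₁ d d-aff))
          a≡ : a ≡ a′
          a≡ = trans (solve 2 (λ a b → a := (a :+ b) :+ :- b) refl a b₀) (trans (cong₂ (λ s t → s ⊕ ⊖ t) a+b₀≡ b₀≡)
            (solve 2 (λ a b → (a :+ b) :+ :- b := a) refl a′ b₀′))
          agree : b₁ ≡ b₁′ → ∀ v → app c v ≡ app d v
          agree b₁≡ (x , false) = trans (proj₁ c-aff x) (trans (cong₂ (λ a b → a ⊗ x ⊕ b , false) a≡ b₀≡) (sym (proj₁ d-aff x)))
          agree b₁≡ (x , true)  = trans (proj₂ c-aff x) (trans (cong₂ (λ a b → a ⊗ x ⊕ b , true) a≡ b₁≡) (sym (proj₂ d-aff x)))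
          period≢0 : b₁′ ⊕ ⊖ b₁ ≢ 0#
          period≢0 eq = c≢d (code-ext (agree (sym (⊖≡0⇒≡ b₁′ b₁ eq))))
          -- Both automorphisms carry `Q` to itself, with the shifts b₀ + b₁ and b₀ + b₁′. Comparing
          -- them at `z` gives the period at a z + b₀ + b₁, which runs through all residues as `a`
          -- is invertible.
          periodic′ : ∀ z → Q (a ⊗ z ⊕ (b₀ ⊕ b₁) ⊕ (b₁′ ⊕ ⊖ b₁)) ≡ Q (a ⊗ z ⊕ (b₀ ⊕ b₁))
          periodic′ z = trans (cong Q (trans
              (solve 4 (λ t b₀ b₁ b → (t :+ (b₀ :+ b₁)) :+ (b :+ :- b₁) := t :+ (b₀ :+ b)) refl (a ⊗ z) b₀ b₁ b₁′)
              (cong₂ (λ a b → a ⊗ z ⊕ (b ⊕ b₁′)) a≡ b₀≡)))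
            (trans (affine-Q (proj₁ (proj₁ Ld)) d-aff z) (sym (affine-Q (proj₁ (proj₁ Lc)) c-aff z)))
          periodic : ∀ w → Q (w ⊕ (b₁′ ⊕ ⊖ b₁)) ≡ Q w
          periodic w = from-inverse (inverse a (affine-≢0 (app c) (proj₁ (proj₁ (proj₁ Lc))) (proj₁ c-aff)))
            where
            from-inverse : (∃ λ k → k ⊗ a ≡ 1#) → Q (w ⊕ (b₁′ ⊕ ⊖ b₁)) ≡ Q w
            from-inverse (k , ka≡1) = subst (λ t → Q (t ⊕ (b₁′ ⊕ ⊖ b₁)) ≡ Q t) az≡w (periodic′ (k ⊗ (w ⊕ ⊖ (b₀ ⊕ b₁))))
              where
              az≡w : a ⊗ (k ⊗ (w ⊕ ⊖ (b₀ ⊕ b₁))) ⊕ (b₀ ⊕ b₁) ≡ w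
              az≡w = trans (solve 4 (λ a k w b → a :* (k :* (w :+ :- b)) :+ b := (k :* a) :* (w :+ :- b) :+ b) refl a k w (b₀ ⊕ b₁))
                (trans (cong (λ t → t ⊗ (w ⊕ ⊖ (b₀ ⊕ b₁)) ⊕ (b₀ ⊕ b₁)) ka≡1)
                  (trans (cong (_⊕ (b₀ ⊕ b₁)) (⊗-identityˡ _)) (solve 2 (λ w b → (w :+ :- b) :+ b := w) refl w (b₀ ⊕ b₁))))

    p²∤#-automorphisms : (∃ λ x → Q x ≢ Q 0#) → ¬ p ^ 2 ∣ # (iso? R Q R Q)
    p²∤#-automorphisms nonconst p²∣A = ℕ.<⇒≱ (few-normal nonconst)
      -- The identity makes the count positive, so that divisibility by p² bounds it from below.
      (∣.∣⇒≤ {{ℕ.>-nonZero (#-pos (layer? false) (code id) identity-layer)}}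
        (p²∣half (# (iso? R Q R Q)) (# (iso∧normal? R Q R Q)) (# (layer? false)) (# (layer? true)) _
          (iso-count R Q R Q) #-normal #-layers p²∣A))

  module _ {R Q R′ Q′ : Z → Bool} (f f⁻¹ : V → V) (invˡ : ∀ v → f⁻¹ (f v) ≡ v) (invʳ : ∀ v → f (f⁻¹ v) ≡ v)
    (f-adj : ∀ u v → adj R′ Q′ (f u) (f v) ≡ adj R Q u v) where

    -- The isomorphisms form a coset of the automorphism group.
    #-iso≡#-automorphisms : # (iso? R Q R′ Q′) ≡ # (iso? R Q R Q)
    #-iso≡#-automorphisms = #-bijection (iso? R Q R′ Q′) (iso? R Q R Q)
      (λ c → code (f⁻¹ ∘ app c)) (λ c → code (f ∘ app c))
      (λ { c (c-inj , c-adj) → iso-cong {R} {Q} {R} {Q} (λ v → sym (app-code (f⁻¹ ∘ app c) v))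
        ((λ u v eq → c-inj u v (trans (sym (invʳ _)) (trans (cong f eq) (invʳ _)))) ,
         (λ u v → trans (f⁻¹-adj (app c u) (app c v)) (c-adj u v))) })
      (λ { c (c-inj , c-adj) → iso-cong {R} {Q} {R′} {Q′} (λ v → sym (app-code (f ∘ app c) v))
        ((λ u v eq → c-inj u v (trans (sym (invˡ _)) (trans (cong f⁻¹ eq) (invˡ _)))) ,
         (λ u v → trans (f-adj (app c u) (app c v)) (c-adj u v))) })
      (λ c _ → code-≡ (f ∘ app (code (f⁻¹ ∘ app c))) c (λ v → trans (cong f (app-code (f⁻¹ ∘ app c) v)) (invʳ _)))
      (λ c _ → code-≡ (f⁻¹ ∘ app (code (f ∘ app c))) c (λ v → trans (cong f⁻¹ (app-code (f ∘ app c) v)) (invˡ _)))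
      where
      f⁻¹-adj : ∀ u v → adj R Q (f⁻¹ u) (f⁻¹ v) ≡ adj R′ Q′ u v
      f⁻¹-adj u v = trans (sym (f-adj (f⁻¹ u) (f⁻¹ v))) (cong₂ (adj R′ Q′) (invʳ u) (invʳ v))

    equivalent-nonconstant : (∃ λ x → Q x ≢ Q 0#) → Equivalent R Q R′ Q′
    equivalent-nonconstant nonconst = from-normal (#≢0⇒∃ (iso∧normal? R Q R′ Q′) N≢0)
      where
      from-normal : (∃ λ c → Iso R Q R′ Q′ (app c) × Normal (app c)) → Equivalent R Q R′ Q′
      from-normal (c , iso , nrm) = normal⇒equivalent (app c) iso nrm
      N≢0 : # (iso∧normal? R Q R′ Q′) ≢ 0
      N≢0 N≡0 = Automorphisms.p²∤#-automorphisms R Q nonconst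
        (p²∣ (# (iso? R Q R′ Q′)) (# (iso∧normal? R Q R′ Q′)) (# (iso? R Q R Q)) _ (iso-count R Q R′ Q′) N≡0 #-iso≡#-automorphisms)
        where
        p²∣ : ∀ I N A k → I + (p ∸ 1) * N ≡ p ^ 2 * k → N ≡ 0 → I ≡ A → p ^ 2 ∣ A
        p²∣ I .0 .I k count refl refl = subst (p ^ 2 ∣_)
          (trans (sym count) (trans (cong (I +_) (ℕ.*-zeroʳ (p ∸ 1))) (ℕ.+-identityʳ I))) (∣.m∣m*n k)

-- The CI property, including constant Q

module CIProperty (p : ℕ) .{{_ : NonZero p}} (p-prime : Prime p) (p≢2 : p ≢ 2) where

  open Zmod p
  open PrimeField p p-prime
  open Bicirculant p p-prime
  open CayleyIsomorphism p p-prime p≢2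
  open Solver using (solve; _:=_; _:+_; _:*_; :-_)

  equivalent-sym : ∀ {R Q R′ Q′} → Equivalent R Q R′ Q′ → Equivalent R′ Q′ R Q
  equivalent-sym {R} {Q} {R′} {Q′} (a , b , a≢0 , R≡ , Q≡) = from-inverse (inverse a a≢0)
    where
    from-inverse : (∃ λ k → k ⊗ a ≡ 1#) → Equivalent R′ Q′ R Q
    from-inverse (k , ka≡1) = k , ⊖ (k ⊗ b) , k≢0 ,
      (λ z → trans (sym (R≡ (k ⊗ z))) (cong R′ (akz≡z z))) ,
      (λ z → trans (sym (Q≡ (k ⊗ z ⊕ ⊖ (k ⊗ b)))) (cong Q′ (begin
        a ⊗ (k ⊗ z ⊕ ⊖ (k ⊗ b)) ⊕ b         ≡⟨ solve 4 (λ a k z b → a :* (k :* z :+ :- (k :* b)) :+ b := a :* (k :* z) :+ (b :+ :- (a :* (k :* b)))) refl a k z b ⟩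
        a ⊗ (k ⊗ z) ⊕ (b ⊕ ⊖ (a ⊗ (k ⊗ b))) ≡⟨ cong₂ (λ s t → s ⊕ (b ⊕ ⊖ t)) (akz≡z z) (akz≡z b) ⟩
        z ⊕ (b ⊕ ⊖ b)                       ≡⟨ cong (z ⊕_) (⊖-inverseʳ b) ⟩
        z ⊕ 0#                              ≡⟨ ⊕-identityʳ z ⟩
        z                                   ∎)))
      where
      open ≡-Reasoning
      akz≡z : ∀ z → a ⊗ (k ⊗ z) ≡ z
      akz≡z z = trans (solve 3 (λ a k z → a :* (k :* z) := (k :* a) :* z) refl a k z)
        (trans (cong (_⊗ z) ka≡1) (⊗-identityˡ z))
      k≢0 : k ≢ 0#
      k≢0 k≡0 = 1#≢0# (trans (sym ka≡1) (trans (cong (_⊗ a) k≡0) (⊗-zeroˡ a)))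

  -- An isomorphism of circulants extends to the graphs with a perfect matching (Q = {0}) added
  -- between the two layers, to which the non-constant case applies.
  circulant-equivalent : ∀ {R R′} (φ : Z → Z) → Injective _≡_ _≡_ φ → (∀ x y → R′ (φ y ⊕ ⊖ φ x) ≡ R (y ⊕ ⊖ x)) →
    ∃ λ a → a ≢ 0# × (∀ z → R′ (a ⊗ z) ≡ R z)
  circulant-equivalent {R} {R′} φ φ-inj φ-adj = drop-matching
    (equivalent-nonconstant {R} {δ} {R′} {δ} F F⁻¹ F-invˡ F-invʳ F-adj (1# , δ1≢δ0))
    where
    δ : Z → Bool
    δ x = does (x ≟ 0#)
    δ1≢δ0 : δ 1# ≢ δ 0#
    δ1≢δ0 eq = distinguish (1# ≟ 0#) (0# ≟ 0#) eq
      where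
      distinguish : (d : Dec (1# ≡ 0#)) (e : Dec (0# ≡ 0#)) → does d ≢ does e
      distinguish (yes 1≡0) _         _ = 1#≢0# 1≡0
      distinguish (no _)    (no 0≢0)  _ = 0≢0 refl
    ψ : Z → Z
    ψ y = proj₁ (injective⇒surjective φ φ-inj y)
    φψ : ∀ y → φ (ψ y) ≡ y
    φψ y = proj₂ (injective⇒surjective φ φ-inj y)
    ψφ : ∀ x → ψ (φ x) ≡ x
    ψφ x = φ-inj (φψ (φ x))
    F F⁻¹ : V → V
    F (x , false)   = φ x , false
    -- The matching joins (x, false) to (-x, true), so the second layer has to carry `φ` conjugated
    -- by negation.
    F (x , true)    = ⊖ φ (⊖ x) , true
    F⁻¹ (x , false) = ψ x , false
    F⁻¹ (x , true)  = ⊖ ψ (⊖ x) , true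
    F-invˡ : ∀ v → F⁻¹ (F v) ≡ v
    F-invˡ (x , false) = cong (_, false) (ψφ x)
    F-invˡ (x , true)  = cong (_, true) (trans (cong (λ t → ⊖ ψ t) (⊖-involutive _)) (trans (cong ⊖_ (ψφ _)) (⊖-involutive x)))
    F-invʳ : ∀ v → F (F⁻¹ v) ≡ v
    F-invʳ (x , false) = cong (_, false) (φψ x)
    F-invʳ (x , true)  = cong (_, true) (trans (cong (λ t → ⊖ φ t) (⊖-involutive _)) (trans (cong ⊖_ (φψ _)) (⊖-involutive x)))
    matching : ∀ x y → δ (⊖ φ (⊖ y) ⊕ φ x) ≡ δ (y ⊕ x)
    matching x y = does-⇔ (mk⇔
      (λ eq → trans (⊕-comm y x) (trans (cong (x ⊕_) (sym (⊖-involutive y)))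
        (trans (cong (_⊕ ⊖ (⊖ y)) (φ-inj (⊖≡0⇒≡ (φ x) (φ (⊖ y)) (trans (⊕-comm _ _) eq)))) (⊖-inverseʳ (⊖ y)))))
      (λ eq → trans (cong (λ t → ⊖ φ t ⊕ φ x) (sym (⊖≡0⇒≡ x (⊖ y) (trans (cong (x ⊕_) (⊖-involutive y)) (trans (⊕-comm x y) eq)))))
        (⊖-inverseˡ (φ x)))) (⊖ φ (⊖ y) ⊕ φ x ≟ 0#) (y ⊕ x ≟ 0#)
    F-adj : ∀ u v → adj R′ δ (F u) (F v) ≡ adj R δ u v
    F-adj (x , false) (y , false) = φ-adj x y
    F-adj (x , false) (y , true)  = matching x y
    F-adj (x , true)  (y , false) = trans (cong δ (⊕-comm _ _)) (trans (matching y x) (cong δ (⊕-comm _ _)))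
    F-adj (x , true)  (y , true)  = trans (cong R′ (⊕-comm _ _))
      (trans (cong (λ t → R′ (t ⊕ ⊖ φ (⊖ y))) (⊖-involutive _)) (trans (φ-adj (⊖ y) (⊖ x))
        (cong R (trans (cong (⊖ x ⊕_) (⊖-involutive y)) (⊕-comm _ _)))))
    drop-matching : Equivalent R δ R′ δ → ∃ λ a → a ≢ 0# × (∀ z → R′ (a ⊗ z) ≡ R z)
    drop-matching (a , _ , a≢0 , R≡ , _) = a , a≢0 , R≡

  cross : ∀ R Q c → (∀ x → Q x ≡ c) → ∀ u v → proj₂ u ≢ proj₂ v → adj R Q u v ≡ c
  cross R Q c const (x , false) (y , false) ne = contradiction refl ne
  cross R Q c const (x , false) (y , true)  ne = const _
  cross R Q c const (x , true)  (y , false) ne = const _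
  cross R Q c const (x , true)  (y , true)  ne = contradiction refl ne

  parallel : ∀ R Q s x y → adj R Q (x , s) (y , s) ≡ R (y ⊕ ⊖ x)
  parallel R Q false x y = refl
  parallel R Q true  x y = refl

  module _ {R Q R′ Q′ : Z → Bool} (f f⁻¹ : V → V) (invˡ : ∀ v → f⁻¹ (f v) ≡ v) (invʳ : ∀ v → f (f⁻¹ v) ≡ v)
    (f-adj : ∀ u v → adj R′ Q′ (f u) (f v) ≡ adj R Q u v) (R0≡ : R 0# ≡ R′ 0#) where

    f-injective : ∀ {u v} → f u ≡ f v → u ≡ v
    f-injective eq = trans (sym (invˡ _)) (trans (cong f⁻¹ eq) (invˡ _))

    f⁻¹-adj : ∀ u v → adj R Q (f⁻¹ u) (f⁻¹ v) ≡ adj R′ Q′ u v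
    f⁻¹-adj u v = trans (sym (f-adj (f⁻¹ u) (f⁻¹ v))) (cong₂ (adj R′ Q′) (invʳ u) (invʳ v))

    -- The images of (0,0) and (0,1) lie in the same layer, hence have a common c′-neighbour w;
    -- its preimage lies in a layer opposite to one of the two.
    constants-agree : ∀ c c′ → (∀ x → Q x ≡ c) → (∀ x → Q′ x ≡ c′) → c ≡ c′
    constants-agree c c′ Q≡c Q′≡c′ = by-layers (proj₂ (f (0# , false)) ≟ proj₂ (f (0# , true)))
      where
      w : V
      w = 0# , not (proj₂ (f (0# , false)))
      opposite : ∀ s z → proj₂ (f (0# , s)) ≡ proj₂ (f (0# , false)) → f z ≡ w → proj₂ z ≡ not s → c ≡ c′
      opposite s z same fz≡w layer = begin
        c                                    ≡⟨ cross R Q c Q≡c (0# , s) z (λ eq → Bool.not-¬ (sym eq) layer) ⟨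
        adj R Q (0# , s) z                   ≡⟨ f-adj (0# , s) z ⟨
        adj R′ Q′ (f (0# , s)) (f z)         ≡⟨ cross R′ Q′ c′ Q′≡c′ (f (0# , s)) (f z)
                                                  (λ eq → Bool.not-¬ same (trans eq (cong proj₂ fz≡w))) ⟩
        c′                                   ∎
        where open ≡-Reasoning
      by-layers : Dec (proj₂ (f (0# , false)) ≡ proj₂ (f (0# , true))) → c ≡ c′
      by-layers (no ne)    = trans (sym (cross R Q c Q≡c (0# , false) (0# , true) (λ ())))
        (trans (sym (f-adj _ _)) (cross R′ Q′ c′ Q′≡c′ _ _ ne))
      by-layers (yes same) = by-preimage (proj₂ (f⁻¹ w)) refl
        where
        by-preimage : ∀ s → proj₂ (f⁻¹ w) ≡ s → c ≡ c′
        by-preimage true  layer = opposite false (f⁻¹ w) refl (invʳ w) layer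
        by-preimage false layer = opposite true (f⁻¹ w) (sym same) (invʳ w) layer

    -- If R r ≠ c for some r ≠ 0, then x and x + r on the first layer cannot be sent to different
    -- layers, where adjacency is `c`. Steps by `r` reach the whole first layer, so it goes into a
    -- single layer and `f` restricts to an isomorphism of circulants. If there is no such r, all
    -- pairs of distinct vertices have adjacency `c` in both graphs, and the identity serves.
    equivalent-constant : ∀ c → (∀ x → Q x ≡ c) → (∀ x → Q′ x ≡ c) → Equivalent R Q R′ Q′
    equivalent-constant c Q≡c Q′≡c = by-distinguished (∃? (λ r → ¬? (r ≟ 0#) ×-dec ¬? (R r ≟ c)))
      where
      extend : (∃ λ a → a ≢ 0# × (∀ z → R′ (a ⊗ z) ≡ R z)) → Equivalent R Q R′ Q′
      extend (a , a≢0 , R≡) = a , 0# , a≢0 , R≡ , λ z → trans (Q′≡c _) (sym (Q≡c z))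
      by-distinguished : Dec (∃ λ r → r ≢ 0# × R r ≢ c) → Equivalent R Q R′ Q′
      by-distinguished (yes (r , r≢0 , Rr≢c)) = extend (circulant-equivalent {R} {R′} φ φ-inj φ-adj)
        where
        s : Bool
        s = proj₂ (f (0# , false))
        φ : Z → Z
        φ x = proj₁ (f (x , false))
        step : ∀ x → proj₂ (f (x ⊕ r , false)) ≡ proj₂ (f (x , false))
        step x = decidable-stable (proj₂ (f (x ⊕ r , false)) ≟ proj₂ (f (x , false))) λ ne → Rr≢c (begin
          R r                                             ≡⟨ cong R (solve 2 (λ x r → r := (x :+ r) :+ :- x) refl x r) ⟩
          adj R Q (x , false) (x ⊕ r , false)             ≡⟨ f-adj (x , false) (x ⊕ r , false) ⟨
          adj R′ Q′ (f (x , false)) (f (x ⊕ r , false))   ≡⟨ cross R′ Q′ c Q′≡c (f (x , false)) (f (x ⊕ r , false)) (ne ∘ sym) ⟩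
          c                                               ∎)
          where open ≡-Reasoning
        layer : ∀ x → proj₂ (f (x , false)) ≡ s
        layer = periodic⇒constant (λ x → proj₂ (f (x , false))) r r≢0 step
        value : ∀ x → f (x , false) ≡ (φ x , s)
        value x = cong (φ x ,_) (layer x)
        φ-inj : Injective _≡_ _≡_ φ
        φ-inj {x} {y} eq = cong proj₁ (f-injective (trans (value x) (trans (cong (_, s) eq) (sym (value y)))))
        φ-adj : ∀ x y → R′ (φ y ⊕ ⊖ φ x) ≡ R (y ⊕ ⊖ x)
        φ-adj x y = trans (sym (parallel R′ Q′ s (φ x) (φ y)))
          (trans (sym (cong₂ (adj R′ Q′) (value x) (value y))) (f-adj (x , false) (y , false)))
      by-distinguished (no none) = 1# , 0# , 1#≢0# , (λ z → trans (cong R′ (⊗-identityˡ z)) (R≡ z (z ≟ 0#))) ,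
        (λ z → trans (Q′≡c _) (sym (Q≡c z)))
        where
        R≡c : ∀ r → r ≢ 0# → R r ≡ c
        R≡c r r≢0 = decidable-stable (R r ≟ c) (λ Rr≢c → none (r , r≢0 , Rr≢c))
        adj≡c : ∀ u v → u ≢ v → adj R Q u v ≡ c
        adj≡c (x , s) (y , t) u≢v = by-layers (s ≟ t)
          where
          by-layers : Dec (s ≡ t) → adj R Q (x , s) (y , t) ≡ c
          by-layers (no s≢t)   = cross R Q c Q≡c (x , s) (y , t) s≢t
          by-layers (yes refl) = trans (parallel R Q s x y) (R≡c _ (λ eq → u≢v (cong (_, s) (sym (⊖≡0⇒≡ y x eq)))))
        R≡ : ∀ z → Dec (z ≡ 0#) → R′ z ≡ R z
        R≡ z (yes refl) = sym R0≡
        R≡ z (no z≢0)   = trans (cong R′ (sym (trans (cong (z ⊕_) ⊖0#≡0#) (⊕-identityʳ z))))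
          (trans (sym (f⁻¹-adj (0# , false) (z , false))) (trans
            (adj≡c (f⁻¹ (0# , false)) (f⁻¹ (z , false)) (λ eq → z≢0 (cong proj₁ (trans (sym (invʳ _)) (trans (cong f (sym eq)) (invʳ _))))))
            (sym (R≡c z z≢0))))

    isomorphic⇒equivalent : Equivalent R Q R′ Q′
    isomorphic⇒equivalent = by-Q (∃? (λ x → ¬? (Q x ≟ Q 0#))) (∃? (λ x → ¬? (Q′ x ≟ Q′ 0#)))
      where
      constant : ∀ (P : Z → Bool) → ¬ (∃ λ x → P x ≢ P 0#) → ∀ x → P x ≡ P 0#
      constant P none x = decidable-stable (P x ≟ P 0#) (λ ne → none (x , ne))
      by-Q : Dec (∃ λ x → Q x ≢ Q 0#) → Dec (∃ λ x → Q′ x ≢ Q′ 0#) → Equivalent R Q R′ Q′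
      by-Q (yes nonconst) _              = equivalent-nonconstant f f⁻¹ invˡ invʳ f-adj nonconst
      by-Q (no _)         (yes nonconst) = equivalent-sym {R′} {Q′} {R} {Q} (equivalent-nonconstant f⁻¹ f invʳ invˡ f⁻¹-adj nonconst)
      by-Q (no const)     (no const′)    = equivalent-constant (Q 0#) (constant Q const)
        (λ x → trans (constant Q′ const′ x) (sym (constants-agree (Q 0#) (Q′ 0#) (constant Q const) (constant Q′ const′))))

-- Cayley graphs of the dihedral group

module CayleyGraphs (p : ℕ) .{{_ : NonZero p}} (p-prime : Prime p) (p≢2 : p ≢ 2) where

  open Zmod p
  open PrimeField p p-prime
  open Bicirculant p p-prime
  open CayleyIsomorphism p p-prime p≢2
  open CIProperty p p-prime p≢2
  open Dihedral p
  open Solver using (solve; _:=_; _:+_; _:*_; :-_)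

  rotations reflections : Subset → Z → Bool
  rotations   S x = S (x , false)
  reflections S x = S (x , true)

  mod≡⊖ : ∀ x → (p ∸ toℕ x) mod p ≡ ⊖ x
  mod≡⊖ x = sym (trans (⊖-def x) (⟦⟧-def _))

  mod≡⊕ : ∀ x k → (toℕ x + k) mod p ≡ x ⊕ ⟦ k ⟧
  mod≡⊕ x k = trans (sym (⟦⟧-def _)) (trans (⟦⟧-+ (toℕ x) k) (cong (_⊕ ⟦ k ⟧) (⟦⟧-toℕ x)))

  mod≡⊖′ : ∀ x y → (toℕ y + (p ∸ toℕ x)) mod p ≡ y ⊕ ⊖ x
  mod≡⊖′ x y = trans (mod≡⊕ y _) (cong (y ⊕_) (sym (⊖-def x)))

  -- A reflection is its own inverse and conjugates τ to τ⁻¹: differences appear within a layer and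
  -- sums across.
  ·-⁻¹-adj : ∀ S g h → S (h · (g ⁻¹)) ≡ adj (rotations S) (reflections S) g h
  ·-⁻¹-adj S (x , false) (y , false) = cong (rotations S)
    (trans (mod≡⊕ y _) (cong (y ⊕_) (trans (⟦⟧-toℕ _) (mod≡⊖ x))))
  ·-⁻¹-adj S (x , false) (y , true)  = cong (reflections S)
    (trans (mod≡⊖′ _ y) (cong (y ⊕_) (trans (cong ⊖_ (mod≡⊖ x)) (⊖-involutive x))))
  ·-⁻¹-adj S (x , true)  (y , false) = cong (reflections S) (trans (mod≡⊕ y _) (cong (y ⊕_) (⟦⟧-toℕ x)))
  ·-⁻¹-adj S (x , true)  (y , true)  = cong (rotations S) (mod≡⊖′ x y)

  ⇔⇒≡ : ∀ {a b : Bool} → (a ≡ true) ⇔ (b ≡ true) → a ≡ b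
  ⇔⇒≡ {true}  {b}     eqv = sym (Equivalence.to eqv refl)
  ⇔⇒≡ {false} {true}  eqv = Equivalence.from eqv refl
  ⇔⇒≡ {false} {false} eqv = refl

  SetEquivalent : Subset → Subset → Set
  SetEquivalent S T = Equivalent (rotations S) (reflections S) (rotations T) (reflections T)

  CayIso⇒equivalent : ∀ S T → IsConnectionSet S → IsConnectionSet T → CayIso S T → SetEquivalent S T
  CayIso⇒equivalent S T (Se , _) (Te , _) (f , f-adj) = isomorphic⇒equivalent
    {rotations S} {reflections S} {rotations T} {reflections T}
    (Inverse.to f) (Inverse.from f) (λ v → Inverse.inverseʳ f refl) (λ v → Inverse.inverseˡ f refl)
    (λ u v → trans (sym (·-⁻¹-adj T (Inverse.to f u) (Inverse.to f v))) (trans (sym (⇔⇒≡ (f-adj u v))) (·-⁻¹-adj S u v)))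
    (trans (cong (rotations S) (⟦⟧-def 0)) (trans Se (trans (sym Te) (cong (rotations T) (sym (⟦⟧-def 0))))))

  equivalent⇒CayIso : ∀ S T → SetEquivalent S T → CayIso S T
  equivalent⇒CayIso S T (a , b , a≢0 , R≡ , Q≡) = from-inverse (inverse a a≢0)
    where
    from-inverse : (∃ λ k → k ⊗ a ≡ 1#) → CayIso S T
    from-inverse (k , ka≡1) = mk↔ₛ′ F F⁻¹ invˡ invʳ , λ g h →
      let eq = trans (·-⁻¹-adj T (F g) (F h)) (trans (F-adj g h) (sym (·-⁻¹-adj S g h)))
      in mk⇔ (trans eq) (trans (sym eq))
      where
      F F⁻¹ : V → V
      F (x , false)   = a ⊗ x , false
      F (x , true)    = a ⊗ x ⊕ b , true
      F⁻¹ (x , false) = k ⊗ x , false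
      F⁻¹ (x , true)  = k ⊗ (x ⊕ ⊖ b) , true
      kaz≡z : ∀ z → k ⊗ (a ⊗ z) ≡ z
      kaz≡z z = trans (sym (⊗-assoc k a z)) (trans (cong (_⊗ z) ka≡1) (⊗-identityˡ z))
      akz≡z : ∀ z → a ⊗ (k ⊗ z) ≡ z
      akz≡z z = trans (sym (⊗-assoc a k z)) (trans (cong (_⊗ z) (trans (⊗-comm a k) ka≡1)) (⊗-identityˡ z))
      invˡ : ∀ v → F (F⁻¹ v) ≡ v
      invˡ (x , false) = cong (_, false) (akz≡z x)
      invˡ (x , true)  = cong (_, true) (trans (cong (_⊕ b) (akz≡z _)) (solve 2 (λ x b → (x :+ :- b) :+ b := x) refl x b))
      invʳ : ∀ v → F⁻¹ (F v) ≡ v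
      invʳ (x , false) = cong (_, false) (kaz≡z x)
      invʳ (x , true)  = cong (_, true) (trans (cong (k ⊗_) (solve 2 (λ x b → (x :+ b) :+ :- b := x) refl (a ⊗ x) b)) (kaz≡z x))
      F-adj : ∀ g h → adj (rotations T) (reflections T) (F g) (F h) ≡ adj (rotations S) (reflections S) g h
      F-adj (x , false) (y , false) = trans (cong (rotations T)
        (solve 3 (λ a x y → a :* y :+ :- (a :* x) := a :* (y :+ :- x)) refl a x y)) (R≡ _)
      F-adj (x , false) (y , true)  = trans (cong (reflections T)
        (solve 4 (λ a x y b → (a :* y :+ b) :+ a :* x := a :* (y :+ x) :+ b) refl a x y b)) (Q≡ _)
      F-adj (x , true)  (y , false) = trans (cong (reflections T)
        (solve 4 (λ a x y b → a :* y :+ (a :* x :+ b) := a :* (y :+ x) :+ b) refl a x y b)) (Q≡ _)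
      F-adj (x , true)  (y , true)  = trans (cong (rotations T)
        (solve 4 (λ a x y b → (a :* y :+ b) :+ :- (a :* x :+ b) := a :* (y :+ :- x)) refl a x y b)) (R≡ _)

-- Orbits of the affine group

module Counting (m : ℕ) .{{_ : NonZero m}} (p-prime : Prime (suc (2 * m))) where

  -- `n` is the order of the multiplicative group of ℤ/p, and `m` the number of pairs {x, -x} of
  -- non-zero residues.
  n p : ℕ
  n = 2 * m
  p = suc n

  instance
    n≢0 : NonZero n
    n≢0 = ℕ.m*n≢0 2 m

  p≢2 : p ≢ 2
  p≢2 eq = absurd m (ℕ.suc-injective eq)
    where
    absurd : ∀ m → 2 * m ≢ 1
    absurd (suc m) eq = case ℕ.suc-injective (trans (sym (ℕ.*-suc 2 m)) eq) of λ ()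

  open Zmod p
  open PrimeField p p-prime
  open CayleyIsomorphism p p-prime p≢2 using (Equivalent)
  open CayleyGraphs p p-prime p≢2
  open Dihedral p using (Subset; IsConnectionSet; ConnectionSet; CayIso)
  open Solver using (solve; _:=_; _:+_; _:*_; :-_)
  module Zm = Zmod m
  module Zn = Zmod n

  g : Z
  g = proj₁ primitiveRoot

  abstract
    g-order : HasOrder g n
    g-order = proj₂ primitiveRoot

  m∣n : m ∣ n
  m∣n = divides 2 refl

  g≢0 : g ≢ 0#
  g≢0 = order⇒≢0 g n g-order

  -- `g ↑ m` is a root of x² - 1 and differs from 1, as `m` lies below the order. Negation thereby
  -- becomes the shift of exponents by `m`.
  gᵐ≡-1 : g ↑ m ≡ ⊖ 1#
  gᵐ≡-1 = case x⊗y≡0⇒x≡0∨y≡0 (g ↑ m ⊕ ⊖ 1#) (g ↑ m ⊕ 1#) product≡0 of λ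
    { (inj₁ eq) → contradiction (∣.∣⇒≤ (proj₂ g-order m (⊖≡0⇒≡ (g ↑ m) 1# eq))) (ℕ.<⇒≱ m<n)
    ; (inj₂ eq) → ⊖≡0⇒≡ (g ↑ m) (⊖ 1#) (trans (cong (g ↑ m ⊕_) (⊖-involutive 1#)) eq) }
    where
    m<n : m < n
    m<n = subst (m <_) (cong (m +_) (sym (ℕ.+-identityʳ m))) (ℕ.m<m+n m (ℕ.>-nonZero⁻¹ m))
    product≡0 : (g ↑ m ⊕ ⊖ 1#) ⊗ (g ↑ m ⊕ 1#) ≡ 0#
    product≡0 = begin
      (g ↑ m ⊕ ⊖ 1#) ⊗ (g ↑ m ⊕ 1#)  ≡⟨ solve 2 (λ x o → (x :+ :- o) :* (x :+ o) := x :* x :+ :- (o :* o)) refl (g ↑ m) 1# ⟩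
      g ↑ m ⊗ g ↑ m ⊕ ⊖ (1# ⊗ 1#)    ≡⟨ cong₂ (λ s t → s ⊕ ⊖ t) (sym (↑-+ g m m)) (⊗-identityˡ 1#) ⟩
      g ↑ (m + m) ⊕ ⊖ 1#             ≡⟨ cong (λ t → g ↑ (m + t) ⊕ ⊖ 1#) (ℕ.+-identityʳ m) ⟨
      g ↑ n ⊕ ⊖ 1#                   ≡⟨ cong (_⊕ ⊖ 1#) (proj₁ g-order) ⟩
      1# ⊕ ⊖ 1#                      ≡⟨ ⊖-inverseʳ 1# ⟩
      0#                             ∎
      where open ≡-Reasoning

  ⊖-↑ : ∀ k → ⊖ (g ↑ k) ≡ g ↑ (k + m)
  ⊖-↑ k = sym (trans (↑-+ g k m) (trans (cong (g ↑ k ⊗_) gᵐ≡-1)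
    (trans (sym (⊖-distribʳ-⊗ (g ↑ k) 1#)) (cong ⊖_ (⊗-identityʳ (g ↑ k))))))

  exp : Fin n → Z
  exp i = g ↑ toℕ i

  ↑≡exp : ∀ k → g ↑ k ≡ exp Zn.⟦ k ⟧
  ↑≡exp k = sym (trans (cong (g ↑_) (Zn.toℕ-⟦⟧ k)) (↑-% g n k (proj₁ g-order)))

  exp-⊕ : ∀ i j → exp (i Zn.⊕ j) ≡ exp i ⊗ exp j
  exp-⊕ i j = trans (cong exp (Zn.⊕-def i j)) (trans (sym (↑≡exp (toℕ i + toℕ j))) (↑-+ g (toℕ i) (toℕ j)))

  exp-0 : exp Zn.0# ≡ 1#
  exp-0 = sym (↑≡exp 0)

  exp≢0 : ∀ i → exp i ≢ 0#
  exp≢0 i = ↑-≢0 g (toℕ i) g≢0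

  toℕ-0ₙ : toℕ Zn.0# ≡ 0
  toℕ-0ₙ = trans (Zn.toℕ-⟦⟧ 0) (ℕ.m<n⇒m%n≡m (ℕ.>-nonZero⁻¹ n))

  exp≢1 : ∀ i → i ≢ Zn.0# → exp i ≢ 1#
  exp≢1 i i≢0 eq = i≢0 (Fin.toℕ-injective (↑-injective g n g-order (toℕ i) (toℕ Zn.0#) (Fin.toℕ<n i) (Fin.toℕ<n Zn.0#)
    (trans eq (sym exp-0))))

  abstract

    -- Discrete logarithm to the base `g`, moved up by one to make room for 0.
    index : Z → Fin (suc n)
    index x = proj₁ (injective⇒surjective (powersWithZero g {n}) (powersWithZero-injective g n g-order) x)

    powersWithZero-index : ∀ x → powersWithZero g (index x) ≡ x
    powersWithZero-index x = proj₂ (injective⇒surjective (powersWithZero g {n}) (powersWithZero-injective g n g-order) x)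

  index-powersWithZero : ∀ i → index (powersWithZero g i) ≡ i
  index-powersWithZero i = powersWithZero-injective g n g-order (powersWithZero-index (powersWithZero g i))

  by-index : (P : Z → Set) → P 0# → (∀ i → P (exp i)) → ∀ x → P x
  by-index P P0 Pexp x = subst P (powersWithZero-index x) (go (index x))
    where
    go : ∀ i → P (powersWithZero g i)
    go Fin.zero    = P0
    go (Fin.suc i) = Pexp i

  onPowers : Bool → (Fin n → Bool) → Fin (suc n) → Bool
  onPowers s w Fin.zero    = s
  onPowers s w (Fin.suc i) = w i

  glue : Bool → (Fin n → Bool) → Z → Bool
  glue s w x = onPowers s w (index x)

  glue-0 : ∀ s w → glue s w 0# ≡ s
  glue-0 s w = cong (onPowers s w) (index-powersWithZero Fin.zero)

  glue-exp : ∀ s w i → glue s w (exp i) ≡ w i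
  glue-exp s w i = cong (onPowers s w) (index-powersWithZero (Fin.suc i))

  -- Coordinates of a connection set. As -1 = gᵐ, a symmetric set of non-zero rotations is a set of
  -- exponents modulo `m`; the reflections, being involutions, form an arbitrary subset of ℤ/p.
  X : Set
  X = Vec Bool m × Vec Bool p

  rotationSet : Vec Bool m → Z → Bool
  rotationSet u = glue false (λ i → lookup u Zm.⟦ toℕ i ⟧)

  rotationSet-↑ : ∀ u k → rotationSet u (g ↑ k) ≡ lookup u Zm.⟦ k ⟧
  rotationSet-↑ u k = trans (cong (rotationSet u) (↑≡exp k)) (trans (glue-exp false _ Zn.⟦ k ⟧)
    (cong (lookup u) (Zm.⟦⟧-cong-% (trans (cong (_% m) (Zn.toℕ-⟦⟧ k)) (ℕ.m∣n⇒o%n%m≡o%m m n k m∣n)))))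

  rotationSet-⊖ : ∀ u x → rotationSet u (⊖ x) ≡ rotationSet u x
  rotationSet-⊖ u = by-index (λ x → rotationSet u (⊖ x) ≡ rotationSet u x) (cong (rotationSet u) ⊖0#≡0#)
    (λ i → trans (cong (rotationSet u) (⊖-↑ (toℕ i))) (trans (rotationSet-↑ u (toℕ i + m))
      (trans (cong (lookup u) (Zm.⟦⟧-cong-% (ℕ.[m+n]%n≡m%n (toℕ i) m))) (sym (rotationSet-↑ u (toℕ i))))))

  subset : X → Subset
  subset (u , v) (x , false) = rotationSet u x
  subset (u , v) (x , true)  = lookup v x

  subset-isConnectionSet : ∀ x → IsConnectionSet (subset x)
  subset-isConnectionSet (u , v) = trans (cong (rotationSet u) (sym (⟦⟧-def 0))) (glue-0 false _) , symmetric
    where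
    symmetric : ∀ d → subset (u , v) (Dihedral._⁻¹ p d) ≡ subset (u , v) d
    symmetric (x , false) = trans (cong (rotationSet u) (mod≡⊖ x)) (rotationSet-⊖ u x)
    symmetric (x , true)  = refl

  connectionSet : X → ConnectionSet
  connectionSet x = subset x , subset-isConnectionSet x

  encode : Subset → X
  encode S = tabulate (λ j → S (g ↑ toℕ j , false)) , tabulate (λ x → S (x , true))

  subset-encode : ∀ S → IsConnectionSet S → ∀ d → subset (encode S) d ≡ S d
  subset-encode S _ (x , true) = Vec.lookup∘tabulate (reflections S) x
  subset-encode S (Se , S⁻¹) (x , false) = by-index (λ x → rotationSet (proj₁ (encode S)) x ≡ S (x , false))
    (trans (glue-0 false _) (sym (trans (cong (rotations S) (⟦⟧-def 0)) Se)))
    (λ i → trans (rotationSet-↑ (proj₁ (encode S)) (toℕ i)) (trans (Vec.lookup∘tabulate (λ j → rotations S (g ↑ toℕ j)) Zm.⟦ toℕ i ⟧)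
      (trans (cong (λ k → rotations S (g ↑ k)) (Zm.toℕ-⟦⟧ (toℕ i))) (reduce (toℕ i))))) x
    where
    shift : ∀ k → rotations S (g ↑ (k + m)) ≡ rotations S (g ↑ k)
    shift k = trans (cong (rotations S) (sym (⊖-↑ k)))
      (trans (cong (rotations S) (sym (mod≡⊖ (g ↑ k)))) (S⁻¹ (g ↑ k , false)))
    shifts : ∀ k q → rotations S (g ↑ (k + q * m)) ≡ rotations S (g ↑ k)
    shifts k zero    = cong (λ t → rotations S (g ↑ t)) (ℕ.+-identityʳ k)
    shifts k (suc q) = trans (cong (λ t → rotations S (g ↑ t))
      (trans (cong (k +_) (ℕ.+-comm m (q * m))) (sym (ℕ.+-assoc k (q * m) m)))) (trans (shift (k + q * m)) (shifts k q))
    reduce : ∀ k → rotations S (g ↑ (k % m)) ≡ rotations S (g ↑ k)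
    reduce k = trans (sym (shifts (k % m) (k / m))) (cong (λ t → rotations S (g ↑ t)) (sym (ℕ.m≡m%n+[m/n]*n k m)))

  G : Set
  G = Fin n × Z

  -- (i , b) is the affine map y ↦ gⁱ y + b, acting on subsets by preimage; _∙_ is therefore the
  -- opposite of composition.
  _∙_ : G → G → G
  (i , b) ∙ (j , c) = i Zn.⊕ j , exp j ⊗ b ⊕ c

  ε : G
  ε = Zn.0# , 0#

  _⁻¹ : G → G
  (i , b) ⁻¹ = Zn.⊖ i , ⊖ (exp (Zn.⊖ i) ⊗ b)

  isGroup : IsGroup _≡_ _∙_ ε _⁻¹
  isGroup = record
    { isMonoid = record
      { isSemigroup = record
        { isMagma = record { isEquivalence = isEquivalence ; ∙-cong = cong₂ _∙_ }
        ; assoc = λ { (i , b) (j , c) (k , d) → cong₂ _,_ (Zn.⊕-assoc i j k)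
            (trans (solve 4 (λ ek ejb c d → ek :* (ejb :+ c) :+ d := ek :* ejb :+ (ek :* c :+ d)) refl (exp k) (exp j ⊗ b) c d)
              (cong (_⊕ (exp k ⊗ c ⊕ d)) (trans (sym (⊗-assoc (exp k) (exp j) b))
                (cong (_⊗ b) (trans (⊗-comm (exp k) (exp j)) (sym (exp-⊕ j k))))))) } }
      ; identity =
        (λ { (i , b) → cong₂ _,_ (Zn.⊕-identityˡ i) (trans (cong (_⊕ b) (⊗-zeroʳ (exp i))) (⊕-identityˡ b)) }) ,
        (λ { (i , b) → cong₂ _,_ (Zn.⊕-identityʳ i)
          (trans (⊕-identityʳ _) (trans (cong (_⊗ b) exp-0) (⊗-identityˡ b))) }) }
    ; inverse =
      (λ { (i , b) → cong₂ _,_ (Zn.⊖-inverseˡ i) (trans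
        (solve 3 (λ e f b → e :* (:- (f :* b)) :+ b := b :+ :- ((e :* f) :* b)) refl (exp i) (exp (Zn.⊖ i)) b)
        (trans (cong (λ t → b ⊕ ⊖ (t ⊗ b)) (trans (sym (exp-⊕ i (Zn.⊖ i))) (trans (cong exp (Zn.⊖-inverseʳ i)) exp-0)))
          (trans (cong (λ t → b ⊕ ⊖ t) (⊗-identityˡ b)) (⊖-inverseʳ b)))) }) ,
      (λ { (i , b) → cong₂ _,_ (Zn.⊖-inverseʳ i) (⊖-inverseʳ _) })
    ; ⁻¹-cong = cong _⁻¹ }
    where open import Relation.Binary.PropositionalEquality.Properties using (isEquivalence)

  shift : Fin n → Vec Bool m → Vec Bool m
  shift i u = tabulate (λ j → lookup u (j Zm.⊕ Zm.⟦ toℕ i ⟧))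

  substitute : G → Vec Bool p → Vec Bool p
  substitute (i , b) v = tabulate (λ y → lookup v (exp i ⊗ y ⊕ b))

  act : G → X → X
  act (i , b) (u , v) = shift i u , substitute (i , b) v

  lookup-shift : ∀ i u j → lookup (shift i u) j ≡ lookup u (j Zm.⊕ Zm.⟦ toℕ i ⟧)
  lookup-shift i u j = Vec.lookup∘tabulate _ j

  lookup-substitute : ∀ i b v y → lookup (substitute (i , b) v) y ≡ lookup v (exp i ⊗ y ⊕ b)
  lookup-substitute i b v y = Vec.lookup∘tabulate (λ y → lookup v (exp i ⊗ y ⊕ b)) y

  act-ε : ∀ x → act ε x ≡ x
  act-ε (u , v) = cong₂ _,_
    (vec-ext (λ j → trans (lookup-shift Zn.0# u j)
      (cong (lookup u) (trans (cong (λ t → j Zm.⊕ Zm.⟦ t ⟧) toℕ-0ₙ) (Zm.⊕-identityʳ j)))))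
    (vec-ext (λ y → trans (lookup-substitute Zn.0# 0# v y)
      (cong (lookup v) (trans (⊕-identityʳ _) (trans (cong (_⊗ y) exp-0) (⊗-identityˡ y))))))

  Zm-⟦toℕ-⊕⟧ : ∀ i j → Zm.⟦ toℕ (i Zn.⊕ j) ⟧ ≡ Zm.⟦ toℕ i ⟧ Zm.⊕ Zm.⟦ toℕ j ⟧
  Zm-⟦toℕ-⊕⟧ i j = trans (cong (λ t → Zm.⟦ toℕ t ⟧) (Zn.⊕-def i j)) (trans (Zm.⟦⟧-cong-%
    (trans (cong (_% m) (Zn.toℕ-⟦⟧ (toℕ i + toℕ j))) (ℕ.m∣n⇒o%n%m≡o%m m n (toℕ i + toℕ j) m∣n)))
    (Zm.⟦⟧-+ (toℕ i) (toℕ j)))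

  act-∙ : ∀ h k x → act (h ∙ k) x ≡ act h (act k x)
  act-∙ (i , b) (j , c) (u , v) = cong₂ _,_
    (vec-ext (λ l → trans (lookup-shift (i Zn.⊕ j) u l) (trans
      (cong (lookup u) (trans (cong (l Zm.⊕_) (Zm-⟦toℕ-⊕⟧ i j)) (sym (Zm.⊕-assoc l _ _))))
      (sym (trans (lookup-shift i (shift j u) l) (lookup-shift j u _))))))
    (vec-ext (λ y → trans (lookup-substitute (i Zn.⊕ j) (exp j ⊗ b ⊕ c) v y) (trans
      (cong (lookup v) (trans (cong (λ t → t ⊗ y ⊕ (exp j ⊗ b ⊕ c)) (exp-⊕ i j))
        (solve 5 (λ e f y b c → (e :* f) :* y :+ (f :* b :+ c) := f :* (e :* y :+ b) :+ c) refl (exp i) (exp j) y b c)))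
      (sym (trans (lookup-substitute i b (substitute (j , c) v) y) (lookup-substitute j c v _))))))

  module B = Burnside isGroup act act-ε act-∙

  -- The direction is reversed because acting by preimage takes the target `y` back to the source
  -- `x`.
  orbit⇒equivalent : ∀ x y → B.Orbit y x → SetEquivalent (subset x) (subset y)
  orbit⇒equivalent x (u , v) ((i , b) , refl) = exp i , b , exp≢0 i ,
    by-index (λ z → rotationSet u (exp i ⊗ z) ≡ rotationSet (shift i u) z)
      (trans (cong (rotationSet u) (⊗-zeroʳ (exp i))) (trans (glue-0 false _) (sym (glue-0 false _))))
      (λ j → trans (cong (rotationSet u) (sym (↑-+ g (toℕ i) (toℕ j)))) (trans (rotationSet-↑ u (toℕ i + toℕ j))
        (trans (cong (lookup u) (trans (Zm.⟦⟧-+ (toℕ i) (toℕ j)) (Zm.⊕-comm _ _)))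
          (sym (trans (rotationSet-↑ (shift i u) (toℕ j)) (lookup-shift i u _)))))) ,
    (λ z → sym (lookup-substitute i b v z))

  equivalent⇒orbit : ∀ x y → SetEquivalent (subset x) (subset y) → B.Orbit y x
  equivalent⇒orbit (u , v) (u′ , v′) (a , b , a≢0 , R≡ , Q≡) = by-index
    (λ a → a ≢ 0# → (∀ z → rotationSet u′ (a ⊗ z) ≡ rotationSet u z) → (∀ z → lookup v′ (a ⊗ z ⊕ b) ≡ lookup v z) →
      B.Orbit (u′ , v′) (u , v))
    (λ 0≢0 _ _ → contradiction refl 0≢0)
    (λ i _ R≡ Q≡ → (i , b) , cong₂ _,_
      (vec-ext (λ j → begin
        lookup (shift i u′) j                        ≡⟨ lookup-shift i u′ j ⟩
        lookup u′ (j Zm.⊕ Zm.⟦ toℕ i ⟧)              ≡⟨ cong (lookup u′) (trans (cong (Zm._⊕ Zm.⟦ toℕ i ⟧) (sym (Zm.⟦⟧-toℕ j)))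
                                                         (trans (Zm.⊕-comm _ _) (sym (Zm.⟦⟧-+ (toℕ i) (toℕ j))))) ⟩
        lookup u′ Zm.⟦ toℕ i + toℕ j ⟧               ≡⟨ rotationSet-↑ u′ (toℕ i + toℕ j) ⟨
        rotationSet u′ (g ↑ (toℕ i + toℕ j))         ≡⟨ cong (rotationSet u′) (↑-+ g (toℕ i) (toℕ j)) ⟩
        rotationSet u′ (exp i ⊗ g ↑ toℕ j)           ≡⟨ R≡ (g ↑ toℕ j) ⟩
        rotationSet u (g ↑ toℕ j)                    ≡⟨ rotationSet-↑ u (toℕ j) ⟩
        lookup u Zm.⟦ toℕ j ⟧                        ≡⟨ cong (lookup u) (Zm.⟦⟧-toℕ j) ⟩
        lookup u j                                   ∎))
      (vec-ext (λ y → trans (lookup-substitute i b v′ y) (Q≡ y))))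
    a a≢0 R≡ Q≡
    where open ≡-Reasoning

  orbit-sym : ∀ x y → B.Orbit x y → B.Orbit y x
  orbit-sym x y (h , refl) = h ⁻¹ , B.act-inverseˡ h x

  representatives : List ConnectionSet
  representatives = map connectionSet B.reps

  representatives-separated : AllPairs (λ S T → ¬ CayIso (proj₁ S) (proj₁ T)) representatives
  representatives-separated = AllPairs.map⁺ (AllPairs.map
    (λ {x} {y} ¬orbit iso → ¬orbit (orbit-sym y x (equivalent⇒orbit x y (CayIso⇒equivalent (subset x) (subset y)
      (subset-isConnectionSet x) (subset-isConnectionSet y) iso)))) B.reps-separated)

  representatives-complete : (S : ConnectionSet) → Any (λ R → CayIso (proj₁ S) (proj₁ R)) representatives
  representatives-complete (S , S-conn) = Any.map⁺ (Any.map
    (λ {r} orbit → equivalent⇒CayIso S (subset r) (encoded r (orbit⇒equivalent (encode S) r (orbit-sym (encode S) r orbit))))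
    (B.reps-complete (encode S)))
    where
    encoded : ∀ r → SetEquivalent (subset (encode S)) (subset r) → SetEquivalent S (subset r)
    encoded r (a , b , a≢0 , R≡ , Q≡) = a , b , a≢0 ,
      (λ z → trans (R≡ z) (subset-encode S S-conn (z , false))) , (λ z → trans (Q≡ z) (subset-encode S S-conn (z , true)))

-- Sets invariant under an affine map

module FixedPoints (m : ℕ) .{{_ : NonZero m}} (p-prime : Prime (suc (2 * m))) where

  open Counting m p-prime
  open Zmod p
  open PrimeField p p-prime
  open Bicirculant p p-prime using (inverse; periodic⇒constant)
  open Solver using (solve; _:=_; _:+_; _:*_; :-_)

  card-Bool : card Bool ≡ 2
  card-Bool = ∑ᶠ-def {Bool} (λ _ → 1)

  Invariant : Fin n → Z → Vec Bool p → Set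
  Invariant i b v = ∀ y → lookup v (exp i ⊗ y ⊕ b) ≡ lookup v y

  invariant? : ∀ i b → Decidable (Invariant i b)
  invariant? i b v = ∀? (λ y → lookup v (exp i ⊗ y ⊕ b) ≟ lookup v y)

  -- The point 0 is fixed by the map, so membership of 0 is free and contributes the factor 2 beside
  -- the shift of the exponents.
  #-invariant-linear : ∀ i → # (invariant? i 0#) ≡ 2 * 2 ^ gcd (toℕ i) n
  #-invariant-linear i = begin
    # (invariant? i 0#)
      ≡⟨ #-bijection (invariant? i 0#) shift? split merge split-invariant merge-invariant
           (λ v _ → merge-split v) (λ sw _ → split-merge sw) ⟩
    # shift?
      ≡⟨ ∑ᶠ-× (λ sw → 𝟙 (shift? sw)) ⟩
    ∑ᶠ {Bool} (λ s → # (shiftInvariant? n (toℕ i)))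
      ≡⟨ ∑ᶠ-const {Bool} _ ⟩
    card Bool * # (shiftInvariant? n (toℕ i))
      ≡⟨ cong₂ _*_ card-Bool (#-shiftInvariant n (toℕ i)) ⟩
    2 * 2 ^ gcd (toℕ i) n ∎
    where
    open ≡-Reasoning
    shift? : Decidable (λ (sw : Bool × Vec Bool n) → ShiftInvariant n (toℕ i) (proj₂ sw))
    shift? sw = shiftInvariant? n (toℕ i) (proj₂ sw)
    split : Vec Bool p → Bool × Vec Bool n
    split v = lookup v 0# , tabulate (λ j → lookup v (exp j))
    merge : Bool × Vec Bool n → Vec Bool p
    merge (s , w) = tabulate (glue s (lookup w))
    lookup-merge : ∀ s w y → lookup (merge (s , w)) y ≡ glue s (lookup w) y
    lookup-merge s w y = Vec.lookup∘tabulate (glue s (lookup w)) y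
    exp-linear : ∀ j → exp i ⊗ exp j ⊕ 0# ≡ exp (j Zn.⊕ i)
    exp-linear j = trans (⊕-identityʳ _) (trans (⊗-comm (exp i) (exp j)) (sym (exp-⊕ j i)))
    0-linear : exp i ⊗ 0# ⊕ 0# ≡ 0#
    0-linear = trans (⊕-identityʳ _) (⊗-zeroʳ (exp i))
    split-invariant : ∀ v → Invariant i 0# v → ShiftInvariant n (toℕ i) (proj₂ (split v))
    split-invariant v inv j = begin
      lookup (proj₂ (split v)) (j Zn.⊕ Zn.⟦ toℕ i ⟧)  ≡⟨ Vec.lookup∘tabulate (λ j → lookup v (exp j)) _ ⟩
      lookup v (exp (j Zn.⊕ Zn.⟦ toℕ i ⟧))            ≡⟨ cong (λ t → lookup v (exp (j Zn.⊕ t))) (Zn.⟦⟧-toℕ i) ⟩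
      lookup v (exp (j Zn.⊕ i))                       ≡⟨ cong (lookup v) (exp-linear j) ⟨
      lookup v (exp i ⊗ exp j ⊕ 0#)                   ≡⟨ inv (exp j) ⟩
      lookup v (exp j)                                ≡⟨ Vec.lookup∘tabulate (λ j → lookup v (exp j)) j ⟨
      lookup (proj₂ (split v)) j                      ∎
    merge-invariant : ∀ sw → ShiftInvariant n (toℕ i) (proj₂ sw) → Invariant i 0# (merge sw)
    merge-invariant (s , w) inv = by-index (λ y → lookup (merge (s , w)) (exp i ⊗ y ⊕ 0#) ≡ lookup (merge (s , w)) y)
      (cong (lookup (merge (s , w))) 0-linear)
      (λ j → begin
        lookup (merge (s , w)) (exp i ⊗ exp j ⊕ 0#)   ≡⟨ cong (lookup (merge (s , w))) (exp-linear j) ⟩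
        lookup (merge (s , w)) (exp (j Zn.⊕ i))       ≡⟨ lookup-merge s w _ ⟩
        glue s (lookup w) (exp (j Zn.⊕ i))            ≡⟨ glue-exp s (lookup w) (j Zn.⊕ i) ⟩
        lookup w (j Zn.⊕ i)                           ≡⟨ cong (λ t → lookup w (j Zn.⊕ t)) (Zn.⟦⟧-toℕ i) ⟨
        lookup w (j Zn.⊕ Zn.⟦ toℕ i ⟧)                ≡⟨ inv j ⟩
        lookup w j                                    ≡⟨ glue-exp s (lookup w) j ⟨
        glue s (lookup w) (exp j)                     ≡⟨ lookup-merge s w (exp j) ⟨
        lookup (merge (s , w)) (exp j)                ∎)
    merge-split : ∀ v → merge (split v) ≡ v
    merge-split v = vec-ext (by-index (λ y → lookup (merge (split v)) y ≡ lookup v y)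
      (trans (lookup-merge (proj₁ (split v)) (proj₂ (split v)) 0#) (glue-0 (lookup v 0#) (lookup (proj₂ (split v)))))
      (λ j → trans (lookup-merge (proj₁ (split v)) (proj₂ (split v)) (exp j)) (trans (glue-exp (lookup v 0#) (lookup (proj₂ (split v))) j)
        (Vec.lookup∘tabulate (λ j → lookup v (exp j)) j))))
    split-merge : ∀ sw → split (merge sw) ≡ sw
    split-merge (s , w) = cong₂ _,_ (trans (lookup-merge s w 0#) (glue-0 s _))
      (vec-ext (λ j → trans (Vec.lookup∘tabulate (λ j → lookup (merge (s , w)) (exp j)) j)
        (trans (lookup-merge s w (exp j)) (glue-exp s (lookup w) j))))

  -- A non-identity multiplier makes the affine map conjugate, by a translation to its fixed point c,
  -- to a linear one.
  #-invariant-affine : ∀ i b → i ≢ Zn.0# → # (invariant? i b) ≡ # (invariant? i 0#)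
  #-invariant-affine i b i≢0 = from-inverse (inverse (1# ⊕ ⊖ exp i) (λ eq → exp≢1 i i≢0 (sym (⊖≡0⇒≡ 1# (exp i) eq))))
    where
    from-inverse : (∃ λ k → k ⊗ (1# ⊕ ⊖ exp i) ≡ 1#) → # (invariant? i b) ≡ # (invariant? i 0#)
    from-inverse (k , k[1-a]≡1) = #-bijection (invariant? i b) (invariant? i 0#) (translate c) (translate (⊖ c))
      (λ v inv y → begin
        lookup (translate c v) (a ⊗ y ⊕ 0#)   ≡⟨ lookup-translate c v _ ⟩
        lookup v (a ⊗ y ⊕ 0# ⊕ c)             ≡⟨ cong (λ t → lookup v (t ⊕ c)) (⊕-identityʳ (a ⊗ y)) ⟩
        lookup v (a ⊗ y ⊕ c)                  ≡⟨ cong (λ t → lookup v (a ⊗ y ⊕ t)) fixed ⟨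
        lookup v (a ⊗ y ⊕ (a ⊗ c ⊕ b))        ≡⟨ cong (lookup v) (solve 4 (λ a y c b → a :* y :+ (a :* c :+ b) := a :* (y :+ c) :+ b) refl a y c b) ⟩
        lookup v (a ⊗ (y ⊕ c) ⊕ b)            ≡⟨ inv (y ⊕ c) ⟩
        lookup v (y ⊕ c)                      ≡⟨ lookup-translate c v y ⟨
        lookup (translate c v) y              ∎)
      (λ w inv y → begin
        lookup (translate (⊖ c) w) (a ⊗ y ⊕ b)   ≡⟨ lookup-translate (⊖ c) w _ ⟩
        lookup w (a ⊗ y ⊕ b ⊕ ⊖ c)               ≡⟨ cong (λ t → lookup w (a ⊗ y ⊕ b ⊕ ⊖ t)) fixed ⟨
        lookup w (a ⊗ y ⊕ b ⊕ ⊖ (a ⊗ c ⊕ b))     ≡⟨ cong (lookup w) (solve 4 (λ a y c b → (a :* y :+ b) :+ :- (a :* c :+ b) := a :* (y :+ :- c)) refl a y c b) ⟩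
        lookup w (a ⊗ (y ⊕ ⊖ c))                 ≡⟨ cong (lookup w) (⊕-identityʳ _) ⟨
        lookup w (a ⊗ (y ⊕ ⊖ c) ⊕ 0#)            ≡⟨ inv (y ⊕ ⊖ c) ⟩
        lookup w (y ⊕ ⊖ c)                       ≡⟨ lookup-translate (⊖ c) w y ⟨
        lookup (translate (⊖ c) w) y             ∎)
      (λ v _ → vec-ext (λ y → trans (lookup-translate (⊖ c) (translate c v) y) (trans (lookup-translate c v _)
        (cong (lookup v) (solve 2 (λ y c → (y :+ :- c) :+ c := y) refl y c)))))
      (λ w _ → vec-ext (λ y → trans (lookup-translate c (translate (⊖ c) w) y) (trans (lookup-translate (⊖ c) w _)
        (cong (lookup w) (solve 2 (λ y c → (y :+ c) :+ :- c := y) refl y c)))))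
      where
      open ≡-Reasoning
      a c : Z
      a = exp i
      -- The fixed point b/(1 - a) of y ↦ a y + b.
      c = k ⊗ b
      translate : Z → Vec Bool p → Vec Bool p
      translate d v = tabulate (λ y → lookup v (y ⊕ d))
      lookup-translate : ∀ d v y → lookup (translate d v) y ≡ lookup v (y ⊕ d)
      lookup-translate d v y = Vec.lookup∘tabulate (λ y → lookup v (y ⊕ d)) y
      fixed : a ⊗ c ⊕ b ≡ c
      fixed = begin
        a ⊗ c ⊕ b                                   ≡⟨ cong (a ⊗ c ⊕_) (⊗-identityˡ b) ⟨
        a ⊗ c ⊕ 1# ⊗ b                              ≡⟨ cong (λ t → a ⊗ c ⊕ t ⊗ b) k[1-a]≡1 ⟨
        a ⊗ (k ⊗ b) ⊕ k ⊗ (1# ⊕ ⊖ a) ⊗ b            ≡⟨ solve 4 (λ a k b o → a :* (k :* b) :+ (k :* (o :+ :- a)) :* b := o :* (k :* b)) refl a k b 1# ⟩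
        1# ⊗ (k ⊗ b)                                ≡⟨ ⊗-identityˡ _ ⟩
        c                                           ∎

  -- A non-zero translation is a p-cycle on ℤ/p, so only the two constant vectors are invariant.
  #-invariant-translation : ∀ b → b ≢ 0# → # (invariant? Zn.0# b) ≡ 2
  #-invariant-translation b b≢0 = trans
    (#-bijection {Q = λ _ → ⊤} (invariant? Zn.0# b) (λ _ → yes tt) (λ v → lookup v 0#) (replicate p)
      (λ _ _ → tt) (λ s _ y → trans (Vec.lookup-replicate (exp Zn.0# ⊗ y ⊕ b) s) (sym (Vec.lookup-replicate y s)))
      (λ v inv → vec-ext (λ y → trans (Vec.lookup-replicate y (lookup v 0#))
        (sym (periodic⇒constant (lookup v) b b≢0 (period v inv) y))))
      (λ s _ → Vec.lookup-replicate 0# s))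
    card-Bool
    where
    period : ∀ v → Invariant Zn.0# b v → ∀ w → lookup v (w ⊕ b) ≡ lookup v w
    period v inv w = trans (cong (λ t → lookup v (t ⊕ b)) (sym (trans (cong (_⊗ w) exp-0) (⊗-identityˡ w)))) (inv w)

  fixed : G → ℕ
  fixed = B.#-fixed {λ _ → ⊤} (λ _ → yes tt) (λ _ _ → tt)

  fixed≡ : ∀ i b → fixed (i , b) ≡ 2 ^ gcd (toℕ i) m * # (invariant? i b)
  fixed≡ i b = begin
    fixed (i , b)
      ≡⟨ ∑ᶠ-cong (λ { (u , v) → trans
           (𝟙-cong (yes tt ×-dec (act (i , b) (u , v) ≟ (u , v))) (shiftInvariant? m (toℕ i) u ×-dec invariant? i b v)
             (λ { (_ , eq) → (λ j → trans (sym (lookup-shift i u j)) (cong (λ x → lookup (proj₁ x) j) eq)) ,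
                             (λ y → trans (sym (lookup-substitute i b v y)) (cong (λ x → lookup (proj₂ x) y) eq)) })
             (λ { (inv , inv′) → tt , cong₂ _,_ (vec-ext (λ j → trans (lookup-shift i u j) (inv j)))
                                               (vec-ext (λ y → trans (lookup-substitute i b v y) (inv′ y))) }))
           (𝟙-× (shiftInvariant? m (toℕ i) u) (invariant? i b v)) }) ⟩
    ∑ᶠ (λ (uv : X) → 𝟙 (shiftInvariant? m (toℕ i) (proj₁ uv)) * 𝟙 (invariant? i b (proj₂ uv)))
      ≡⟨ ∑ᶠ-*-∑ᶠ (λ u → 𝟙 (shiftInvariant? m (toℕ i) u)) (λ v → 𝟙 (invariant? i b v)) ⟩
    # (shiftInvariant? m (toℕ i)) * # (invariant? i b)
      ≡⟨ cong (_* # (invariant? i b)) (#-shiftInvariant m (toℕ i)) ⟩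
    2 ^ gcd (toℕ i) m * # (invariant? i b) ∎
    where open ≡-Reasoning

  term : ℕ → ℕ
  term i = 2 ^ gcd i m * 2 ^ gcd i n

  -- The identity contributes 2·2ⁿ, the other `n` translations 2 each. A 2 is added on both sides to
  -- separate b = 0 without subtraction.
  #-invariant-translations : ∑ᶠ (λ b → # (invariant? Zn.0# b)) ≡ n * 2 + 2 * 2 ^ n
  #-invariant-translations = ℕ.+-cancelˡ-≡ 2 _ _ (begin
    2 + ∑ᶠ W                                         ≡⟨ ℕ.+-comm 2 _ ⟩
    ∑ᶠ W + 2                                         ≡⟨ cong (∑ᶠ W +_) (∑ᶠ-δ 0# (λ _ → 2)) ⟨
    ∑ᶠ W + ∑ᶠ (λ b → 𝟙 (b ≟ 0#) * 2)                 ≡⟨ ∑ᶠ-+ _ _ ⟨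
    ∑ᶠ (λ b → W b + 𝟙 (b ≟ 0#) * 2)                  ≡⟨ ∑ᶠ-cong (λ b → pointwise b (b ≟ 0#)) ⟩
    ∑ᶠ (λ b → 2 + 𝟙 (b ≟ 0#) * (2 * 2 ^ n))          ≡⟨ ∑ᶠ-+ _ _ ⟩
    ∑ᶠ {Z} (λ b → 2) + ∑ᶠ (λ b → 𝟙 (b ≟ 0#) * (2 * 2 ^ n)) ≡⟨ cong₂ _+_ (trans (∑ᶠ-const {Z} 2) (cong (_* 2) (card-Fin p))) (∑ᶠ-δ 0# (λ _ → 2 * 2 ^ n)) ⟩
    2 + n * 2 + 2 * 2 ^ n                            ≡⟨ ℕ.+-assoc 2 (n * 2) _ ⟩
    2 + (n * 2 + 2 * 2 ^ n)                          ∎)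
    where
    open ≡-Reasoning
    W : Z → ℕ
    W b = # (invariant? Zn.0# b)
    pointwise : ∀ b (d : Dec (b ≡ 0#)) → W b + 𝟙 d * 2 ≡ 2 + 𝟙 d * (2 * 2 ^ n)
    pointwise b (no b≢0)   = cong (_+ 0) (#-invariant-translation b b≢0)
    pointwise b (yes refl) = trans (ℕ.+-comm (W 0#) 2) (cong (2 +_) (trans (#-invariant-linear Zn.0#)
      (trans (cong (λ t → 2 * 2 ^ gcd t n) toℕ-0ₙ) (trans (cong (λ t → 2 * 2 ^ t) (GCD.gcd-identityˡ n)) (sym (ℕ.+-identityʳ _))))))

  -- Every translation part `b` contributes equally unless i = 0, where the `n` non-zero ones leave
  -- only constant Q invariant. The deviation is stated as terms added on both sides, to stay within
  -- ℕ.
  row : ∀ i (d : Dec (i ≡ Zn.0#)) →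
    ∑ᶠ (λ b → fixed (i , b)) + 𝟙 d * (n * (2 ^ m * (2 * 2 ^ n))) ≡ p * 2 * term (toℕ i) + 𝟙 d * (n * (2 ^ m * 2))
  row i (no i≢0) = cong (_+ 0) (begin
    ∑ᶠ (λ b → fixed (i , b))                                    ≡⟨ ∑ᶠ-cong (λ b → trans (fixed≡ i b)
                                                                     (cong (2 ^ gcd (toℕ i) m *_) (trans (#-invariant-affine i b i≢0) (#-invariant-linear i)))) ⟩
    ∑ᶠ {Z} (λ b → 2 ^ gcd (toℕ i) m * (2 * 2 ^ gcd (toℕ i) n))  ≡⟨ ∑ᶠ-const {Z} _ ⟩
    card Z * (2 ^ gcd (toℕ i) m * (2 * 2 ^ gcd (toℕ i) n))      ≡⟨ cong (_* (2 ^ gcd (toℕ i) m * (2 * 2 ^ gcd (toℕ i) n))) (card-Fin p) ⟩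
    p * (2 ^ gcd (toℕ i) m * (2 * 2 ^ gcd (toℕ i) n))           ≡⟨ reorder p (2 ^ gcd (toℕ i) m) (2 ^ gcd (toℕ i) n) ⟩
    p * 2 * term (toℕ i)                                        ∎)
    where
    open ≡-Reasoning
    reorder : ∀ p x y → p * (x * (2 * y)) ≡ p * 2 * (x * y)
    reorder = solve-∀
  row i (yes refl) = begin
    ∑ᶠ (λ b → fixed (i , b)) + (n * (2 ^ m * (2 * 2 ^ n)) + 0)  ≡⟨ cong (_+ (n * (2 ^ m * (2 * 2 ^ n)) + 0)) (begin
      ∑ᶠ (λ b → fixed (i , b))                                    ≡⟨ ∑ᶠ-cong (λ b → trans (fixed≡ i b) (cong (_* # (invariant? i b)) U≡)) ⟩
      ∑ᶠ (λ b → 2 ^ m * # (invariant? i b))                       ≡⟨ ∑ᶠ-*ˡ (2 ^ m) _ ⟩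
      2 ^ m * ∑ᶠ (λ b → # (invariant? i b))                       ≡⟨ cong (2 ^ m *_) #-invariant-translations ⟩
      2 ^ m * (n * 2 + 2 * 2 ^ n)                                 ∎) ⟩
    2 ^ m * (n * 2 + 2 * 2 ^ n) + (n * (2 ^ m * (2 * 2 ^ n)) + 0) ≡⟨ reorder n (2 ^ m) (2 ^ n) ⟩
    p * 2 * (2 ^ m * 2 ^ n) + (n * (2 ^ m * 2) + 0)             ≡⟨ cong (λ t → p * 2 * t + (n * (2 ^ m * 2) + 0)) (cong₂ _*_ U≡
                                                                     (trans (cong (λ t → 2 ^ gcd t n) toℕ-0ₙ) (cong (2 ^_) (GCD.gcd-identityˡ n)))) ⟨
    p * 2 * term (toℕ Zn.0#) + (n * (2 ^ m * 2) + 0)            ∎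
    where
    open ≡-Reasoning
    U≡ : 2 ^ gcd (toℕ Zn.0#) m ≡ 2 ^ m
    U≡ = trans (cong (λ t → 2 ^ gcd t m) toℕ-0ₙ) (cong (2 ^_) (GCD.gcd-identityˡ m))
    reorder : ∀ n x y → x * (n * 2 + 2 * y) + (n * (x * (2 * y)) + 0) ≡ suc n * 2 * (x * y) + (n * (x * 2) + 0)
    reorder = solve-∀

  #-orbits : n * p * length B.reps + n * (2 ^ m * (2 * 2 ^ n)) ≡ p * 2 * ∑ᶠ {Fin n} (λ i → term (toℕ i)) + n * (2 ^ m * 2)
  #-orbits = begin
    n * p * length B.reps + n * (2 ^ m * (2 * 2 ^ n))
      ≡⟨ cong₂ _+_ orbits≡fixed (sym (∑ᶠ-δ Zn.0# (λ _ → n * (2 ^ m * (2 * 2 ^ n))))) ⟩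
    ∑ᶠ (λ i → ∑ᶠ (λ b → fixed (i , b))) + ∑ᶠ (λ i → 𝟙 (i ≟ Zn.0#) * (n * (2 ^ m * (2 * 2 ^ n))))
      ≡⟨ ∑ᶠ-+ _ _ ⟨
    ∑ᶠ (λ i → ∑ᶠ (λ b → fixed (i , b)) + 𝟙 (i ≟ Zn.0#) * (n * (2 ^ m * (2 * 2 ^ n))))
      ≡⟨ ∑ᶠ-cong (λ i → row i (i ≟ Zn.0#)) ⟩
    ∑ᶠ (λ i → p * 2 * term (toℕ i) + 𝟙 (i ≟ Zn.0#) * (n * (2 ^ m * 2)))
      ≡⟨ ∑ᶠ-+ _ _ ⟩
    ∑ᶠ {Fin n} (λ i → p * 2 * term (toℕ i)) + ∑ᶠ (λ i → 𝟙 (i ≟ Zn.0#) * (n * (2 ^ m * 2)))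
      ≡⟨ cong₂ _+_ (∑ᶠ-*ˡ {Fin n} (p * 2) _) (∑ᶠ-δ Zn.0# (λ _ → n * (2 ^ m * 2))) ⟩
    p * 2 * ∑ᶠ {Fin n} (λ i → term (toℕ i)) + n * (2 ^ m * 2) ∎
    where
    open ≡-Reasoning
    orbits≡fixed : n * p * length B.reps ≡ ∑ᶠ (λ i → ∑ᶠ (λ b → fixed (i , b)))
    orbits≡fixed = begin
      n * p * length B.reps
        ≡⟨ cong₂ _*_ (sym (trans (card-× {Fin n} {Z}) (cong₂ _*_ (card-Fin n) (card-Fin p))))
             (trans B.length-reps (#-cong _ _ (λ _ r → tt , r) (λ _ → proj₂))) ⟩
      card G * B.#-reps {λ _ → ⊤} (λ _ → yes tt) (λ _ _ → tt)
        ≡⟨ B.burnside {λ _ → ⊤} (λ _ → yes tt) (λ _ _ → tt) ⟨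
      ∑ᶠ fixed
        ≡⟨ ∑ᶠ-× fixed ⟩
      ∑ᶠ (λ i → ∑ᶠ (λ b → fixed (i , b))) ∎

-- The closed formula

open import Data.Integer using (+_; _-_)

-- `suc q` stands for p and `suc r` for p - 1. The counting identity over ℕ, with its negative term
-- on the left, is moved to ℤ, where that term can be subtracted again.
cross-multiplied : ∀ L A B S q r → suc r * suc q * L + suc r * B ≡ suc q * 2 * S + suc r * A →
  + L ℤ.* ↧ ((mkℚᵘ (+ 1) q ℚᵘ.* mkℚᵘ (+ A - + B) 0) ℚᵘ.+ (mkℚᵘ (+ 2) r ℚᵘ.* mkℚᵘ (+ S) 0))
  ≡ ↥ ((mkℚᵘ (+ 1) q ℚᵘ.* mkℚᵘ (+ A - + B) 0) ℚᵘ.+ (mkℚᵘ (+ 2) r ℚᵘ.* mkℚᵘ (+ S) 0)) ℤ.* + 1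
-- Multiplication by a fraction with denominator 1 leaves `q * 1` and `r * 1` in the denominators.
cross-multiplied L A B S q r eq rewrite ℕ.*-identityʳ q | ℕ.*-identityʳ r = begin
  + L ℤ.* (+ (suc q * suc r))                      ≡⟨ cong (+ L ℤ.*_) (ℤ.pos-* (suc q) (suc r)) ⟩
  + L ℤ.* (P ℤ.* N)                                ≡⟨ solve 4 (λ l p n b → l :* (p :* n) := (n :* p :* l :+ n :* b) :- n :* b) refl (+ L) P N (+ B) ⟩
  (N ℤ.* P ℤ.* + L ℤ.+ N ℤ.* + B) ℤ.- N ℤ.* + B    ≡⟨ cong (ℤ._- N ℤ.* + B) eqℤ ⟩
  (P ℤ.* + 2 ℤ.* + S ℤ.+ N ℤ.* + A) ℤ.- N ℤ.* + B  ≡⟨ solve 5 (λ p s n a b → (p :* con (+ 2) :* s :+ n :* a) :- n :* b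
                                                        := (con (+ 1) :* (a :- b) :* n :+ con (+ 2) :* s :* p) :* con (+ 1)) refl P (+ S) N (+ A) (+ B) ⟩
  (+ 1 ℤ.* (+ A - + B) ℤ.* N ℤ.+ + 2 ℤ.* + S ℤ.* P) ℤ.* + 1 ∎
  where
  open ≡-Reasoning
  open +-*-Solver
  P N : ℤ
  P = + suc q
  N = + suc r
  eqℤ : N ℤ.* P ℤ.* + L ℤ.+ N ℤ.* + B ≡ P ℤ.* + 2 ℤ.* + S ℤ.+ N ℤ.* + A
  eqℤ = begin
    N ℤ.* P ℤ.* + L ℤ.+ N ℤ.* + B      ≡⟨ cong₂ ℤ._+_ (trans (ℤ.pos-* (suc r * suc q) L) (cong (ℤ._* + L) (ℤ.pos-* (suc r) (suc q)))) (ℤ.pos-* (suc r) B) ⟨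
    + (suc r * suc q * L + suc r * B)  ≡⟨ cong +_ eq ⟩
    + (suc q * 2 * S + suc r * A)      ≡⟨ cong₂ ℤ._+_ (trans (ℤ.pos-* (suc q * 2) S) (cong (ℤ._* + S) (ℤ.pos-* (suc q) 2))) (ℤ.pos-* (suc r) A) ⟩
    P ℤ.* + 2 ℤ.* + S ℤ.+ N ℤ.* + A    ∎

-- Passing to unnormalised rationals avoids reduction to lowest terms; the passage is injective and
-- compatible with sums and products.
frac-identity : ∀ L A B S p n → .{{NonZero p}} → .{{NonZero n}} →
  n * p * L + n * B ≡ p * 2 * S + n * A →
  frac (+ L) 1 ≡ (frac (+ 1) p *ℚ frac (+ A - + B) 1) +ℚ (frac (+ 2) n *ℚ frac (+ S) 1)
frac-identity L A B S (suc q) (suc r) eq = ℚ.toℚᵘ-injective (begin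
  ℚ.toℚᵘ (frac (+ L) 1)                                         ≈⟨ toℚᵘ-frac (+ L) 0 ⟩
  mkℚᵘ (+ L) 0                                                  ≈⟨ *≡* (cross-multiplied L A B S q r eq) ⟩
  (mkℚᵘ (+ 1) q ℚᵘ.* mkℚᵘ (+ A - + B) 0) ℚᵘ.+ (mkℚᵘ (+ 2) r ℚᵘ.* mkℚᵘ (+ S) 0)
    ≈⟨ ℚᵘ.+-cong (ℚᵘ.*-cong (toℚᵘ-frac (+ 1) q) (toℚᵘ-frac (+ A - + B) 0)) (ℚᵘ.*-cong (toℚᵘ-frac (+ 2) r) (toℚᵘ-frac (+ S) 0)) ⟨
  (ℚ.toℚᵘ (frac (+ 1) (suc q)) ℚᵘ.* ℚ.toℚᵘ (frac (+ A - + B) 1)) ℚᵘ.+ (ℚ.toℚᵘ (frac (+ 2) (suc r)) ℚᵘ.* ℚ.toℚᵘ (frac (+ S) 1))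
    ≈⟨ ℚᵘ.+-cong (ℚ.toℚᵘ-homo-* (frac (+ 1) (suc q)) (frac (+ A - + B) 1)) (ℚ.toℚᵘ-homo-* (frac (+ 2) (suc r)) (frac (+ S) 1)) ⟨
  ℚ.toℚᵘ (frac (+ 1) (suc q) *ℚ frac (+ A - + B) 1) ℚᵘ.+ ℚ.toℚᵘ (frac (+ 2) (suc r) *ℚ frac (+ S) 1)
    ≈⟨ ℚ.toℚᵘ-homo-+ (frac (+ 1) (suc q) *ℚ frac (+ A - + B) 1) (frac (+ 2) (suc r) *ℚ frac (+ S) 1) ⟨
  ℚ.toℚᵘ ((frac (+ 1) (suc q) *ℚ frac (+ A - + B) 1) +ℚ (frac (+ 2) (suc r) *ℚ frac (+ S) 1)) ∎)
  where
  open ℚᵘ.≃-Reasoning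
  toℚᵘ-frac : ∀ i d → ℚ.toℚᵘ (frac i (suc d)) ≃ mkℚᵘ i d
  toℚᵘ-frac i d = ℚ.toℚᵘ-fromℚᵘ (mkℚᵘ i d)

oddPrime : ∀ {p} → Prime p → p ≢ 2 → ∃ λ m → p ≡ suc (2 * m)
oddPrime {p} p-prime p≢2 with p % 2 in eq | ℕ.m%n<n p 2
... | 0 | _ = contradiction (case Prime.prime⇒irreducible p-prime (∣.m%n≡0⇒n∣m p 2 eq) of λ
  { (inj₁ ()) ; (inj₂ 2≡p) → sym 2≡p }) p≢2
... | 1 | _ = p / 2 , trans (ℕ.m≡m%n+[m/n]*n p 2) (cong₂ _+_ eq (ℕ.*-comm (p / 2) 2))
... | suc (suc _) | s≤s (s≤s ())

-- The origin of the exponent gcd(2i, p - 1)/2 in the formula: it is the number of cycles of a shift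
-- by i on ℤ/m.
gcd-double : ∀ i m → gcd (2 * i) (2 * m) / 2 ≡ gcd i m
gcd-double i m = trans (cong (_/ 2) (trans (sym (GCD.c*gcd[m,n]≡gcd[cm,cn] 2 i m)) (ℕ.*-comm 2 (gcd i m)))) (ℕ.m*n/n≡m (gcd i m) 2)

∑ᶠ-toℕ : ∀ n (f : ℕ → ℕ) → ∑ᶠ {Fin n} (f ∘ toℕ) ≡ sum (map f (upTo n))
∑ᶠ-toℕ n f = trans (∑ᶠ-def {Fin n} (f ∘ toℕ)) (trans (sym (∑-map toℕ (allFin n) f))
  (cong (λ xs → ∑ xs f) (trans (List.map-tabulate id toℕ) (tabulate-toℕ n id))))
  where
  tabulate-toℕ : ∀ n (h : ℕ → ℕ) → Data.List.tabulate {n = n} (h ∘ toℕ) ≡ Data.List.applyUpTo h n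
  tabulate-toℕ zero    h = refl
  tabulate-toℕ (suc n) h = cong (h 0 ∷_) (tabulate-toℕ n (h ∘ suc))

module Enumeration (m : ℕ) .{{_ : NonZero m}} (p-prime : Prime (suc (2 * m))) where

  open Counting m p-prime
  open FixedPoints m p-prime

  exponent₁ : (p + 1) / 2 ≡ suc m
  exponent₁ = trans (cong (_/ 2) (double m)) (ℕ.m*n/n≡m (suc m) 2)
    where
    double : ∀ m → suc (2 * m) + 1 ≡ suc m * 2
    double = solve-∀

  exponent₂ : (3 * p ∸ 1) / 2 ≡ suc (m + n)
  exponent₂ = trans (cong (λ t → (t ∸ 1) / 2) (double m)) (ℕ.m*n/n≡m (suc (m + n)) 2)
    where
    double : ∀ m → 3 * suc (2 * m) ≡ suc (suc (m + 2 * m) * 2)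
    double = solve-∀

  terms : ∑ᶠ {Fin n} (λ i → term (toℕ i)) ≡ sum (map (λ i → 2 ^ (gcd (2 * i) n / 2 + gcd i n)) (upTo n))
  terms = trans (∑ᶠ-cong {Fin n} (λ i → trans (sym (ℕ.^-distribˡ-+-* 2 (gcd (toℕ i) m) (gcd (toℕ i) n)))
    (cong (λ t → 2 ^ (t + gcd (toℕ i) n)) (sym (gcd-double (toℕ i) m)))))
    (∑ᶠ-toℕ n (λ i → 2 ^ (gcd (2 * i) n / 2 + gcd i n)))

  #-representatives : n * p * length representatives + n * 2 ^ ((3 * p ∸ 1) / 2)
    ≡ p * 2 * sum (map (λ i → 2 ^ (gcd (2 * i) n / 2 + gcd i n)) (upTo n)) + n * 2 ^ ((p + 1) / 2)
  #-representatives = begin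
    n * p * length representatives + n * 2 ^ ((3 * p ∸ 1) / 2)
      ≡⟨ cong₂ (λ s t → n * p * s + n * t) (List.length-map connectionSet B.reps) power₂ ⟩
    n * p * length B.reps + n * (2 ^ m * (2 * 2 ^ n))
      ≡⟨ #-orbits ⟩
    p * 2 * ∑ᶠ {Fin n} (λ i → term (toℕ i)) + n * (2 ^ m * 2)
      ≡⟨ cong₂ (λ s t → p * 2 * s + n * t) terms (trans (ℕ.*-comm (2 ^ m) 2) (cong (2 ^_) (sym exponent₁))) ⟩
    p * 2 * sum (map (λ i → 2 ^ (gcd (2 * i) n / 2 + gcd i n)) (upTo n)) + n * 2 ^ ((p + 1) / 2) ∎
    where
    open ≡-Reasoning
    reorder : ∀ x y → 2 * (x * y) ≡ x * (2 * y)
    reorder = solve-∀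
    power₂ : 2 ^ ((3 * p ∸ 1) / 2) ≡ 2 ^ m * (2 * 2 ^ n)
    power₂ = trans (cong (2 ^_) exponent₂) (trans (cong (2 *_) (ℕ.^-distribˡ-+-* 2 m n)) (reorder (2 ^ m) (2 ^ n)))

  formula : frac (+ length representatives) 1
    ≡ (frac (+ 1) p *ℚ frac (+ (2 ^ ((p + 1) / 2)) - + (2 ^ ((3 * p ∸ 1) / 2))) 1)
      +ℚ (frac (+ 2) n *ℚ frac (+ sum (map (λ i → 2 ^ (gcd (2 * i) n / 2 + gcd i n)) (upTo n))) 1)
  formula = frac-identity (length representatives) (2 ^ ((p + 1) / 2)) (2 ^ ((3 * p ∸ 1) / 2))
    (sum (map (λ i → 2 ^ (gcd (2 * i) n / 2 + gcd i n)) (upTo n))) p n #-representatives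

theorem4p3 : (p : ℕ) → .{{_ : NonZero p}} → Prime p → p ≢ 2 →
    let open Dihedral p in
    Σ (List ConnectionSet) λ reps →
    AllPairs (λ S T → ¬ CayIso (proj₁ S) (proj₁ T)) reps
    × (∀ (S : ConnectionSet) → Any (λ R → CayIso (proj₁ S) (proj₁ R)) reps)
    × (frac (+ length reps) 1
    ≡ (frac (+ 1) p *ℚ frac (+ (2 ^ ((p + 1) / 2)) - + (2 ^ ((3 * p ∸ 1) / 2))) 1)
    +ℚ (frac (+ 2) (p ∸ 1)
    *ℚ frac (+ sum (map (λ i → 2 ^ (gcd (2 * i) (p ∸ 1) / 2 + gcd i (p ∸ 1)))
    (upTo (p ∸ 1)))) 1))
theorem4p3 p p-prime p≢2 with oddPrime p-prime p≢2
... | zero      , refl = contradiction p-prime Prime.¬prime[1]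
... | m@(suc _) , refl = representatives , representatives-separated , representatives-complete , formula
  where
  open Counting m p-prime using (representatives; representatives-separated; representatives-complete)
  open Enumeration m p-prime using (formula)
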